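{- Let $X,Y$ be computable metric spaces, let $Y$ be co-c.e. compact and let $A\subseteq X\times Y$ be co-c.e. closed. If $(\forall x\in X)(\exists y\in Y)\,(x,y)\in A$, then the multi-valued map $R:X\rightrightarrows Y$, $x\mapsto\{y\in Y:(x,y)\in A\}$ satisfies $R\le_W\mathsf{C_K}$.
   Context: A represented space is a pair $(X,\delta_X)$ with $\delta_X:\subseteq\mathbb N^{\mathbb N}\to X$ a partial surjection; computable metric spaces carry their Cauchy representation. For a partial multi-valued map $f:\subseteq X\rightrightarrows Y$ between represented spaces, a realizer of $f$ is a partial function $F:\subseteq\mathbb N^{\mathbb N}\to\mathbb N^{\mathbb N}$ with $\delta_Y(F(p))\in f(\delta_X(p))$ for all $p\in\mathrm{dom}(f\circ\delta_X)$. We write $f\le_W g$ (Weihrauch reducibility) if there are computable partial functions $H,K:\subseteq\mathbb N^{\mathbb N}\to\mathbb N^{\mathbb N}$ such that for every realizer $G$ of $g$ the function $p\mapsto H\langle p,G(K(p))\rangle$ is a realizer of $f$, where $\langle\cdot,\cdot\rangle$ is a standard computable pairing on $\mathbb N^{\mathbb N}$. For a computable metric space $Z$, $\mathcal A_-(Z)$ is the set of closed subsets of $Z$, where a name of $A$ is an enumeration of rational open balls (centers from the dense sequence, rational radii) whose union is $Z\setminus A$; $A$ is co-c.e. closed if it has a computable name. $Y$ is co-c.e. compact if $Y$ is compact and the set of all finite lists of rational open balls covering $Y$ is computably enumerable. $\mathsf{C_K}:\subseteq\mathcal A_-([0,1])\rightrightarrows[0,1]$, $A\mapsto A$, defined on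 non-empty closed $A\subseteq[0,1]$ (compact choice). -}

module Defs where

open import Axiom.ExcludedMiddle using (ExcludedMiddle)
open import Data.Empty using (⊥-elim)
open import Data.Fin.Base using (Fin)
open import Data.Integer.Base as ℤ using (+_; -[1+_])
import Data.Integer.Properties as ℤₚ
open import Data.List.Base using (List; []; _∷_)
open import Data.List.Relation.Unary.Any using (Any)
open import Data.Nat.Base as ℕ using (ℕ; zero; suc)
import Data.Nat.Properties as ℕₚ
open import Data.Product.Base using (_×_; _,_; ∃; ∃-syntax; Σ-syntax; proj₁; proj₂; map₂)
open import Data.Product.Relation.Binary.Pointwise.NonDependent using (×-setoid)
open import Data.Rational.Base as ℚ using (ℚ; mkℚ; 0ℚ; 1ℚ; ½)
import Data.Rational.Properties as ℚₚ
open import Data.Rational.Solver using (module +-*-Solver)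
open import Data.Rational.Unnormalised.Base as ℚᵘ using (mkℚᵘ)
import Data.Rational.Unnormalised.Properties as ℚᵘₚ
open import Data.Sum.Base using (inj₁; inj₂)
open import Data.Vec.Base using (Vec; []; _∷_; lookup)
open import Data.Vec.Relation.Binary.Pointwise.Inductive using (Pointwise)
open import Function.Bundles using (_⇔_; mk⇔; module Equivalence)
open import Function.Metric.Structures using (IsGeneralMetric)
open import Level using (0ℓ) renaming (suc to lsuc; _⊔_ to _⊔ℓ_)
open import Relation.Binary.Bundles using (Setoid)
open import Relation.Binary.Core using (Rel)
open import Relation.Binary.PropositionalEquality using (_≡_; _≗_; refl; sym; trans; cong; cong₂; subst; subst₂; _→-setoid_)
open import Relation.Binary.Structures using (IsEquivalence; IsPartialOrder)
open import Relation.Nullary.Decidable.Core using (Dec; yes; no; decidable-stable)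
open import Relation.Nullary.Negation.Core using (¬_)
open import Relation.Unary using (Pred; ∁; _∈_)

------------------------------------------------------------------------
-- Rational arithmetic

½^_ : ℕ → ℚ
½^ zero  = 1ℚ
½^ suc n = ½ ℚ.* ½^ n

half+half : ∀ q → ½ ℚ.* q ℚ.+ ½ ℚ.* q ≡ q
half+half q = trans (sym (ℚₚ.*-distribʳ-+ q ½ ½)) (ℚₚ.*-identityˡ q)

½-pos : ∀ {q} → 0ℚ ℚ.< q → 0ℚ ℚ.< ½ ℚ.* q
½-pos {q} 0<q = subst (ℚ._< ½ ℚ.* q) (ℚₚ.*-zeroʳ ½) (ℚₚ.*-monoʳ-<-pos ½ 0<q)

½^-pos : ∀ n → 0ℚ ℚ.< ½^ n
½^-pos zero    = ℚₚ.positive⁻¹ 1ℚ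
½^-pos (suc n) = ½-pos (½^-pos n)

q≤q+ε : ∀ q {ε} → 0ℚ ℚ.< ε → q ℚ.≤ q ℚ.+ ε
q≤q+ε q {ε} 0<ε = subst (ℚ._≤ q ℚ.+ ε) (ℚₚ.+-identityʳ q) (ℚₚ.+-monoʳ-≤ q (ℚₚ.<⇒≤ 0<ε))

½q≤q : ∀ {q} → 0ℚ ℚ.< q → ½ ℚ.* q ℚ.≤ q
½q≤q {q} 0<q = subst (½ ℚ.* q ℚ.≤_) (half+half q) (q≤q+ε (½ ℚ.* q) (½-pos 0<q))

½^-anti : ∀ {m n} → m ℕ.≤ n → ½^ n ℚ.≤ ½^ m
½^-anti {n = zero}  ℕ.z≤n = ℚₚ.≤-refl
½^-anti {n = suc n} ℕ.z≤n = ℚₚ.≤-trans (½q≤q (½^-pos n)) (½^-anti {n = n} ℕ.z≤n)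
½^-anti (ℕ.s≤s m≤n) = ℚₚ.*-monoˡ-≤-nonNeg ½ (½^-anti m≤n)

½^≤1/ : ∀ n → ½^ n ℚ.≤ ℚ.fromℚᵘ (mkℚᵘ (+ 1) n)
½^≤1/ zero    = ℚₚ.≤-refl
½^≤1/ (suc n) = ℚₚ.≤-trans (ℚₚ.*-monoˡ-≤-nonNeg ½ (½^≤1/ n)) (ℚₚ.toℚᵘ-cancel-≤ step)
  where
  open ℚᵘₚ.≤-Reasoning
  1/n = mkℚᵘ (+ 1) n
  step : ℚ.toℚᵘ (½ ℚ.* ℚ.fromℚᵘ 1/n) ℚᵘ.≤ ℚ.toℚᵘ (ℚ.fromℚᵘ (mkℚᵘ (+ 1) (suc n)))
  step = begin
    ℚ.toℚᵘ (½ ℚ.* ℚ.fromℚᵘ 1/n)               ≃⟨ ℚₚ.toℚᵘ-homo-* ½ (ℚ.fromℚᵘ 1/n) ⟩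
    ℚ.toℚᵘ ½ ℚᵘ.* ℚ.toℚᵘ (ℚ.fromℚᵘ 1/n)       ≃⟨ ℚᵘₚ.*-congˡ {ℚ.toℚᵘ ½} (ℚₚ.toℚᵘ-fromℚᵘ 1/n) ⟩
    ℚ.toℚᵘ ½ ℚᵘ.* 1/n                         ≤⟨ ℚᵘ.*≤* (ℤ.+≤+ (ℕ.s≤s bound)) ⟩
    mkℚᵘ (+ 1) (suc n)                        ≃⟨ ℚₚ.toℚᵘ-fromℚᵘ _ ⟨
    ℚ.toℚᵘ (ℚ.fromℚᵘ (mkℚᵘ (+ 1) (suc n)))    ∎
    where
    bound : suc n ℕ.+ 0 ℕ.≤ n ℕ.+ suc (n ℕ.+ 0) ℕ.+ 0
    bound = ℕₚ.+-monoˡ-≤ 0 (subst (ℕ._≤ n ℕ.+ suc (n ℕ.+ 0)) (ℕₚ.+-comm n 1)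
              (ℕₚ.+-monoʳ-≤ n (ℕ.s≤s ℕ.z≤n)))

archimedean : ∀ {ε} → 0ℚ ℚ.< ε → ∃[ n ] ½^ n ℚ.≤ ε
archimedean {mkℚ (+ zero)   d c} 0<ε = ⊥-elim (ℚₚ.<-irrefl (sym (ℚₚ.↥p≡0⇒p≡0 _ refl)) 0<ε)
archimedean {mkℚ -[1+ a ]   d c} 0<ε = ⊥-elim (ℚₚ.<-asym 0<ε (ℚₚ.negative⁻¹ _))
archimedean {ε@(mkℚ (+ suc a) d c)} 0<ε = d , ℚₚ.≤-trans (½^≤1/ d) (ℚₚ.toℚᵘ-cancel-≤ step)
  where
  open ℚᵘₚ.≤-Reasoning
  step : ℚ.toℚᵘ (ℚ.fromℚᵘ (mkℚᵘ (+ 1) d)) ℚᵘ.≤ ℚ.toℚᵘ ε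
  step = begin
    ℚ.toℚᵘ (ℚ.fromℚᵘ (mkℚᵘ (+ 1) d))  ≃⟨ ℚₚ.toℚᵘ-fromℚᵘ _ ⟩
    mkℚᵘ (+ 1) d                      ≤⟨ ℚᵘ.*≤* (ℤₚ.*-monoʳ-≤-nonNeg (+ suc d) {+ 1} {+ suc a} (ℤ.+≤+ (ℕ.s≤s ℕ.z≤n))) ⟩
    ℚ.toℚᵘ ε                          ∎

p≤∣p∣ : ∀ p → p ℚ.≤ ℚ.∣ p ∣
p≤∣p∣ p with ℚₚ.≤-total 0ℚ p
... | inj₁ 0≤p = ℚₚ.≤-reflexive (sym (ℚₚ.0≤p⇒∣p∣≡p 0≤p))
... | inj₂ p≤0 = ℚₚ.≤-trans p≤0 (ℚₚ.0≤∣p∣ p)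

∣p-q∣≡∣q-p∣ : ∀ p q → ℚ.∣ p ℚ.- q ∣ ≡ ℚ.∣ q ℚ.- p ∣
∣p-q∣≡∣q-p∣ p q = trans (sym (ℚₚ.∣-p∣≡∣p∣ (p ℚ.- q)))
  (cong ℚ.∣_∣ (solve 2 (λ p q → :- (p :- q) := q :- p) refl p q))
  where open +-*-Solver

∣-∣≤⇒≤+ : ∀ p q {ε} → ℚ.∣ p ℚ.- q ∣ ℚ.≤ ε → p ℚ.≤ q ℚ.+ ε
∣-∣≤⇒≤+ p q {ε} h = subst (ℚ._≤ q ℚ.+ ε) (solve 2 (λ p q → q :+ (p :- q) := p) refl p q)
  (ℚₚ.+-monoʳ-≤ q (ℚₚ.≤-trans (p≤∣p∣ (p ℚ.- q)) h))
  where open +-*-Solver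

∣-∣≤⇒≤+′ : ∀ p q {ε} → ℚ.∣ p ℚ.- q ∣ ℚ.≤ ε → q ℚ.≤ p ℚ.+ ε
∣-∣≤⇒≤+′ p q {ε} h = ∣-∣≤⇒≤+ q p (subst (ℚ._≤ ε) (∣p-q∣≡∣q-p∣ p q) h)

≤+⇒-≤ : ∀ p q {ε} → p ℚ.≤ q ℚ.+ ε → p ℚ.- q ℚ.≤ ε
≤+⇒-≤ p q {ε} h = subst (p ℚ.- q ℚ.≤_) (solve 2 (λ q e → (q :+ e) :- q := e) refl q ε)
  (ℚₚ.+-monoˡ-≤ (ℚ.- q) {p} {q ℚ.+ ε} h)
  where open +-*-Solver

≤+⇒∣-∣≤ : ∀ p q {ε} → p ℚ.≤ q ℚ.+ ε → q ℚ.≤ p ℚ.+ ε → ℚ.∣ p ℚ.- q ∣ ℚ.≤ ε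
≤+⇒∣-∣≤ p q {ε} h k with ℚₚ.∣p∣≡p∨∣p∣≡-p (p ℚ.- q)
... | inj₁ e = subst (ℚ._≤ ε) (sym e) (≤+⇒-≤ p q h)
... | inj₂ e = subst (ℚ._≤ ε) (trans (solve 2 (λ p q → q :- p := :- (p :- q)) refl p q) (sym e)) (≤+⇒-≤ q p k)
  where open +-*-Solver

+-swap-ε : ∀ p q ε → (p ℚ.+ ½ ℚ.* ε) ℚ.+ (q ℚ.+ ½ ℚ.* ε) ≡ (p ℚ.+ q) ℚ.+ ε
+-swap-ε p q ε = trans
  (solve 3 (λ p q e → (p :+ e) :+ (q :+ e) := (p :+ q) :+ (e :+ e)) refl p q (½ ℚ.* ε))
  (cong ((p ℚ.+ q) ℚ.+_) (half+half ε))
  where open +-*-Solver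

+½+½ : ∀ p ε → (p ℚ.+ ½ ℚ.* ε) ℚ.+ ½ ℚ.* ε ≡ p ℚ.+ ε
+½+½ p ε = trans (ℚₚ.+-assoc p (½ ℚ.* ε) (½ ℚ.* ε)) (cong (p ℚ.+_) (half+half ε))

⊔-≤+ : ∀ {p q r s ε} → p ℚ.≤ r ℚ.+ ε → q ℚ.≤ s ℚ.+ ε → p ℚ.⊔ q ℚ.≤ (r ℚ.⊔ s) ℚ.+ ε
⊔-≤+ {r = r} {s} {ε} h k = ℚₚ.⊔-lub
  (ℚₚ.≤-trans h (ℚₚ.+-monoˡ-≤ ε (ℚₚ.p≤p⊔q r s)))
  (ℚₚ.≤-trans k (ℚₚ.+-monoˡ-≤ ε (ℚₚ.p≤q⊔p r s)))

------------------------------------------------------------------------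
-- Real numbers as Cauchy sequences of rationals

Eventually : Pred ℕ 0ℓ → Set
Eventually P = ∃[ N ] (∀ n → N ℕ.≤ n → P n)

always : ∀ {P : Pred ℕ 0ℓ} → (∀ n → P n) → Eventually P
always f = 0 , λ n _ → f n

ev-map₂ : ∀ {P Q R : Pred ℕ 0ℓ} → (∀ n → P n → Q n → R n) → Eventually P → Eventually Q → Eventually R
ev-map₂ f (N , h) (M , k) = N ℕ.⊔ M , λ n le →
  f n (h n (ℕₚ.≤-trans (ℕₚ.m≤m⊔n N M) le)) (k n (ℕₚ.≤-trans (ℕₚ.m≤n⊔m N M) le))

ev-map : ∀ {P Q : Pred ℕ 0ℓ} → (∀ n → P n → Q n) → Eventually P → Eventually Q
ev-map f (N , h) = N , λ n le → f n (h n le)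

ev-witness : ∀ {P : Pred ℕ 0ℓ} → Eventually P → ∃ P
ev-witness (N , h) = N , h N ℕₚ.≤-refl

IsCauchy : (ℕ → ℚ) → Set
IsCauchy s = ∀ ε → 0ℚ ℚ.< ε → ∃[ N ] (∀ m n → N ℕ.≤ m → N ℕ.≤ n → ℚ.∣ s m ℚ.- s n ∣ ℚ.≤ ε)

-- Without η, the operations below do not unfold during unification.

record ℝ : Set where
  no-eta-equality
  field
    seq    : ℕ → ℚ
    cauchy : IsCauchy seq

open ℝ public

infix  4 _≤ᴿ_ _<ᴿ_ _≃_
infixl 6 _+ᴿ_ _⊔ᴿ_

record _≤ᴿ_ (x y : ℝ) : Set where
  constructor mk≤
  field
    eventually-≤ : ∀ ε → 0ℚ ℚ.< ε → Eventually λ n → seq x n ℚ.≤ seq y n ℚ.+ ε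

open _≤ᴿ_ public

record _<ᴿ_ (x y : ℝ) : Set where
  constructor mk<
  field
    gap          : ℚ
    gap-pos      : 0ℚ ℚ.< gap
    eventually-< : Eventually λ n → seq x n ℚ.+ gap ℚ.≤ seq y n

open _<ᴿ_ public

_≃_ : Rel ℝ 0ℓ
x ≃ y = x ≤ᴿ y × y ≤ᴿ x

real : ℚ → ℝ
real q .seq _ = q
real q .cauchy ε 0<ε = 0 , λ _ _ _ _ → ≤+⇒∣-∣≤ q q (q≤q+ε q 0<ε) (q≤q+ε q 0<ε)

0ᴿ : ℝ
0ᴿ = real 0ℚ

lift-cauchy : (f : ℚ → ℚ → ℚ) →
  (∀ {p p′ q q′ ε} → p ℚ.≤ p′ ℚ.+ ½ ℚ.* ε → p′ ℚ.≤ p ℚ.+ ½ ℚ.* ε →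
     q ℚ.≤ q′ ℚ.+ ½ ℚ.* ε → q′ ℚ.≤ q ℚ.+ ½ ℚ.* ε → 0ℚ ℚ.< ε → f p q ℚ.≤ f p′ q′ ℚ.+ ε) →
  ∀ x y → IsCauchy λ n → f (seq x n) (seq y n)
lift-cauchy f f-cont x y ε 0<ε =
  let N , h = cauchy x (½ ℚ.* ε) (½-pos 0<ε)
      M , k = cauchy y (½ ℚ.* ε) (½-pos 0<ε)
  in N ℕ.⊔ M , λ m n le le′ →
     let a  = h m n (ℕₚ.≤-trans (ℕₚ.m≤m⊔n N M) le) (ℕₚ.≤-trans (ℕₚ.m≤m⊔n N M) le′)
         b  = k m n (ℕₚ.≤-trans (ℕₚ.m≤n⊔m N M) le) (ℕₚ.≤-trans (ℕₚ.m≤n⊔m N M) le′)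
     in ≤+⇒∣-∣≤ (f (seq x m) (seq y m)) (f (seq x n) (seq y n))
          (f-cont {seq x m} {seq x n} {seq y m} {seq y n}
             (∣-∣≤⇒≤+ (seq x m) (seq x n) a) (∣-∣≤⇒≤+′ (seq x m) (seq x n) a)
             (∣-∣≤⇒≤+ (seq y m) (seq y n) b) (∣-∣≤⇒≤+′ (seq y m) (seq y n) b) 0<ε)
          (f-cont {seq x n} {seq x m} {seq y n} {seq y m}
             (∣-∣≤⇒≤+′ (seq x m) (seq x n) a) (∣-∣≤⇒≤+ (seq x m) (seq x n) a)
             (∣-∣≤⇒≤+′ (seq y m) (seq y n) b) (∣-∣≤⇒≤+ (seq y m) (seq y n) b) 0<ε)

+-cont : ∀ {p p′ q q′ ε} → p ℚ.≤ p′ ℚ.+ ½ ℚ.* ε → q ℚ.≤ q′ ℚ.+ ½ ℚ.* ε → p ℚ.+ q ℚ.≤ (p′ ℚ.+ q′) ℚ.+ ε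
+-cont {p} {p′} {q} {q′} {ε} h k = subst (p ℚ.+ q ℚ.≤_) (+-swap-ε p′ q′ ε) (ℚₚ.+-mono-≤ h k)

∣-∣-triangle : ∀ p q r → ℚ.∣ p ℚ.- r ∣ ℚ.≤ ℚ.∣ p ℚ.- q ∣ ℚ.+ ℚ.∣ q ℚ.- r ∣
∣-∣-triangle p q r = subst (λ t → ℚ.∣ t ∣ ℚ.≤ ℚ.∣ p ℚ.- q ∣ ℚ.+ ℚ.∣ q ℚ.- r ∣)
  (solve 3 (λ p q r → (p :- q) :+ (q :- r) := p :- r) refl p q r) (ℚₚ.∣p+q∣≤∣p∣+∣q∣ (p ℚ.- q) (q ℚ.- r))
  where open +-*-Solver

∣-∣-cont : ∀ {p p′ q q′ ε} → p ℚ.≤ p′ ℚ.+ ½ ℚ.* ε → p′ ℚ.≤ p ℚ.+ ½ ℚ.* ε →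
           q ℚ.≤ q′ ℚ.+ ½ ℚ.* ε → q′ ℚ.≤ q ℚ.+ ½ ℚ.* ε → ℚ.∣ p ℚ.- q ∣ ℚ.≤ ℚ.∣ p′ ℚ.- q′ ∣ ℚ.+ ε
∣-∣-cont {p} {p′} {q} {q′} {ε} h h′ k k′ = begin
  ℚ.∣ p ℚ.- q ∣                                                    ≤⟨ ∣-∣-triangle p p′ q ⟩
  ℚ.∣ p ℚ.- p′ ∣ ℚ.+ ℚ.∣ p′ ℚ.- q ∣                                ≤⟨ ℚₚ.+-mono-≤ (≤+⇒∣-∣≤ p p′ h h′) (∣-∣-triangle p′ q′ q) ⟩
  ½ ℚ.* ε ℚ.+ (ℚ.∣ p′ ℚ.- q′ ∣ ℚ.+ ℚ.∣ q′ ℚ.- q ∣)                 ≤⟨ ℚₚ.+-monoʳ-≤ (½ ℚ.* ε) (ℚₚ.+-monoʳ-≤ ℚ.∣ p′ ℚ.- q′ ∣ (≤+⇒∣-∣≤ q′ q k′ k)) ⟩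
  ½ ℚ.* ε ℚ.+ (ℚ.∣ p′ ℚ.- q′ ∣ ℚ.+ ½ ℚ.* ε)                        ≡⟨ ℚₚ.+-comm (½ ℚ.* ε) (ℚ.∣ p′ ℚ.- q′ ∣ ℚ.+ ½ ℚ.* ε) ⟩
  (ℚ.∣ p′ ℚ.- q′ ∣ ℚ.+ ½ ℚ.* ε) ℚ.+ ½ ℚ.* ε                        ≡⟨ +½+½ ℚ.∣ p′ ℚ.- q′ ∣ ε ⟩
  ℚ.∣ p′ ℚ.- q′ ∣ ℚ.+ ε                                            ∎
  where open ℚₚ.≤-Reasoning

_+ᴿ_ : ℝ → ℝ → ℝ
(x +ᴿ y) .seq n = seq x n ℚ.+ seq y n
(x +ᴿ y) .cauchy = lift-cauchy ℚ._+_
  (λ {p} {p′} {q} {q′} h _ k _ _ → +-cont {p} {p′} {q} {q′} h k) x y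

_⊔ᴿ_ : ℝ → ℝ → ℝ
(x ⊔ᴿ y) .seq n = seq x n ℚ.⊔ seq y n
(x ⊔ᴿ y) .cauchy = lift-cauchy ℚ._⊔_ (λ {_} {p′} {_} {q′} h _ k _ 0<ε → ⊔-≤+ {r = p′} {q′}
  (ℚₚ.≤-trans h (ℚₚ.+-monoʳ-≤ p′ (½q≤q 0<ε)))
  (ℚₚ.≤-trans k (ℚₚ.+-monoʳ-≤ q′ (½q≤q 0<ε)))) x y

∣_-_∣ᴿ : ℝ → ℝ → ℝ
∣ x - y ∣ᴿ .seq n = ℚ.∣ seq x n ℚ.- seq y n ∣
∣ x - y ∣ᴿ .cauchy = lift-cauchy (λ p q → ℚ.∣ p ℚ.- q ∣)
  (λ {p} {p′} {q} {q′} h h′ k k′ _ → ∣-∣-cont {p} {p′} {q} {q′} h h′ k k′) x y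

pointwise-≤ : ∀ {x y} → (∀ n → seq x n ℚ.≤ seq y n) → x ≤ᴿ y
pointwise-≤ {y = y} f = mk≤ λ ε 0<ε → always λ n → ℚₚ.≤-trans (f n) (q≤q+ε (seq y n) 0<ε)

≤ᴿ-refl : ∀ {x} → x ≤ᴿ x
≤ᴿ-refl = pointwise-≤ λ _ → ℚₚ.≤-refl

≤ᴿ-trans : ∀ {x y z} → x ≤ᴿ y → y ≤ᴿ z → x ≤ᴿ z
≤ᴿ-trans {x} {y} {z} (mk≤ h) (mk≤ k) = mk≤ λ ε 0<ε → ev-map₂
  (λ n a b → subst (seq x n ℚ.≤_) (+½+½ (seq z n) ε)
    (ℚₚ.≤-trans a (ℚₚ.+-monoˡ-≤ (½ ℚ.* ε) {seq y n} {seq z n ℚ.+ ½ ℚ.* ε} b)))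
  (h (½ ℚ.* ε) (½-pos 0<ε)) (k (½ ℚ.* ε) (½-pos 0<ε))

≃-isEquivalence : IsEquivalence _≃_
≃-isEquivalence = record
  { refl  = ≤ᴿ-refl , ≤ᴿ-refl
  ; sym   = λ (a , b) → b , a
  ; trans = λ (a , b) (c , d) → ≤ᴿ-trans a c , ≤ᴿ-trans d b
  }

≤ᴿ-isPartialOrder : IsPartialOrder _≃_ _≤ᴿ_
≤ᴿ-isPartialOrder = record
  { isPreorder = record
    { isEquivalence = ≃-isEquivalence
    ; reflexive     = proj₁
    ; trans         = ≤ᴿ-trans
    }
  ; antisym = _,_
  }

+ᴿ-mono-≤ : ∀ {x x′ y y′} → x ≤ᴿ x′ → y ≤ᴿ y′ → x +ᴿ y ≤ᴿ x′ +ᴿ y′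
+ᴿ-mono-≤ {x} {x′} {y} {y′} (mk≤ h) (mk≤ k) = mk≤ λ ε 0<ε →
  ev-map₂ (λ n → +-cont {seq x n} {seq x′ n} {seq y n} {seq y′ n})
    (h (½ ℚ.* ε) (½-pos 0<ε)) (k (½ ℚ.* ε) (½-pos 0<ε))

⊔ᴿ-mono-≤ : ∀ {x x′ y y′} → x ≤ᴿ x′ → y ≤ᴿ y′ → x ⊔ᴿ y ≤ᴿ x′ ⊔ᴿ y′
⊔ᴿ-mono-≤ {x} {x′} {y} {y′} (mk≤ h) (mk≤ k) = mk≤ λ ε 0<ε →
  ev-map₂ (λ n → ⊔-≤+ {seq x n} {seq y n} {seq x′ n} {seq y′ n}) (h ε 0<ε) (k ε 0<ε)

<ᴿ⇒≤ᴿ : ∀ {x y} → x <ᴿ y → x ≤ᴿ y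
<ᴿ⇒≤ᴿ {x} {y} (mk< δ 0<δ h) = mk≤ λ ε 0<ε → ev-map
  (λ n a → ℚₚ.≤-trans (ℚₚ.≤-trans (q≤q+ε (seq x n) 0<δ) a) (q≤q+ε (seq y n) 0<ε)) h

≤-<ᴿ-trans : ∀ {x y z} → x ≤ᴿ y → y <ᴿ z → x <ᴿ z
≤-<ᴿ-trans {x} {y} {z} (mk≤ h) (mk< δ 0<δ k) = mk< (½ ℚ.* δ) (½-pos 0<δ) (ev-map₂
  (λ n a b → ℚₚ.≤-trans
    (subst (seq x n ℚ.+ ½ ℚ.* δ ℚ.≤_) (+½+½ (seq y n) δ)
      (ℚₚ.+-monoˡ-≤ (½ ℚ.* δ) {seq x n} {seq y n ℚ.+ ½ ℚ.* δ} a)) b)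
  (h (½ ℚ.* δ) (½-pos 0<δ)) k)

<-≤ᴿ-trans : ∀ {x y z} → x <ᴿ y → y ≤ᴿ z → x <ᴿ z
<-≤ᴿ-trans {x} {y} {z} (mk< δ 0<δ h) (mk≤ k) = mk< (½ ℚ.* δ) (½-pos 0<δ) (ev-map₂
  (λ n a b → subst₂ ℚ._≤_
    (trans (cong (ℚ._- ½ ℚ.* δ) (sym (+½+½ (seq x n) δ))) (cancel (seq x n ℚ.+ ½ ℚ.* δ) (½ ℚ.* δ)))
    (cancel (seq z n) (½ ℚ.* δ))
    (ℚₚ.+-monoˡ-≤ (ℚ.- (½ ℚ.* δ)) {seq x n ℚ.+ δ} {seq z n ℚ.+ ½ ℚ.* δ} (ℚₚ.≤-trans a b)))
  h (k (½ ℚ.* δ) (½-pos 0<δ)))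
  where
  open +-*-Solver
  cancel : ∀ p q → (p ℚ.+ q) ℚ.- q ≡ p
  cancel = solve 2 (λ p q → (p :+ q) :- q := p) refl

+ᴿ-mono-< : ∀ {x x′ y y′} → x <ᴿ x′ → y <ᴿ y′ → x +ᴿ y <ᴿ x′ +ᴿ y′
+ᴿ-mono-< {x} {y = y} (mk< δ 0<δ h) (mk< η 0<η k) = mk< δ 0<δ (ev-map₂
  (λ n a b → subst (ℚ._≤ _)
    (solve 3 (λ p q e → (p :+ e) :+ q := (p :+ q) :+ e) refl (seq x n) (seq y n) δ)
    (ℚₚ.+-mono-≤ a (ℚₚ.≤-trans (q≤q+ε (seq y n) 0<η) b)))
  h k)
  where open +-*-Solver

⊔ᴿ-lub-< : ∀ {x y z} → x <ᴿ z → y <ᴿ z → x ⊔ᴿ y <ᴿ z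
⊔ᴿ-lub-< {x} {y} {z} (mk< δ 0<δ h) (mk< η 0<η k) = mk< (δ ℚ.⊓ η) ⊓-pos (ev-map₂
  (λ n a b → subst (ℚ._≤ seq z n)
    (sym (ℚₚ.mono-≤-distrib-⊔ (λ {p} {q} → ℚₚ.+-monoˡ-≤ (δ ℚ.⊓ η) {p} {q}) (seq x n) (seq y n)))
    (ℚₚ.⊔-lub (ℚₚ.≤-trans (ℚₚ.+-monoʳ-≤ (seq x n) (ℚₚ.p⊓q≤p δ η)) a)
              (ℚₚ.≤-trans (ℚₚ.+-monoʳ-≤ (seq y n) (ℚₚ.p⊓q≤q δ η)) b)))
  h k)
  where
  ⊓-pos : 0ℚ ℚ.< δ ℚ.⊓ η
  ⊓-pos with ℚₚ.⊓-sel δ η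
  ... | inj₁ e = subst (0ℚ ℚ.<_) (sym e) 0<δ
  ... | inj₂ e = subst (0ℚ ℚ.<_) (sym e) 0<η

∣-∣ᴿ-isMetric : IsGeneralMetric _≃_ _≃_ _≤ᴿ_ 0ᴿ _+ᴿ_ ∣_-_∣ᴿ
∣-∣ᴿ-isMetric = record
  { isSemiMetric = record
    { isQuasiSemiMetric = record
      { isPreMetric = record
        { isProtoMetric = record
          { isPartialOrder  = ≤ᴿ-isPartialOrder
          ; ≈-isEquivalence = ≃-isEquivalence
          ; cong            = λ (a , a′) (b , b′) → cong-≤ a a′ b b′ , cong-≤ a′ a b′ b
          ; nonNegative     = nonneg
          }
        ; ≈⇒0 = λ (a , a′) → to-0 a a′ , nonneg
        }
      ; 0⇒≈ = λ (a , _) → from-0 a , from-0′ a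
      }
    ; sym = λ x y → swap x y , swap y x
    }
  ; triangle = λ x y z → pointwise-≤ λ n → ∣-∣-triangle (seq x n) (seq y n) (seq z n)
  }
  where
  nonneg : ∀ {x y} → 0ᴿ ≤ᴿ ∣ x - y ∣ᴿ
  nonneg = pointwise-≤ λ n → ℚₚ.0≤∣p∣ _

  swap : ∀ x y → ∣ x - y ∣ᴿ ≤ᴿ ∣ y - x ∣ᴿ
  swap x y = pointwise-≤ λ n → ℚₚ.≤-reflexive (∣p-q∣≡∣q-p∣ (seq x n) (seq y n))

  cong-≤ : ∀ {x x′ y y′} → x ≤ᴿ x′ → x′ ≤ᴿ x → y ≤ᴿ y′ → y′ ≤ᴿ y → ∣ x - y ∣ᴿ ≤ᴿ ∣ x′ - y′ ∣ᴿ
  cong-≤ {x} {x′} {y} {y′} (mk≤ a) (mk≤ a′) (mk≤ b) (mk≤ b′) = mk≤ λ ε 0<ε → ev-map₂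
    (λ n (u , u′) (v , v′) → ∣-∣-cont {seq x n} {seq x′ n} {seq y n} {seq y′ n} u u′ v v′)
    (ev-map₂ (λ n → _,_) (a (½ ℚ.* ε) (½-pos 0<ε)) (a′ (½ ℚ.* ε) (½-pos 0<ε)))
    (ev-map₂ (λ n → _,_) (b (½ ℚ.* ε) (½-pos 0<ε)) (b′ (½ ℚ.* ε) (½-pos 0<ε)))

  to-0 : ∀ {x y} → x ≤ᴿ y → y ≤ᴿ x → ∣ x - y ∣ᴿ ≤ᴿ 0ᴿ
  to-0 {x} {y} (mk≤ a) (mk≤ a′) = mk≤ λ ε 0<ε → ev-map₂
    (λ n b b′ → subst (ℚ.∣ seq x n ℚ.- seq y n ∣ ℚ.≤_) (sym (ℚₚ.+-identityˡ ε)) (≤+⇒∣-∣≤ (seq x n) (seq y n) b b′))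
    (a ε 0<ε) (a′ ε 0<ε)

  from-0 : ∀ {x y} → ∣ x - y ∣ᴿ ≤ᴿ 0ᴿ → x ≤ᴿ y
  from-0 {x} {y} (mk≤ a) = mk≤ λ ε 0<ε → ev-map
    (λ n b → ∣-∣≤⇒≤+ (seq x n) (seq y n) (subst (ℚ.∣ seq x n ℚ.- seq y n ∣ ℚ.≤_) (ℚₚ.+-identityˡ ε) b)) (a ε 0<ε)

  from-0′ : ∀ {x y} → ∣ x - y ∣ᴿ ≤ᴿ 0ᴿ → y ≤ᴿ x
  from-0′ {x} {y} (mk≤ a) = mk≤ λ ε 0<ε → ev-map
    (λ n b → ∣-∣≤⇒≤+′ (seq x n) (seq y n) (subst (ℚ.∣ seq x n ℚ.- seq y n ∣ ℚ.≤_) (ℚₚ.+-identityˡ ε) b)) (a ε 0<ε)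

real-mono-≤ : ∀ {p q} → p ℚ.≤ q → real p ≤ᴿ real q
real-mono-≤ p≤q = pointwise-≤ λ _ → p≤q

real-+-≤ : ∀ p q → real p +ᴿ real q ≤ᴿ real (p ℚ.+ q)
real-+-≤ p q = pointwise-≤ λ _ → ℚₚ.≤-refl

real-mono-< : ∀ {p q} → p ℚ.< q → real p <ᴿ real q
real-mono-< {p} {q} p<q = mk< (q ℚ.- p) (subst (ℚ._< q ℚ.- p) (ℚₚ.+-inverseʳ p) (ℚₚ.+-monoˡ-< (ℚ.- p) p<q))
  (always λ _ → ℚₚ.≤-reflexive (solve 2 (λ p q → p :+ (q :- p) := q) refl p q))
  where open +-*-Solver

<ᴿ-irrefl : ∀ {x} → ¬ (x <ᴿ x)
<ᴿ-irrefl {x} (mk< δ 0<δ h) = ℚₚ.<-irrefl refl (ℚₚ.<-≤-trans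
  (subst (ℚ._< seq x n ℚ.+ δ) (ℚₚ.+-identityʳ (seq x n)) (ℚₚ.+-monoʳ-< (seq x n) 0<δ)) (proj₂ (ev-witness h)))
  where n = proj₁ (ev-witness h)

≤-real⇒≤0 : ∀ {x} → (∀ ε → 0ℚ ℚ.< ε → x ≤ᴿ real ε) → x ≤ᴿ 0ᴿ
≤-real⇒≤0 {x} h = mk≤ λ ε 0<ε → ev-map
  (λ n → subst (seq x n ℚ.≤_) (trans (half+half ε) (sym (ℚₚ.+-identityˡ ε))))
  (eventually-≤ (h (½ ℚ.* ε) (½-pos 0<ε)) (½ ℚ.* ε) (½-pos 0<ε))

≤-halves : ∀ {x y ε} → x ≤ᴿ real (½ ℚ.* ε) → y ≤ᴿ real (½ ℚ.* ε) → x +ᴿ y ≤ᴿ real ε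
≤-halves {ε = ε} h k = ≤ᴿ-trans (+ᴿ-mono-≤ h k)
  (≤ᴿ-trans (real-+-≤ (½ ℚ.* ε) (½ ℚ.* ε)) (real-mono-≤ (ℚₚ.≤-reflexive (half+half ε))))

<-halves : ∀ {x y ε} → x <ᴿ real (½ ℚ.* ε) → y <ᴿ real (½ ℚ.* ε) → x +ᴿ y <ᴿ real ε
<-halves {ε = ε} h k = <-≤ᴿ-trans (+ᴿ-mono-< h k)
  (≤ᴿ-trans (real-+-≤ (½ ℚ.* ε) (½ ℚ.* ε)) (real-mono-≤ (ℚₚ.≤-reflexive (half+half ε))))

x≤x⊔ᴿy : ∀ x y → x ≤ᴿ x ⊔ᴿ y
x≤x⊔ᴿy x y = pointwise-≤ λ n → ℚₚ.p≤p⊔q (seq x n) (seq y n)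

y≤x⊔ᴿy : ∀ x y → y ≤ᴿ x ⊔ᴿ y
y≤x⊔ᴿy x y = pointwise-≤ λ n → ℚₚ.p≤q⊔p (seq x n) (seq y n)

⊔ᴿ-lub : ∀ {x y z} → x ≤ᴿ z → y ≤ᴿ z → x ⊔ᴿ y ≤ᴿ z
⊔ᴿ-lub (mk≤ h) (mk≤ k) = mk≤ λ ε 0<ε → ev-map₂ (λ n → ℚₚ.⊔-lub) (h ε 0<ε) (k ε 0<ε)

⊔ᴿ-cong : ∀ {x x′ y y′} → x ≃ x′ → y ≃ y′ → x ⊔ᴿ y ≃ x′ ⊔ᴿ y′
⊔ᴿ-cong (a , a′) (b , b′) = ⊔ᴿ-mono-≤ a b , ⊔ᴿ-mono-≤ a′ b′

------------------------------------------------------------------------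
-- Numberings

-- unpair runs through ℕ × ℕ along the antidiagonals, and pair is the
-- inverse Cantor pairing function.

triangular : ℕ → ℕ
triangular zero    = 0
triangular (suc n) = suc n ℕ.+ triangular n

pair : ℕ → ℕ → ℕ
pair m n = triangular (m ℕ.+ n) ℕ.+ n

next : ℕ × ℕ → ℕ × ℕ
next (zero  , n) = suc n , zero
next (suc m , n) = m , suc n

unpair : ℕ → ℕ × ℕ
unpair zero    = zero , zero
unpair (suc k) = next (unpair k)

unpair-pair : ∀ m n → unpair (pair m n) ≡ (m , n)
unpair-pair m n = go (m ℕ.+ n) m n refl
  where
  go : ∀ s m n → m ℕ.+ n ≡ s → unpair (pair m n) ≡ (m , n)
  go s zero    zero    e = refl
  go (suc s) (suc m) zero e = trans (cong unpair eq) (cong next (go s zero m m≡s))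
    where
    m≡s : m ≡ s
    m≡s = trans (sym (ℕₚ.+-identityʳ m)) (ℕₚ.suc-injective e)
    eq : pair (suc m) zero ≡ suc (pair zero m)
    eq = trans (ℕₚ.+-identityʳ _) (trans (cong triangular (cong suc (ℕₚ.+-identityʳ m))) (cong suc (ℕₚ.+-comm m (triangular m))))
  go s m (suc n) e = trans (cong unpair eq) (cong next (go s (suc m) n (trans (sym (ℕₚ.+-suc m n)) e)))
    where
    eq : pair m (suc n) ≡ suc (pair (suc m) n)
    eq = trans (ℕₚ.+-suc _ n) (cong (λ t → suc (triangular t ℕ.+ n)) (ℕₚ.+-suc m n))

-- ⟨⟨a,b⟩,c⟩ ↦ (a - b) / (c + 1)

νℚ : ℕ → ℚ
νℚ k = let s , c = unpair k
           a , b = unpair s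
       in (a ℤ.⊖ b) ℚ./ suc c

νℚ-surjective : ∀ q → ∃[ k ] νℚ k ≡ q
νℚ-surjective q@(mkℚ z c _) = let a , b , e = difference z in pair (pair a b) c ,
  trans (cong₂ (λ s c′ → (proj₁ (unpair s) ℤ.⊖ proj₂ (unpair s)) ℚ./ suc c′)
          (cong proj₁ (unpair-pair (pair a b) c)) (cong proj₂ (unpair-pair (pair a b) c)))
  (trans (cong (λ (a , b) → (a ℤ.⊖ b) ℚ./ suc c) (unpair-pair a b))
  (trans (cong (ℚ._/ suc c) e) (ℚₚ.↥p/↧p≡p q)))
  where
  difference : ∀ z → ∃[ a ] ∃[ b ] a ℤ.⊖ b ≡ z
  difference (+ n)      = n , 0 , refl
  difference (-[1+ n ]) = 0 , suc n , refl

-- A bijection between List ℕ and ℕ.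

encodeList : List ℕ → ℕ
encodeList []       = zero
encodeList (n ∷ ns) = suc (pair n (encodeList ns))

------------------------------------------------------------------------
-- Computability on ℕ and on Baire space

𝔹 : Set
𝔹 = ℕ → ℕ

𝔹-setoid : Setoid 0ℓ 0ℓ
𝔹-setoid = ℕ →-setoid ℕ

-- The μ-recursive functions with an oracle p ∈ 𝔹 as an additional basic
-- function; p ⊢ e · xs ⇓ v says that e halts on xs with value v.

data Code : ℕ → Set where
  zeroᶜ   : ∀ {k} → Code k
  sucᶜ    : Code 1
  oracleᶜ : Code 1
  projᶜ   : ∀ {k} → Fin k → Code k
  compᶜ   : ∀ {k m} → Code m → Vec (Code k) m → Code k
  precᶜ   : ∀ {k} → Code k → Code (suc (suc k)) → Code (suc k)
  minᶜ    : ∀ {k} → Code (suc k) → Code k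

infix 4 _⊢_·_⇓_

data _⊢_·_⇓_ (p : 𝔹) : ∀ {k} → Code k → Vec ℕ k → ℕ → Set where
  zero⇓   : ∀ {k} {xs : Vec ℕ k} → p ⊢ zeroᶜ · xs ⇓ 0
  suc⇓    : ∀ {n} → p ⊢ sucᶜ · n ∷ [] ⇓ suc n
  oracle⇓ : ∀ {n} → p ⊢ oracleᶜ · n ∷ [] ⇓ p n
  proj⇓   : ∀ {k} {i : Fin k} {xs} → p ⊢ projᶜ i · xs ⇓ lookup xs i
  comp⇓   : ∀ {k m} {f : Code m} {gs : Vec (Code k) m} {xs ys v} →
            Pointwise (λ g y → p ⊢ g · xs ⇓ y) gs ys → p ⊢ f · ys ⇓ v →
            p ⊢ compᶜ f gs · xs ⇓ v
  prec0⇓  : ∀ {k} {f : Code k} {g xs v} → p ⊢ f · xs ⇓ v → p ⊢ precᶜ f g · zero ∷ xs ⇓ v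
  prec+⇓  : ∀ {k} {f : Code k} {g xs n u v} →
            p ⊢ precᶜ f g · n ∷ xs ⇓ u → p ⊢ g · n ∷ u ∷ xs ⇓ v →
            p ⊢ precᶜ f g · suc n ∷ xs ⇓ v
  min⇓    : ∀ {k} {f : Code (suc k)} {xs n} →
            (∀ m → m ℕ.< n → ∃[ u ] p ⊢ f · m ∷ xs ⇓ suc u) → p ⊢ f · n ∷ xs ⇓ 0 →
            p ⊢ minᶜ f · xs ⇓ n

-- Computing without an oracle is computing with the constant zero oracle.

infix 4 _·_⇓_

_·_⇓_ : ∀ {k} → Code k → Vec ℕ k → ℕ → Set
e · xs ⇓ v = (λ _ → 0) ⊢ e · xs ⇓ v

ComputableSeq : 𝔹 → Set
ComputableSeq p = ∃[ e ] (∀ n → e · n ∷ [] ⇓ p n)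

-- S is listed by a computable sequence. The value 0 lists nothing, so
-- that the empty set is included.

ComputablyEnumerable : Pred (List ℕ) 0ℓ → Set
ComputablyEnumerable S = ∃[ p ] ComputableSeq p × (∀ L → S L ⇔ (∃[ n ] p n ≡ suc (encodeList L)))

-- Partial functions between setoids, given by their graphs.

infix 2 _⇀_

record _⇀_ {a b ℓ₁ ℓ₂} (S : Setoid a ℓ₁) (T : Setoid b ℓ₂) : Set (lsuc 0ℓ ⊔ℓ a ⊔ℓ b ⊔ℓ ℓ₁ ⊔ℓ ℓ₂) where
  private
    module S = Setoid S
    module T = Setoid T
  field
    graph  : S.Carrier → T.Carrier → Set
    resp   : ∀ {x x′ y y′} → x S.≈ x′ → y T.≈ y′ → graph x y → graph x′ y′
    single : ∀ {x y y′} → graph x y → graph x y′ → y T.≈ y′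

open _⇀_ public

-- dom F consists of the p for which e, with oracle p, halts on every n.

Computable : (𝔹-setoid ⇀ 𝔹-setoid) → Set
Computable F = ∃[ e ] (∀ p q → graph F p q ⇔ (∀ n → p ⊢ e · n ∷ [] ⇓ q n))

⟨_,_⟩ : 𝔹 → 𝔹 → 𝔹
⟨ p , q ⟩ zero          = p 0
⟨ p , q ⟩ (suc zero)    = q 0
⟨ p , q ⟩ (suc (suc n)) = ⟨ (λ i → p (suc i)) , (λ i → q (suc i)) ⟩ n

⟨,⟩-cong : ∀ {p p′ q q′} → p ≗ p′ → q ≗ q′ → ⟨ p , q ⟩ ≗ ⟨ p′ , q′ ⟩
⟨,⟩-cong h k zero          = h 0
⟨,⟩-cong h k (suc zero)    = k 0
⟨,⟩-cong h k (suc (suc n)) = ⟨,⟩-cong (λ i → h (suc i)) (λ i → k (suc i)) n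

------------------------------------------------------------------------
-- Represented spaces and Weihrauch reducibility

record RepresentedSpace c : Set (lsuc c ⊔ℓ lsuc 0ℓ) where
  field
    setoid     : Setoid c 0ℓ
    δ          : 𝔹-setoid ⇀ setoid
    surjective : ∀ x → ∃[ p ] graph δ p x

  open Setoid setoid public

module _ {a b} (X : RepresentedSpace a) (Y : RepresentedSpace b) where
  private
    module X = RepresentedSpace X
    module Y = RepresentedSpace Y

  infix 2 _⇉_

  -- Partial multi-valued maps: the domain consists of the x for which
  -- values x is inhabited.
  record _⇉_ : Set (lsuc 0ℓ ⊔ℓ a ⊔ℓ b) where
    field
      values : X.Carrier → Pred Y.Carrier 0ℓ
      resp   : ∀ {x x′ y y′} → x X.≈ x′ → y Y.≈ y′ → y ∈ values x → y′ ∈ values x′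

  Realizes : (𝔹-setoid ⇀ 𝔹-setoid) → _⇉_ → Set (a ⊔ℓ b)
  Realizes F f = ∀ p x → graph X.δ p x → (∃[ y ] y ∈ values x) →
                 ∃[ q ] graph F p q × (∃[ y ] graph Y.δ q y × y ∈ values x)
    where open _⇉_ f

-- p ↦ H⟨p,G(K(p))⟩

compose : (H G K : 𝔹-setoid ⇀ 𝔹-setoid) → 𝔹-setoid ⇀ 𝔹-setoid
compose H G K .graph p s = ∃[ r ] ∃[ q ] graph K p r × graph G r q × graph H ⟨ p , q ⟩ s
compose H G K .resp p≗p′ s≗s′ (r , q , k , g , h) =
  r , q , resp K p≗p′ (λ _ → refl) k , g , resp H (⟨,⟩-cong p≗p′ (λ _ → refl)) s≗s′ h
compose H G K .single (r , q , k , g , h) (r′ , q′ , k′ , g′ , h′) = single H h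
  (resp H (⟨,⟩-cong (λ _ → refl) (single G (resp G (single K k′ k) (λ _ → refl) g′) g)) (λ _ → refl) h′)

infix 4 _≤W_

_≤W_ : ∀ {a b c d} {X : RepresentedSpace a} {Y : RepresentedSpace b}
       {U : RepresentedSpace c} {V : RepresentedSpace d} → (X ⇉ Y) → (U ⇉ V) → Set (lsuc 0ℓ ⊔ℓ a ⊔ℓ b ⊔ℓ c ⊔ℓ d)
_≤W_ {X = X} {Y} {U} {V} f g =
  Σ[ H ∈ (𝔹-setoid ⇀ 𝔹-setoid) ] Σ[ K ∈ (𝔹-setoid ⇀ 𝔹-setoid) ] Computable H × Computable K ×
  (∀ G → Realizes U V G g → Realizes X Y (compose H G K) f)

------------------------------------------------------------------------
-- Computable metric spaces

-- The Cauchy representation, the hyperspace of closed sets and products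
-- depend only on the metric and the dense sequence, so the computability
-- of d ∘ (α × α) is split off into ComputableMetricSpace.

record SeparableMetricSpace : Set₁ where
  infix 4 _≈_
  field
    Carrier  : Set
    _≈_      : Rel Carrier 0ℓ
    d        : Carrier → Carrier → ℝ
    isMetric : IsGeneralMetric _≈_ _≃_ _≤ᴿ_ 0ᴿ _+ᴿ_ d
    α        : ℕ → Carrier
    α-dense  : ∀ x ε → 0ℚ ℚ.< ε → ∃[ k ] d (α k) x <ᴿ real ε

  open IsGeneralMetric isMetric public
    using (nonNegative; ≈⇒0; 0⇒≈; triangle)
    renaming (≈-isEquivalence to isEquivalence; cong to d-cong; sym to d-sym)

  setoid : Setoid 0ℓ 0ℓ
  setoid = record { isEquivalence = isEquivalence }

  -- The ball with index ⟨i,k⟩ has centre α i and radius νℚ k. It is empty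
  -- if νℚ k ≤ 0, which lets an enumeration of balls have empty union.
  Ball : ℕ → Pred Carrier 0ℓ
  Ball n z = let i , k = unpair n in d (α i) z <ᴿ real (νℚ k)

  Open : Pred Carrier 0ℓ → Set
  Open U = ∀ x → x ∈ U → ∃[ ε ] 0ℚ ℚ.< ε × (∀ y → d x y <ᴿ real ε → y ∈ U)

  triangle-≤ : ∀ x y z {ε} → d x y ≤ᴿ real (½ ℚ.* ε) → d y z ≤ᴿ real (½ ℚ.* ε) → d x z ≤ᴿ real ε
  triangle-≤ x y z h k = ≤ᴿ-trans (triangle x y z) (≤-halves h k)

  triangle-< : ∀ x y z {ε} → d x y <ᴿ real (½ ℚ.* ε) → d y z <ᴿ real (½ ℚ.* ε) → d x z <ᴿ real ε
  triangle-< x y z h k = ≤-<ᴿ-trans (triangle x y z) (<-halves h k)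

record ComputableMetricSpace : Set₁ where
  field
    space      : SeparableMetricSpace
  open SeparableMetricSpace space public
  field
    computable : ∃[ e ] (∀ i j n → ∃[ k ] e · i ∷ j ∷ n ∷ [] ⇓ k ×
                   ∣ d (α i) (α j) - real (νℚ k) ∣ᴿ ≤ᴿ real (½^ n))

module _ (Z : SeparableMetricSpace) where
  open SeparableMetricSpace Z

  record CauchyName (p : 𝔹) (x : Carrier) : Set where
    field
      rapid     : ∀ i j → i ℕ.< j → d (α (p i)) (α (p j)) <ᴿ real (½^ i)
      converges : ∀ ε → 0ℚ ℚ.< ε → Eventually λ i → d (α (p i)) x ≤ᴿ real ε

  open CauchyName

  private
    d-resp : ∀ {x x′ y y′} → x ≈ x′ → y ≈ y′ → d x′ y′ ≤ᴿ d x y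
    d-resp x≈x′ y≈y′ = proj₂ (d-cong x≈x′ y≈y′)

    ≈-refl = IsEquivalence.refl isEquivalence

    d-flip : ∀ x y → d x y ≤ᴿ d y x
    d-flip x y = proj₁ (d-sym x y)

  Cauchy : RepresentedSpace 0ℓ
  Cauchy = record { setoid = setoid ; δ = δ′ ; surjective = surj }
    where
    δ′ : 𝔹-setoid ⇀ setoid
    δ′ .graph = CauchyName
    δ′ .resp {p} {p′} {x} {x′} p≗p′ x≈x′ c = record
      { rapid     = λ i j i<j → subst₂ (λ a b → d (α a) (α b) <ᴿ real (½^ i)) (p≗p′ i) (p≗p′ j) (rapid c i j i<j)
      ; converges = λ ε 0<ε → ev-map
          (λ i h → subst (λ a → d (α a) x′ ≤ᴿ real ε) (p≗p′ i) (≤ᴿ-trans (d-resp ≈-refl x≈x′) h))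
          (converges c ε 0<ε)
      }
    δ′ .single {p} {x} {y} c c′ = 0⇒≈ (≤-real⇒≤0 small , nonNegative)
      where
      small : ∀ ε → 0ℚ ℚ.< ε → d x y ≤ᴿ real ε
      small ε 0<ε =
        let i , h , k = ev-witness (ev-map₂ (λ n → _,_)
                          (converges c (½ ℚ.* ε) (½-pos 0<ε)) (converges c′ (½ ℚ.* ε) (½-pos 0<ε)))
        in triangle-≤ x (α (p i)) y (≤ᴿ-trans (d-flip x (α (p i))) h) k

    surj : ∀ x → ∃[ p ] CauchyName p x
    surj x = p , record
      { rapid     = λ i j i<j → triangle-< (α (p i)) x (α (p j)) (near i)
          (≤-<ᴿ-trans (d-flip x (α (p j)))
            (<-≤ᴿ-trans (near j) (real-mono-≤ (½^-anti {suc i} {suc j} (ℕ.s≤s (ℕₚ.<⇒≤ i<j))))))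
      ; converges = λ ε 0<ε → let N , h = archimedean 0<ε in N , λ n N≤n →
          ≤ᴿ-trans (<ᴿ⇒≤ᴿ (near n)) (real-mono-≤ (ℚₚ.≤-trans (½^-anti {N} {suc n} (ℕₚ.m≤n⇒m≤1+n N≤n)) h))
      }
      where
      p : 𝔹
      p i = proj₁ (α-dense x (½^ suc i) (½^-pos (suc i)))
      near : ∀ i → d (α (p i)) x <ᴿ real (½^ suc i)
      near i = proj₂ (α-dense x (½^ suc i) (½^-pos (suc i)))

  record ClosedSubset : Set₁ where
    field
      member : Pred Carrier 0ℓ
      resp   : ∀ {x y} → x ≈ y → x ∈ member → y ∈ member
      closed : Open (∁ member)

  open ClosedSubset

  _≐_ : Rel ClosedSubset 0ℓ
  A ≐ B = ∀ x → (x ∈ member A) ⇔ (x ∈ member B)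

  ClosedName : 𝔹 → ClosedSubset → Set
  ClosedName p A = ∀ x → (x ∈ ∁ (member A)) ⇔ (∃[ n ] x ∈ Ball (p n))

  CoCeClosed : ClosedSubset → Set
  CoCeClosed A = ∃[ p ] ComputableSeq p × ClosedName p A

  -- Excluded middle gives closed sets their classical meaning: they are
  -- determined by their complements, and each of them has a name. It has
  -- no bearing on computability, which is a matter of explicit programs.
  𝒜₋ : ExcludedMiddle 0ℓ → RepresentedSpace (lsuc 0ℓ)
  𝒜₋ em = record { setoid = closedSetoid ; δ = δ′ ; surjective = surj }
    where
    open Equivalence using (to; from)

    closedSetoid : Setoid (lsuc 0ℓ) 0ℓ
    closedSetoid = record
      { Carrier = ClosedSubset
      ; _≈_     = _≐_
      ; isEquivalence = record
        { refl  = λ x → mk⇔ (λ a → a) (λ a → a)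
        ; sym   = λ e x → mk⇔ (from (e x)) (to (e x))
        ; trans = λ e f x → mk⇔ (λ a → to (f x) (to (e x) a)) (λ b → from (e x) (from (f x) b))
        }
      }

    included : ∀ {p A B} → ClosedName p A → ClosedName p B → ∀ x → x ∈ member A → x ∈ member B
    included nA nB x a = decidable-stable em λ ¬b → from (nA x) (to (nB x) ¬b) a

    δ′ : 𝔹-setoid ⇀ closedSetoid
    δ′ .graph = ClosedName
    δ′ .resp p≗p′ e nA x = mk⇔
      (λ ¬b → map₂ (λ {n} → subst (λ k → x ∈ Ball k) (p≗p′ n)) (to (nA x) (λ a → ¬b (to (e x) a))))
      (λ (n , h) b → from (nA x) (n , subst (λ k → x ∈ Ball k) (sym (p≗p′ n)) h) (from (e x) b))
    δ′ .single {p} {A} {B} nA nB x = mk⇔ (included {p} {A} {B} nA nB x) (included {p} {B} {A} nB nA x)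

    surj : ∀ A → ∃[ p ] ClosedName p A
    surj A = (λ n → choose n em) , λ x → mk⇔ (covered x) (λ (n , h) a → sound x n em h a)
      where
      Meets : ℕ → Set
      Meets n = ∃[ x ] x ∈ Ball n × x ∈ member A

      choose : ∀ n → Dec (Meets n) → ℕ
      choose n (yes _) = 0
      choose n (no _)  = n

      sound : ∀ x n (m : Dec (Meets n)) → x ∈ Ball (choose n m) → ¬ (x ∈ member A)
      sound x n (yes _) h a = <ᴿ-irrefl (≤-<ᴿ-trans nonNegative h)
      sound x n (no ¬m) h a = ¬m (x , h , a)

      hit : ∀ x n (m : Dec (Meets n)) → ¬ Meets n → x ∈ Ball n → x ∈ Ball (choose n m)
      hit x n (yes m) ¬m h = ⊥-elim (¬m m)
      hit x n (no _)  ¬m h = h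

      covered : ∀ x → ¬ (x ∈ member A) → ∃[ n ] x ∈ Ball (choose n em)
      covered x ¬a =
        let ε , 0<ε , avoid = closed A x ¬a
            i , near        = α-dense x (½ ℚ.* ε) (½-pos 0<ε)
            k , νk≡         = νℚ-surjective (½ ℚ.* ε)
            ball≡ : ∀ y → (y ∈ Ball (pair i k)) ≡ (d (α i) y <ᴿ real (½ ℚ.* ε))
            ball≡ y = trans (cong (λ (i , k) → d (α i) y <ᴿ real (νℚ k)) (unpair-pair i k))
                            (cong (λ r → d (α i) y <ᴿ real r) νk≡)
        in pair i k , hit x (pair i k) em
             (λ (y , h , a) → avoid y (triangle-< x (α i) y (≤-<ᴿ-trans (d-flip x (α i)) near)
                                                             (subst (λ P → P) (ball≡ y) h)) a)
             (subst (λ P → P) (sym (ball≡ x)) near)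

  Compact : Set₁
  Compact = ∀ {I : Set} (U : I → Pred Carrier 0ℓ) → (∀ i → Open (U i)) → (∀ x → ∃[ i ] x ∈ U i) →
            ∃[ L ] (∀ x → Any (λ i → x ∈ U i) L)

  Covers : Pred (List ℕ) 0ℓ
  Covers L = ∀ x → Any (λ n → x ∈ Ball n) L

  CoCeCompact : Set₁
  CoCeCompact = Compact × ComputablyEnumerable Covers

-- The product with the maximum metric and the dense sequence
-- ⟨i,j⟩ ↦ (α i , α j).

infixr 2 _⊗_

_⊗_ : SeparableMetricSpace → SeparableMetricSpace → SeparableMetricSpace
X ⊗ Y = record
  { Carrier  = X.Carrier × Y.Carrier
  ; _≈_      = Setoid._≈_ (×-setoid X.setoid Y.setoid)
  ; d        = λ (x , y) (x′ , y′) → X.d x x′ ⊔ᴿ Y.d y y′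
  ; isMetric = record
    { isSemiMetric = record
      { isQuasiSemiMetric = record
        { isPreMetric = record
          { isProtoMetric = record
            { isPartialOrder  = ≤ᴿ-isPartialOrder
            ; ≈-isEquivalence = Setoid.isEquivalence (×-setoid X.setoid Y.setoid)
            ; cong            = λ (a , b) (a′ , b′) → ⊔ᴿ-cong (X.d-cong a a′) (Y.d-cong b b′)
            ; nonNegative     = ≤ᴿ-trans X.nonNegative (x≤x⊔ᴿy _ _)
            }
          ; ≈⇒0 = λ (a , b) → ≤ᴿ-trans (⊔ᴿ-mono-≤ (proj₁ (X.≈⇒0 a)) (proj₁ (Y.≈⇒0 b))) (⊔ᴿ-lub ≤ᴿ-refl ≤ᴿ-refl) ,
                              ≤ᴿ-trans X.nonNegative (x≤x⊔ᴿy _ _)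
          }
        ; 0⇒≈ = λ (h , _) → X.0⇒≈ (≤ᴿ-trans (x≤x⊔ᴿy _ _) h , X.nonNegative) ,
                            Y.0⇒≈ (≤ᴿ-trans (y≤x⊔ᴿy _ _) h , Y.nonNegative)
        }
      ; sym = λ (x , y) (x′ , y′) → ⊔ᴿ-cong (X.d-sym x x′) (Y.d-sym y y′)
      }
    ; triangle = λ (x , y) (x′ , y′) (x″ , y″) → ⊔ᴿ-lub
        (≤ᴿ-trans (X.triangle x x′ x″) (+ᴿ-mono-≤ (x≤x⊔ᴿy _ _) (x≤x⊔ᴿy _ _)))
        (≤ᴿ-trans (Y.triangle y y′ y″) (+ᴿ-mono-≤ (y≤x⊔ᴿy _ _) (y≤x⊔ᴿy _ _)))
    }
  ; α        = λ n → let i , j = unpair n in X.α i , Y.α j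
  ; α-dense  = λ (x , y) ε 0<ε →
      let i , h = X.α-dense x ε 0<ε
          j , k = Y.α-dense y ε 0<ε
      in pair i j , subst (λ (i , j) → X.d (X.α i) x ⊔ᴿ Y.d (Y.α j) y <ᴿ real ε)
           (sym (unpair-pair i j)) (⊔ᴿ-lub-< h k)
  }
  where
  module X = SeparableMetricSpace X
  module Y = SeparableMetricSpace Y

clamp : ℚ → ℚ
clamp q = 0ℚ ℚ.⊔ (1ℚ ℚ.⊓ q)

0≤clamp : ∀ q → 0ℚ ℚ.≤ clamp q
0≤clamp q = ℚₚ.p≤p⊔q 0ℚ (1ℚ ℚ.⊓ q)

clamp≤1 : ∀ q → clamp q ℚ.≤ 1ℚ
clamp≤1 q = ℚₚ.⊔-lub (ℚₚ.<⇒≤ (ℚₚ.positive⁻¹ 1ℚ)) (ℚₚ.p⊓q≤p 1ℚ q)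

⊓-+ : ∀ p q ε → (p ℚ.⊓ q) ℚ.+ ε ≡ (p ℚ.+ ε) ℚ.⊓ (q ℚ.+ ε)
⊓-+ p q ε = ℚₚ.mono-≤-distrib-⊓ (λ {p} {q} → ℚₚ.+-monoˡ-≤ ε {p} {q}) p q

-- The dense sequence of [0,1] is the numbering of ℚ truncated to [0,1].

unitInterval : SeparableMetricSpace
unitInterval = record
  { Carrier  = Σ[ x ∈ ℝ ] 0ᴿ ≤ᴿ x × x ≤ᴿ real 1ℚ
  ; _≈_      = λ (x , _) (y , _) → x ≃ y
  ; d        = λ (x , _) (y , _) → ∣ x - y ∣ᴿ
  ; isMetric = record
    { isSemiMetric = record
      { isQuasiSemiMetric = record
        { isPreMetric = record
          { isProtoMetric = record
            { isPartialOrder  = ≤ᴿ-isPartialOrder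
            ; ≈-isEquivalence = record { refl = E.refl ; sym = E.sym ; trans = E.trans }
            ; cong            = M.cong
            ; nonNegative     = M.nonNegative
            }
          ; ≈⇒0 = M.≈⇒0
          }
        ; 0⇒≈ = M.0⇒≈
        }
      ; sym = λ (x , _) (y , _) → M.sym x y
      }
    ; triangle = λ (x , _) (y , _) (z , _) → M.triangle x y z
    }
  ; α        = λ k → real (clamp (νℚ k)) , real-mono-≤ (0≤clamp (νℚ k)) , real-mono-≤ (clamp≤1 (νℚ k))
  ; α-dense  = dense
  }
  where
  module E = IsEquivalence ≃-isEquivalence
  module M = IsGeneralMetric ∣-∣ᴿ-isMetric

  dense : ((x , _) : Σ[ x ∈ ℝ ] 0ᴿ ≤ᴿ x × x ≤ᴿ real 1ℚ) → ∀ ε → 0ℚ ℚ.< ε →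
          ∃[ k ] ∣ real (clamp (νℚ k)) - x ∣ᴿ <ᴿ real ε
  dense (x , 0≤x , x≤1) ε 0<ε =
    let η       = ½ ℚ.* ε
        0<η     = ½-pos 0<ε
        N , h   = cauchy x η 0<η
        q       = seq x N
        k , νk≡ = νℚ-surjective q
        near : Eventually λ n → ℚ.∣ clamp q ℚ.- seq x n ∣ ℚ.≤ η
        near = ev-map₂
          (λ n (0≤ , ≤1) c → ≤+⇒∣-∣≤ (clamp q) (seq x n)
            (ℚₚ.⊔-lub 0≤ (ℚₚ.≤-trans (ℚₚ.p⊓q≤q 1ℚ q) (∣-∣≤⇒≤+ q (seq x n) c)))
            (ℚₚ.≤-trans (subst (seq x n ℚ.≤_) (sym (⊓-+ 1ℚ q η)) (ℚₚ.⊓-glb ≤1 (∣-∣≤⇒≤+′ q (seq x n) c)))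
                        (ℚₚ.+-monoˡ-≤ η (ℚₚ.p≤q⊔p 0ℚ (1ℚ ℚ.⊓ q)))))
          (ev-map₂ (λ n → _,_) (eventually-≤ 0≤x η 0<η) (eventually-≤ x≤1 η 0<η))
          (N , λ n N≤n → h N n ℕₚ.≤-refl N≤n)
    in k , subst (λ r → ∣ real (clamp r) - x ∣ᴿ <ᴿ real ε) (sym νk≡)
             (mk< η 0<η (ev-map (λ n c → subst (ℚ.∣ clamp q ℚ.- seq x n ∣ ℚ.+ η ℚ.≤_) (half+half ε) (ℚₚ.+-monoˡ-≤ η c)) near))

------------------------------------------------------------------------
-- Compact choice, and the multi-valued map with a given closed graph

C-K : (em : ExcludedMiddle 0ℓ) → 𝒜₋ unitInterval em ⇉ Cauchy unitInterval
C-K em = record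
  { values = ClosedSubset.member
  ; resp   = λ {A} {B} {x} {y} A≐B x≈y a → Equivalence.to (A≐B y) (ClosedSubset.resp A {x} {y} x≈y a)
  }

section : (X Y : SeparableMetricSpace) → ClosedSubset (X ⊗ Y) → Cauchy X ⇉ Cauchy Y
section X Y A = record
  { values = λ x y → (x , y) ∈ ClosedSubset.member A
  ; resp   = λ x≈x′ y≈y′ → ClosedSubset.resp A (x≈x′ , y≈y′)
  }

{-# OPTIONS --safe #-}

-- A point y of Y is coded by a sequence of bits, the j-th of which tells whether
-- y lies in the j-th rational ball, and the sequence is coded by a point t of
-- [0,1]. For each j, two overlapping open sets that cover [0,1] tell which values
-- of the j-th bit are compatible with t. If 1 is, then y has to be in the closed
-- ball; if 0 is, then y must not be in the open ball. The points y that violate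
-- one of these conditions, or (x,y) ∈ A, form a union of rational balls, which
-- can be enumerated from x and t. As Y is compact, t is not a code of any
-- solution y iff finitely many of these balls cover Y. The finite covers of Y are
-- computably enumerable, so the codes of solutions form a closed set that is
-- co-c.e. relative to x. Conversely, y lies in balls of arbitrarily small radius,
-- and a search for such balls whose bit in t can be 1 yields a Cauchy name of y.

module Submission where

open import Defs
open import Axiom.ExcludedMiddle using (ExcludedMiddle)
open import Data.Empty using (⊥; ⊥-elim)
open import Data.Fin.Base using (Fin; zero; suc)
open import Data.Fin.Patterns using (0F; 1F; 2F; 3F; 4F)
open import Data.Integer.Base as ℤ using (+_)
import Data.Integer.Properties as ℤₚ
import Data.Integer.Solver
open import Data.List.Base using (List; []; _∷_; length; map)
open import Data.List.Relation.Unary.All as All using (All; []; _∷_)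
open import Data.List.Relation.Unary.Any as Any using (Any)
import Data.List.Relation.Unary.Any.Properties as Anyₚ
open import Data.Nat.Base as ℕ using (ℕ; zero; suc; pred)
import Data.Nat.Properties as ℕₚ
import Data.Nat.Solver
open import Data.Product.Base using (_×_; _,_; ∃-syntax; Σ-syntax; proj₁; proj₂)
open import Data.Rational.Base as ℚ using (ℚ; 0ℚ; 1ℚ; ½)
import Data.Rational.Properties as ℚₚ
import Data.Rational.Solver
open import Data.Rational.Unnormalised.Base as ℚᵘ using (mkℚᵘ)
import Data.Rational.Unnormalised.Properties as ℚᵘₚ
open import Data.Sum.Base using (_⊎_; inj₁; inj₂)
open import Data.Vec.Base using (Vec; []; _∷_; lookup; tabulate)
open import Data.Vec.Relation.Binary.Pointwise.Inductive using (Pointwise; []; _∷_)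
open import Function.Bundles using (_⇔_; mk⇔; module Equivalence)
open import Level using (0ℓ)
open import Relation.Binary.Definitions using (Tri; tri<; tri≈; tri>)
open import Relation.Binary.PropositionalEquality using (_≡_; _≢_; _≗_; refl; sym; trans; cong; cong₂; subst; subst₂)
open import Relation.Binary.Structures using (IsEquivalence)
open import Relation.Nullary.Decidable.Core using (Dec; yes; no; decidable-stable)
open import Relation.Nullary.Negation.Core using (¬_)
open import Relation.Unary using (_∈_)
open ComputableMetricSpace using (space)
open ClosedSubset using (member)

-- Evaluation of codes

-- Membership of y in an open ball is only semidecidable and [0,1] is connected, so exact bits
-- cannot be read off a point t. The sets for the two bit values therefore overlap, and some t allow
-- both. The constraints tolerate this: points on the sphere satisfy both of them, and each
-- violation is an open condition on y that is confirmed by finitely many rational data. Existence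
-- of a code may be ineffective: excluded middle fixes each bit, and the chosen point keeps clear of
-- the sets of the opposite bits, so compact choice is applied to a non-empty set. Decoding has to
-- terminate for every survivor, not only for such clean codes: if y lies in an open ball, bit 0 is
-- excluded, and as the two sets cover [0,1], bit 1 is possible. All tests are formal: rational
-- inequalities between centres and radii with an explicit error term, sound at every precision and
-- met once the precision is high enough.

⇓-det : ∀ {p k} {e : Code k} {xs u v} → p ⊢ e · xs ⇓ u → p ⊢ e · xs ⇓ v → u ≡ v
⇓-det* : ∀ {p k m} {es : Vec (Code k) m} {xs us vs} →
         Pointwise (λ e u → p ⊢ e · xs ⇓ u) es us → Pointwise (λ e v → p ⊢ e · xs ⇓ v) es vs → us ≡ vs
⇓-det zero⇓ zero⇓ = refl
⇓-det suc⇓ suc⇓ = refl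
⇓-det oracle⇓ oracle⇓ = refl
⇓-det proj⇓ proj⇓ = refl
⇓-det (comp⇓ gs f) (comp⇓ gs′ f′) with refl ← ⇓-det* gs gs′ = ⇓-det f f′
⇓-det (prec0⇓ f) (prec0⇓ f′) = ⇓-det f f′
⇓-det (prec+⇓ r g) (prec+⇓ r′ g′) with refl ← ⇓-det r r′ = ⇓-det g g′
⇓-det (min⇓ {n = m} below f) (min⇓ {n = n} below′ f′) with ℕₚ.<-cmp m n
... | tri< m<n _ _ with () ← ⇓-det f (proj₂ (below′ m m<n))
... | tri≈ _ m≡n _ = m≡n
... | tri> _ _ n<m with () ← ⇓-det (proj₂ (below n n<m)) f′
⇓-det* [] [] = refl
⇓-det* (g ∷ gs) (g′ ∷ gs′) = cong₂ _∷_ (⇓-det g g′) (⇓-det* gs gs′)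

-- Partial functions on Baire space have to respect pointwise equality of oracles.
⇓-resp : ∀ {p p′ k} {e : Code k} {xs v} → p ≗ p′ → p ⊢ e · xs ⇓ v → p′ ⊢ e · xs ⇓ v
⇓-resp* : ∀ {p p′ k m} {es : Vec (Code k) m} {xs vs} → p ≗ p′ →
          Pointwise (λ e v → p ⊢ e · xs ⇓ v) es vs → Pointwise (λ e v → p′ ⊢ e · xs ⇓ v) es vs
⇓-resp p≗p′ zero⇓ = zero⇓
⇓-resp p≗p′ suc⇓ = suc⇓
⇓-resp {p′ = p′} p≗p′ (oracle⇓ {n}) = subst (p′ ⊢ oracleᶜ · n ∷ [] ⇓_) (sym (p≗p′ n)) oracle⇓
⇓-resp p≗p′ proj⇓ = proj⇓
⇓-resp p≗p′ (comp⇓ gs f) = comp⇓ (⇓-resp* p≗p′ gs) (⇓-resp p≗p′ f)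
⇓-resp p≗p′ (prec0⇓ f) = prec0⇓ (⇓-resp p≗p′ f)
⇓-resp p≗p′ (prec+⇓ r g) = prec+⇓ (⇓-resp p≗p′ r) (⇓-resp p≗p′ g)
⇓-resp p≗p′ (min⇓ below f) =
  min⇓ (λ m m<n → proj₁ (below m m<n) , ⇓-resp p≗p′ (proj₂ (below m m<n))) (⇓-resp p≗p′ f)
⇓-resp* p≗p′ [] = []
⇓-resp* p≗p′ (g ∷ gs) = ⇓-resp p≗p′ g ∷ ⇓-resp* p≗p′ gs

-- Programs without oracle run with the constant zero oracle, so they can be
-- run with any oracle once their oracle calls are replaced by zero.
oracleFree : ∀ {k} → Code k → Code k
oracleFree* : ∀ {k m} → Vec (Code k) m → Vec (Code k) m
oracleFree zeroᶜ = zeroᶜ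
oracleFree sucᶜ = sucᶜ
oracleFree oracleᶜ = zeroᶜ
oracleFree (projᶜ i) = projᶜ i
oracleFree (compᶜ f gs) = compᶜ (oracleFree f) (oracleFree* gs)
oracleFree (precᶜ f g) = precᶜ (oracleFree f) (oracleFree g)
oracleFree (minᶜ f) = minᶜ (oracleFree f)
oracleFree* [] = []
oracleFree* (g ∷ gs) = oracleFree g ∷ oracleFree* gs

oracleFree⇓ : ∀ {p k} {e : Code k} {xs v} → e · xs ⇓ v → p ⊢ oracleFree e · xs ⇓ v
oracleFree⇓* : ∀ {p k m} {es : Vec (Code k) m} {xs vs} →
               Pointwise (λ e v → e · xs ⇓ v) es vs → Pointwise (λ e v → p ⊢ e · xs ⇓ v) (oracleFree* es) vs
oracleFree⇓ zero⇓ = zero⇓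
oracleFree⇓ suc⇓ = suc⇓
oracleFree⇓ oracle⇓ = zero⇓
oracleFree⇓ proj⇓ = proj⇓
oracleFree⇓ (comp⇓ gs f) = comp⇓ (oracleFree⇓* gs) (oracleFree⇓ f)
oracleFree⇓ (prec0⇓ f) = prec0⇓ (oracleFree⇓ f)
oracleFree⇓ (prec+⇓ r g) = prec+⇓ (oracleFree⇓ r) (oracleFree⇓ g)
oracleFree⇓ (min⇓ below f) =
  min⇓ (λ m m<n → proj₁ (below m m<n) , oracleFree⇓ (proj₂ (below m m<n))) (oracleFree⇓ f)
oracleFree⇓* [] = []
oracleFree⇓* (g ∷ gs) = oracleFree⇓ g ∷ oracleFree⇓* gs

functional : Code 1 → (𝔹-setoid ⇀ 𝔹-setoid)
functional e .graph p q = ∀ n → p ⊢ e · n ∷ [] ⇓ q n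
functional e .resp {p} {p′} p≗p′ q≗q′ h n = subst (p′ ⊢ e · n ∷ [] ⇓_) (q≗q′ n) (⇓-resp p≗p′ (h n))
functional e .single h h′ n = ⇓-det (h n) (h′ n)

functional-computable : ∀ e → Computable (functional e)
functional-computable e = e , λ p q → mk⇔ (λ h → h) (λ h → h)

-- Programs for total functions

natrec : ∀ {a} {A : Set a} → A → (ℕ → A → A) → ℕ → A
natrec z s zero    = z
natrec z s (suc n) = s n (natrec z s n)

record Computes {k} (f : 𝔹 → Vec ℕ k → ℕ) : Set where
  field
    code    : Code k
    correct : ∀ p xs → p ⊢ code · xs ⇓ f p xs

record Computes₁ (f : 𝔹 → ℕ → ℕ) : Set where
  field
    code    : Code 1
    correct : ∀ p x → p ⊢ code · x ∷ [] ⇓ f p x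

record Computes₂ (f : 𝔹 → ℕ → ℕ → ℕ) : Set where
  field
    code    : Code 2
    correct : ∀ p x y → p ⊢ code · x ∷ y ∷ [] ⇓ f p x y

record Computes₃ (f : 𝔹 → ℕ → ℕ → ℕ → ℕ) : Set where
  field
    code    : Code 3
    correct : ∀ p x y z → p ⊢ code · x ∷ y ∷ z ∷ [] ⇓ f p x y z

fn₁ : ∀ {f} → Computes {1} f → Computes₁ (λ p x → f p (x ∷ []))
fn₁ c = record { code = code ; correct = λ p x → correct p (x ∷ []) }
  where open Computes c

fn₂ : ∀ {f} → Computes {2} f → Computes₂ (λ p x y → f p (x ∷ y ∷ []))
fn₂ c = record { code = code ; correct = λ p x y → correct p (x ∷ y ∷ []) }
  where open Computes c

fn₃ : ∀ {f} → Computes {3} f → Computes₃ (λ p x y z → f p (x ∷ y ∷ z ∷ []))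
fn₃ c = record { code = code ; correct = λ p x y z → correct p (x ∷ y ∷ z ∷ []) }
  where open Computes c

ext₁ : ∀ {f g} → (∀ p x → f p x ≡ g p x) → Computes₁ f → Computes₁ g
ext₁ e c = record { code = code ; correct = λ p x → subst (p ⊢ code · _ ⇓_) (e p x) (correct p x) }
  where open Computes₁ c

ext₂ : ∀ {f g} → (∀ p x y → f p x y ≡ g p x y) → Computes₂ f → Computes₂ g
ext₂ e c = record { code = code ; correct = λ p x y → subst (p ⊢ code · _ ⇓_) (e p x y) (correct p x y) }
  where open Computes₂ c

module _ {k : ℕ} where

  zeroᵗ : Computes {k} (λ _ _ → 0)
  zeroᵗ = record { code = zeroᶜ ; correct = λ _ _ → zero⇓ }

  var : ∀ i → Computes {k} (λ _ xs → lookup xs i)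
  var i = record { code = projᶜ i ; correct = λ _ _ → proj⇓ }

  ap₁ : ∀ {f g} → Computes₁ f → Computes {k} g → Computes {k} (λ p xs → f p (g p xs))
  ap₁ f g = record { code = compᶜ F.code (G.code ∷ []) ; correct = λ p xs → comp⇓ (G.correct p xs ∷ []) (F.correct p _) }
    where module F = Computes₁ f
          module G = Computes g

  ap₂ : ∀ {f g h} → Computes₂ f → Computes {k} g → Computes {k} h → Computes {k} (λ p xs → f p (g p xs) (h p xs))
  ap₂ f g h = record
    { code    = compᶜ F.code (G.code ∷ H.code ∷ [])
    ; correct = λ p xs → comp⇓ (G.correct p xs ∷ H.correct p xs ∷ []) (F.correct p _ _)
    }
    where module F = Computes₂ f
          module G = Computes g
          module H = Computes h

  ap₃ : ∀ {f g h i} → Computes₃ f → Computes {k} g → Computes {k} h → Computes {k} i →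
        Computes {k} (λ p xs → f p (g p xs) (h p xs) (i p xs))
  ap₃ f g h i = record
    { code    = compᶜ F.code (G.code ∷ H.code ∷ I.code ∷ [])
    ; correct = λ p xs → comp⇓ (G.correct p xs ∷ H.correct p xs ∷ I.correct p xs ∷ []) (F.correct p _ _ _)
    }
    where module F = Computes₃ f
          module G = Computes g
          module H = Computes h
          module I = Computes i

  projections⇓ : ∀ {p m} (σ : Fin m → Fin k) {xs : Vec ℕ k} ys → (∀ i → lookup xs (σ i) ≡ lookup ys i) →
                 Pointwise (λ e y → p ⊢ e · xs ⇓ y) (tabulate (λ i → projᶜ (σ i))) ys
  projections⇓ σ [] e = []
  projections⇓ {p} σ {xs} (y ∷ ys) e =
    subst (p ⊢ projᶜ (σ zero) · xs ⇓_) (e zero) proj⇓ ∷ projections⇓ (λ i → σ (suc i)) ys (λ i → e (suc i))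

  -- In the step, variable 0 is the counter and variable 1 the value so far; the parameters are
  -- shifted by two.
  rec : ∀ {z s n} → Computes {k} z → Computes {2 ℕ.+ k} s → Computes {k} n →
        Computes {k} (λ p xs → natrec (z p xs) (λ m u → s p (m ∷ u ∷ xs)) (n p xs))
  rec {z} {s} {n} cz cs cn = record
    { code    = compᶜ (precᶜ Z.code S.code) (N.code ∷ tabulate projᶜ)
    ; correct = λ p xs → comp⇓ (N.correct p xs ∷ projections⇓ (λ i → i) xs (λ _ → refl)) (loop p xs (n p xs))
    }
    where
    module Z = Computes cz
    module S = Computes cs
    module N = Computes cn
    loop : ∀ p xs m → p ⊢ precᶜ Z.code S.code · m ∷ xs ⇓ natrec (z p xs) (λ m u → s p (m ∷ u ∷ xs)) m
    loop p xs zero    = prec0⇓ (Z.correct p xs)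
    loop p xs (suc m) = prec+⇓ (loop p xs m) (S.correct p _)

sucᵖ : Computes₁ (λ _ → suc)
sucᵖ = record { code = sucᶜ ; correct = λ _ _ → suc⇓ }

oracleᵖ : Computes₁ (λ p → p)
oracleᵖ = record { code = oracleᶜ ; correct = λ _ _ → oracle⇓ }

computableSeq : ∀ {a} → ComputableSeq a → Computes₁ (λ _ → a)
computableSeq (e , h) = record { code = oracleFree e ; correct = λ _ n → oracleFree⇓ (h n) }

lit : ∀ {k} n → Computes {k} (λ _ _ → n)
lit zero    = zeroᵗ
lit (suc n) = ap₁ sucᵖ (lit n)

least : ∀ {P : ℕ → Set} → (∀ n → Dec (P n)) → ∀ n → P n → ∃[ m ] P m × (∀ i → i ℕ.< m → ¬ P i)
least P? zero    Pn = 0 , Pn , λ _ ()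
least {P} P? (suc n) Pn with P? 0
... | yes P0 = 0 , P0 , λ _ ()
... | no ¬P0 with least {λ i → P (suc i)} (λ i → P? (suc i)) n Pn
...   | m , Pm , below = suc m , Pm , λ { zero _ → ¬P0 ; (suc i) (ℕ.s≤s i<m) → below i i<m }

-- `minᶜ` requires nonzero values at all smaller arguments, so it returns the least zero, which may
-- differ from the given one.
search : ∀ {k f} (c : Computes {suc k} f) p xs n → f p (n ∷ xs) ≡ 0 →
         ∃[ m ] f p (m ∷ xs) ≡ 0 × p ⊢ minᶜ (Computes.code c) · xs ⇓ m
search {f = f} c p xs n fn≡0 with least (λ m → f p (m ∷ xs) ℕₚ.≟ 0) n fn≡0
... | m , fm≡0 , below = m , fm≡0 , min⇓
  (λ i i<m → pred (f p (i ∷ xs)) , subst (p ⊢ code · i ∷ xs ⇓_) (sym (nonzero (below i i<m))) (correct p (i ∷ xs)))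
  (subst (p ⊢ code · m ∷ xs ⇓_) fm≡0 (correct p (m ∷ xs)))
  where
  open Computes c
  nonzero : ∀ {n} → n ≢ 0 → suc (pred n) ≡ n
  nonzero {zero}  n≢0 = ⊥-elim (n≢0 refl)
  nonzero {suc n} _   = refl

-- Arithmetic programs

+ᵖ : Computes₂ (λ _ → ℕ._+_)
+ᵖ = ext₂ (λ _ → eq) (fn₂ (rec (var 1F) (ap₁ sucᵖ (var 1F)) (var 0F)))
  where
  eq : ∀ x y → natrec y (λ _ u → suc u) x ≡ x ℕ.+ y
  eq zero    y = refl
  eq (suc x) y = cong suc (eq x y)

infixl 6 _⊕_ _⊖_
infixl 7 _⊗ᵗ_

_⊕_ : ∀ {k f g} → Computes {k} f → Computes g → Computes (λ p xs → f p xs ℕ.+ g p xs)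
_⊕_ = ap₂ +ᵖ

*ᵖ : Computes₂ (λ _ → ℕ._*_)
*ᵖ = ext₂ (λ _ → eq) (fn₂ (rec zeroᵗ (var 3F ⊕ var 1F) (var 0F)))
  where
  eq : ∀ x y → natrec 0 (λ _ u → y ℕ.+ u) x ≡ x ℕ.* y
  eq zero    y = refl
  eq (suc x) y = cong (y ℕ.+_) (eq x y)

_⊗ᵗ_ : ∀ {k f g} → Computes {k} f → Computes g → Computes (λ p xs → f p xs ℕ.* g p xs)
_⊗ᵗ_ = ap₂ *ᵖ

predᵖ : Computes₁ (λ _ → pred)
predᵖ = ext₁ (λ _ → eq) (fn₁ (rec zeroᵗ (var 0F) (var 0F)))
  where
  eq : ∀ x → natrec 0 (λ n _ → n) x ≡ pred x
  eq zero    = refl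
  eq (suc x) = refl

∸ᵖ : Computes₂ (λ _ → ℕ._∸_)
∸ᵖ = ext₂ (λ _ → eq) (fn₂ (rec (var 0F) (ap₁ predᵖ (var 1F)) (var 1F)))
  where
  eq : ∀ x y → natrec x (λ _ → pred) y ≡ x ℕ.∸ y
  eq x zero    = refl
  eq x (suc y) = trans (cong pred (eq x y)) (ℕₚ.pred[m∸n]≡m∸[1+n] x y)

_⊖_ : ∀ {k f g} → Computes {k} f → Computes g → Computes (λ p xs → f p xs ℕ.∸ g p xs)
_⊖_ = ap₂ ∸ᵖ

^ᵖ : Computes₂ (λ _ → ℕ._^_)
^ᵖ = ext₂ (λ _ → eq) (fn₂ (rec (lit 1) (var 2F ⊗ᵗ var 1F) (var 1F)))
  where
  eq : ∀ x y → natrec 1 (λ _ u → x ℕ.* u) y ≡ x ℕ.^ y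
  eq x zero    = refl
  eq x (suc y) = cong (x ℕ.*_) (eq x y)

parity : ℕ → ℕ
parity = natrec 0 (λ _ u → 1 ℕ.∸ u)

parityᵖ : Computes₁ (λ _ → parity)
parityᵖ = fn₁ (rec zeroᵗ (lit 1 ⊖ var 1F) (var 0F))

triangularᵖ : Computes₁ (λ _ → triangular)
triangularᵖ = ext₁ (λ _ → eq) (fn₁ (rec zeroᵗ (ap₁ sucᵖ (var 0F) ⊕ var 1F) (var 0F)))
  where
  eq : ∀ n → natrec 0 (λ n u → suc n ℕ.+ u) n ≡ triangular n
  eq zero    = refl
  eq (suc n) = cong (suc n ℕ.+_) (eq n)

pairᵖ : Computes₂ (λ _ → pair)
pairᵖ = fn₂ (ap₁ triangularᵖ (var 0F ⊕ var 1F) ⊕ var 1F)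

-- Inverse of the Cantor pairing

fst snd : ℕ → ℕ
fst k = proj₁ (unpair k)
snd k = proj₂ (unpair k)

pair-next : ∀ m n → pair (proj₁ (next (m , n))) (proj₂ (next (m , n))) ≡ suc (pair m n)
pair-next zero    n = trans (ℕₚ.+-identityʳ _)
  (trans (cong triangular (ℕₚ.+-identityʳ (suc n))) (cong suc (ℕₚ.+-comm n (triangular n))))
pair-next (suc m) n = trans (ℕₚ.+-suc _ n) (cong (λ s → suc (triangular s ℕ.+ n)) (ℕₚ.+-suc m n))

pair-unpair : ∀ k → pair (fst k) (snd k) ≡ k
pair-unpair zero    = refl
pair-unpair (suc k) = trans (pair-next (fst k) (snd k)) (cong suc (pair-unpair k))

fst-pair : ∀ m n → fst (pair m n) ≡ m
fst-pair m n = cong proj₁ (unpair-pair m n)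

snd-pair : ∀ m n → snd (pair m n) ≡ n
snd-pair m n = cong proj₂ (unpair-pair m n)

n≤pair : ∀ m n → n ℕ.≤ pair m n
n≤pair m n = ℕₚ.m≤n+m n (triangular (m ℕ.+ n))

-- The components of unpair k satisfy a simultaneous recursion only, but both can
-- be read off the antidiagonal of k, which satisfies a primitive recursion.
antidiagonal : ℕ → ℕ
antidiagonal = natrec 0 (λ k s → (1 ℕ.∸ (s ℕ.∸ (k ℕ.∸ triangular s))) ℕ.+ s)

snd-antidiagonal : ∀ k {s} → s ≡ fst k ℕ.+ snd k → k ℕ.∸ triangular s ≡ snd k
snd-antidiagonal k refl = trans (cong (ℕ._∸ triangular (fst k ℕ.+ snd k)) (sym (pair-unpair k)))
  (ℕₚ.m+n∸m≡n (triangular (fst k ℕ.+ snd k)) (snd k))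

fst-antidiagonal : ∀ k {s} → s ≡ fst k ℕ.+ snd k → s ℕ.∸ (k ℕ.∸ triangular s) ≡ fst k
fst-antidiagonal k {s} e = trans (cong₂ ℕ._∸_ e (snd-antidiagonal k e)) (ℕₚ.m+n∸n≡m (fst k) (snd k))

-- `next` moves on to the following antidiagonal exactly when the first component is 0, which is
-- what the summand `1 ∸ m` detects.
antidiagonal-unpair : ∀ k → antidiagonal k ≡ fst k ℕ.+ snd k
antidiagonal-unpair zero    = refl
antidiagonal-unpair (suc k) =
  trans (cong₂ (λ m s → (1 ℕ.∸ m) ℕ.+ s) (fst-antidiagonal k ih) ih) (step (fst k) (snd k))
  where
  ih = antidiagonal-unpair k
  step : ∀ m n → (1 ℕ.∸ m) ℕ.+ (m ℕ.+ n) ≡ proj₁ (next (m , n)) ℕ.+ proj₂ (next (m , n))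
  step zero    n = cong suc (sym (ℕₚ.+-identityʳ n))
  step (suc m) n = trans (cong (ℕ._+ (suc m ℕ.+ n)) (ℕₚ.0∸n≡0 m)) (sym (ℕₚ.+-suc m n))

antidiagonalᵖ : Computes₁ (λ _ → antidiagonal)
antidiagonalᵖ = fn₁ (rec zeroᵗ
  ((lit 1 ⊖ (var 1F ⊖ (var 0F ⊖ ap₁ triangularᵖ (var 1F)))) ⊕ var 1F) (var 0F))

sndᵖ : Computes₁ (λ _ → snd)
sndᵖ = ext₁ (λ _ k → snd-antidiagonal k (antidiagonal-unpair k))
  (fn₁ (var 0F ⊖ ap₁ triangularᵖ (ap₁ antidiagonalᵖ (var 0F))))

fstᵖ : Computes₁ (λ _ → fst)
fstᵖ = ext₁ (λ _ k → fst-antidiagonal k (antidiagonal-unpair k))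
  (fn₁ (ap₁ antidiagonalᵖ (var 0F) ⊖ (var 0F ⊖ ap₁ triangularᵖ (ap₁ antidiagonalᵖ (var 0F)))))

-- Codes of lists and bounded tests

encodeList-surjective : ∀ e → ∃[ L ] encodeList L ≡ e
encodeList-surjective e = go e e ℕₚ.≤-refl
  where
  -- The bound `b` makes the recursion structural: the tail of the list coded by `suc e` has code
  -- `snd e`, which is at most `e`.
  go : ∀ b e → e ℕ.≤ b → ∃[ L ] encodeList L ≡ e
  go b       zero    _          = [] , refl
  go (suc b) (suc e) (ℕ.s≤s e≤b) =
    let L , eq = go b (snd e) (ℕₚ.≤-trans (subst (snd e ℕ.≤_) (pair-unpair e) (n≤pair (fst e) (snd e))) e≤b)
    in fst e ∷ L , cong suc (trans (cong (pair (fst e)) eq) (pair-unpair e))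

-- The code of the list without its first entries; `pred` strips the successor of a cons code. Past
-- the end it stays at 0, the code of the empty list.
drop : ℕ → ℕ → ℕ
drop e = natrec e (λ _ u → snd (pred u))

-- Tests succeed with the value 0, so that conjunctions are sums and
-- disjunctions are products.

anyBelow : (ℕ → ℕ) → ℕ → ℕ
anyBelow f = natrec 1 (λ n u → f n ℕ.* u)

allBelow : (ℕ → ℕ) → ℕ → ℕ
allBelow f = natrec 0 (λ n u → f n ℕ.+ u)

nonEmpty : ℕ → ℕ
nonEmpty e = 1 ℕ.∸ (1 ℕ.∸ e)

-- The code of a list bounds its length, so `e` rounds reach every entry. In the rounds past the
-- end, the factor `nonEmpty` is 0 and the test passes.
allItems : (ℕ → ℕ) → ℕ → ℕ
allItems f e = allBelow (λ i → nonEmpty (drop e i) ℕ.* f (fst (pred (drop e i)))) e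

anyBelow-intro : ∀ f {n m} → n ℕ.< m → f n ≡ 0 → anyBelow f m ≡ 0
anyBelow-intro f {n} {suc m} n<1+m fn≡0 with ℕₚ.m≤n⇒m<n∨m≡n (ℕ.s≤s⁻¹ n<1+m)
... | inj₁ n<m  = trans (cong (f m ℕ.*_) (anyBelow-intro f n<m fn≡0)) (ℕₚ.*-zeroʳ (f m))
... | inj₂ refl = cong (ℕ._* anyBelow f m) fn≡0

anyBelow-elim : ∀ f m → anyBelow f m ≡ 0 → ∃[ n ] f n ≡ 0
anyBelow-elim f (suc m) h with ℕₚ.m*n≡0⇒m≡0∨n≡0 (f m) h
... | inj₁ fm≡0 = m , fm≡0
... | inj₂ rest = anyBelow-elim f m rest

allBelow-intro : ∀ f m → (∀ n → f n ≡ 0) → allBelow f m ≡ 0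
allBelow-intro f zero    h = refl
allBelow-intro f (suc m) h = cong₂ ℕ._+_ (h m) (allBelow-intro f m h)

allBelow-elim : ∀ f {n m} → n ℕ.< m → allBelow f m ≡ 0 → f n ≡ 0
allBelow-elim f {n} {suc m} n<1+m h with ℕₚ.m≤n⇒m<n∨m≡n (ℕ.s≤s⁻¹ n<1+m)
... | inj₁ n<m  = allBelow-elim f n<m (ℕₚ.m+n≡0⇒n≡0 (f m) h)
... | inj₂ refl = ℕₚ.m+n≡0⇒m≡0 (f m) h

drop-∷ : ∀ l L i → drop (encodeList (l ∷ L)) (suc i) ≡ drop (encodeList L) i
drop-∷ l L zero    = snd-pair l (encodeList L)
drop-∷ l L (suc i) = cong (λ u → snd (pred u)) (drop-∷ l L i)

module _ (f : ℕ → ℕ) where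

  private
    item : ℕ → ℕ
    item u = nonEmpty u ℕ.* f (fst (pred u))

    item-∷ : ∀ l L → item (encodeList (l ∷ L)) ≡ f l
    item-∷ l L = trans (cong (λ s → (1 ℕ.∸ s) ℕ.* f (fst u)) (ℕₚ.0∸n≡0 u))
      (trans (ℕₚ.+-identityʳ _) (cong f (fst-pair l (encodeList L))))
      where u = pair l (encodeList L)

  allItems-intro : ∀ {L} → All (λ l → f l ≡ 0) L → allItems f (encodeList L) ≡ 0
  allItems-intro {L} h = allBelow-intro _ (encodeList L) (go h)
    where
    go : ∀ {L} → All (λ l → f l ≡ 0) L → ∀ i → item (drop (encodeList L) i) ≡ 0
    go []                zero    = refl
    go []                (suc i) = trans (cong (λ u → item (snd (pred u))) (drop-[] i)) refl
      where
      drop-[] : ∀ i → drop 0 i ≡ 0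
      drop-[] zero    = refl
      drop-[] (suc i) = cong (λ u → snd (pred u)) (drop-[] i)
    go {l ∷ L} (fl≡0 ∷ h) zero    = trans (item-∷ l L) fl≡0
    go {l ∷ L} (fl≡0 ∷ h) (suc i) = trans (cong item (drop-∷ l L i)) (go h i)

  allItems-elim : ∀ {L} → allItems f (encodeList L) ≡ 0 → All (λ l → f l ≡ 0) L
  allItems-elim {L} h = go L λ i i<n → allBelow-elim _ (ℕₚ.<-≤-trans i<n (length≤ L)) h
    where
    length≤ : ∀ L → length L ℕ.≤ encodeList L
    length≤ []      = ℕ.z≤n
    length≤ (l ∷ L) = ℕ.s≤s (ℕₚ.≤-trans (length≤ L) (n≤pair l (encodeList L)))
    go : ∀ L → (∀ i → i ℕ.< length L → item (drop (encodeList L) i) ≡ 0) → All (λ l → f l ≡ 0) L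
    go []      h = []
    go (l ∷ L) h = trans (sym (item-∷ l L)) (h 0 (ℕ.s≤s ℕ.z≤n)) ∷
      go L λ i i<n → trans (cong item (sym (drop-∷ l L i))) (h (suc i) (ℕ.s≤s i<n))

-- Codes of rational numbers

num⁺ num⁻ den : ℕ → ℕ
num⁺ k = fst (fst k)
num⁻ k = snd (fst k)
den  k = suc (snd k)

-- Cross-multiplication with the negative parts moved to the other side; `suc` makes the comparison
-- strict.
lessℚ : ℕ → ℕ → ℕ
lessℚ k l = suc (num⁺ k ℕ.* den l ℕ.+ num⁻ l ℕ.* den k) ℕ.∸ (num⁺ l ℕ.* den k ℕ.+ num⁻ k ℕ.* den l)

-- Codes store denominators minus one, and `snd l + snd k * den l` is one less than `den k * den l`.
addℚ : ℕ → ℕ → ℕ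
addℚ k l = pair (pair (num⁺ k ℕ.* den l ℕ.+ num⁺ l ℕ.* den k) (num⁻ k ℕ.* den l ℕ.+ num⁻ l ℕ.* den k))
                (snd l ℕ.+ snd k ℕ.* den l)

dyadic : ℕ → ℕ → ℕ
dyadic h m = pair (pair h 0) (pred (2 ℕ.^ m))

-- (a ∸ b) ⊓ c, divided by c, is the truncation of (a - b) / c to [0,1].
clampℚ : ℕ → ℕ
clampℚ k = pair (pair (num⁺ k ℕ.∸ num⁻ k ℕ.∸ (num⁺ k ℕ.∸ num⁻ k ℕ.∸ den k)) 0) (snd k)

-- The distance of two rational numbers whose codes have negative part 0.
gapℚ : ℕ → ℕ → ℕ
gapℚ k l = let x = num⁺ k ℕ.* den l ; y = num⁺ l ℕ.* den k in
  pair (pair ((x ℕ.∸ y) ℕ.+ (y ℕ.∸ x)) 0) (snd l ℕ.+ snd k ℕ.* den l)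

num⁺ᵖ : Computes₁ (λ _ → num⁺)
num⁺ᵖ = fn₁ (ap₁ fstᵖ (ap₁ fstᵖ (var 0F)))

num⁻ᵖ : Computes₁ (λ _ → num⁻)
num⁻ᵖ = fn₁ (ap₁ sndᵖ (ap₁ fstᵖ (var 0F)))

denᵖ : Computes₁ (λ _ → den)
denᵖ = fn₁ (ap₁ sucᵖ (ap₁ sndᵖ (var 0F)))

num⁺ᵗ : ∀ {n} (i : Fin n) → Computes {n} (λ _ xs → num⁺ (lookup xs i))
num⁺ᵗ i = ap₁ num⁺ᵖ (var i)

num⁻ᵗ : ∀ {n} (i : Fin n) → Computes {n} (λ _ xs → num⁻ (lookup xs i))
num⁻ᵗ i = ap₁ num⁻ᵖ (var i)

denᵗ : ∀ {n} (i : Fin n) → Computes {n} (λ _ xs → den (lookup xs i))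
denᵗ i = ap₁ denᵖ (var i)

sndᵗ : ∀ {n} (i : Fin n) → Computes {n} (λ _ xs → snd (lookup xs i))
sndᵗ i = ap₁ sndᵖ (var i)

lessℚᵖ : Computes₂ (λ _ → lessℚ)
lessℚᵖ = fn₂ (ap₁ sucᵖ (num⁺ᵗ 0F ⊗ᵗ denᵗ 1F ⊕ num⁻ᵗ 1F ⊗ᵗ denᵗ 0F) ⊖ (num⁺ᵗ 1F ⊗ᵗ denᵗ 0F ⊕ num⁻ᵗ 0F ⊗ᵗ denᵗ 1F))

addℚᵖ : Computes₂ (λ _ → addℚ)
addℚᵖ = fn₂ (ap₂ pairᵖ (ap₂ pairᵖ (num⁺ᵗ 0F ⊗ᵗ denᵗ 1F ⊕ num⁺ᵗ 1F ⊗ᵗ denᵗ 0F) (num⁻ᵗ 0F ⊗ᵗ denᵗ 1F ⊕ num⁻ᵗ 1F ⊗ᵗ denᵗ 0F))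
                       (sndᵗ 1F ⊕ sndᵗ 0F ⊗ᵗ denᵗ 1F))

dyadicᵖ : Computes₂ (λ _ → dyadic)
dyadicᵖ = fn₂ (ap₂ pairᵖ (ap₂ pairᵖ (var 0F) zeroᵗ) (ap₁ predᵖ (ap₂ ^ᵖ (lit 2) (var 1F))))

clampℚᵖ : Computes₁ (λ _ → clampℚ)
clampℚᵖ = fn₁ (ap₂ pairᵖ (ap₂ pairᵖ (num⁺ᵗ 0F ⊖ num⁻ᵗ 0F ⊖ (num⁺ᵗ 0F ⊖ num⁻ᵗ 0F ⊖ denᵗ 0F)) zeroᵗ) (sndᵗ 0F))

gapℚᵖ : Computes₂ (λ _ → gapℚ)
gapℚᵖ = fn₂ (ap₂ pairᵖ (ap₂ pairᵖ ((x ⊖ y) ⊕ (y ⊖ x)) zeroᵗ) (sndᵗ 1F ⊕ sndᵗ 0F ⊗ᵗ denᵗ 1F))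
  where
  x : Computes {2} _
  x = num⁺ᵗ 0F ⊗ᵗ denᵗ 1F
  y : Computes {2} _
  y = num⁺ᵗ 1F ⊗ᵗ denᵗ 0F

-- Order and arithmetic of fractions of differences

⊖-*-pos : ∀ a b c → (a ℤ.⊖ b) ℤ.* + c ≡ (a ℕ.* c) ℤ.⊖ (b ℕ.* c)
⊖-*-pos a b c = trans (cong (ℤ._* + c) (sym (ℤₚ.m-n≡m⊖n a b)))
  (trans (ℤₚ.*-distribʳ-+ (+ c) (+ a) (ℤ.- (+ b)))
  (trans (cong₂ ℤ._+_ (sym (ℤₚ.pos-* a c)) (trans (sym (ℤₚ.neg-distribˡ-* (+ b) (+ c))) (cong ℤ.-_ (sym (ℤₚ.pos-* b c)))))
         (ℤₚ.m-n≡m⊖n (a ℕ.* c) (b ℕ.* c))))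

⊖-+-⊖ : ∀ a b a′ b′ → (a ℤ.⊖ b) ℤ.+ (a′ ℤ.⊖ b′) ≡ (a ℕ.+ a′) ℤ.⊖ (b ℕ.+ b′)
⊖-+-⊖ a b a′ b′ = trans (cong (ℤ._+ (a′ ℤ.⊖ b′)) (sym (ℤₚ.m-n≡m⊖n a b)))
  (trans (cong (ℤ._+_ (+ a ℤ.- + b)) (sym (ℤₚ.m-n≡m⊖n a′ b′)))
  (trans (solve 4 (λ a b a′ b′ → (a :- b) :+ (a′ :- b′) := (a :+ a′) :- (b :+ b′)) refl (+ a) (+ b) (+ a′) (+ b′))
         (ℤₚ.m-n≡m⊖n (a ℕ.+ a′) (b ℕ.+ b′))))
  where
  open Data.Integer.Solver.+-*-Solver

-- Adding `b + b′` to a comparison of `a ⊖ b` with `a′ ⊖ b′` clears both subtractions and leaves a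
-- comparison in ℕ.
⊖-+-cancel : ∀ a b b′ → (a ℤ.⊖ b) ℤ.+ + (b ℕ.+ b′) ≡ + (a ℕ.+ b′)
⊖-+-cancel a b b′ = trans (ℤₚ.distribˡ-⊖-+-pos (b ℕ.+ b′) a b)
  (trans (cong (ℤ._⊖ b) (trans (cong (a ℕ.+_) (ℕₚ.+-comm b b′)) (sym (ℕₚ.+-assoc a b′ b))))
  (trans (cong ((a ℕ.+ b′ ℕ.+ b) ℤ.⊖_) (sym (ℕₚ.+-identityˡ b)))
  (trans (ℤₚ.⊖-≥ (ℕₚ.m≤n+m b (a ℕ.+ b′))) (cong +_ (ℕₚ.m+n∸n≡m (a ℕ.+ b′) b)))))

⊖-cancel-< : ∀ a b a′ b′ → a ℤ.⊖ b ℤ.< a′ ℤ.⊖ b′ → a ℕ.+ b′ ℕ.< a′ ℕ.+ b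
⊖-cancel-< a b a′ b′ h = ℤₚ.drop‿+<+ (subst₂ ℤ._<_ (⊖-+-cancel a b b′)
  (trans (cong (λ n → (a′ ℤ.⊖ b′) ℤ.+ + n) (ℕₚ.+-comm b b′)) (⊖-+-cancel a′ b′ b))
  (ℤₚ.+-monoˡ-< (+ (b ℕ.+ b′)) h))

⊖-mono-< : ∀ a b a′ b′ → a ℕ.+ b′ ℕ.< a′ ℕ.+ b → a ℤ.⊖ b ℤ.< a′ ℤ.⊖ b′
⊖-mono-< a b a′ b′ h = subst₂ ℤ._<_ (cancel a b b′)
  (trans (cong (λ n → + (a′ ℕ.+ b) ℤ.- + n) (ℕₚ.+-comm b b′)) (cancel a′ b′ b))
  (ℤₚ.+-monoˡ-< (ℤ.- (+ (b ℕ.+ b′))) (ℤ.+<+ h))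
  where
  open Data.Integer.Solver.+-*-Solver
  cancel : ∀ a b b′ → + (a ℕ.+ b′) ℤ.- + (b ℕ.+ b′) ≡ a ℤ.⊖ b
  cancel a b b′ = trans (cong (ℤ._- + (b ℕ.+ b′)) (sym (⊖-+-cancel a b b′)))
    (solve 2 (λ x y → (x :+ y) :- y := x) refl (a ℤ.⊖ b) (+ (b ℕ.+ b′)))

frac : ℕ → ℕ → ℕ → ℚ
frac a b c = (a ℤ.⊖ b) ℚ./ suc c

private
  fracᵘ : ℕ → ℕ → ℕ → ℚᵘ.ℚᵘ
  fracᵘ a b c = mkℚᵘ (a ℤ.⊖ b) c

  toℚᵘ-frac : ∀ a b c → ℚ.toℚᵘ (frac a b c) ℚᵘ.≃ fracᵘ a b c
  toℚᵘ-frac a b c = ℚₚ.toℚᵘ-fromℚᵘ (fracᵘ a b c)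

frac-mono-< : ∀ a b c a′ b′ c′ → a ℕ.* suc c′ ℕ.+ b′ ℕ.* suc c ℕ.< a′ ℕ.* suc c ℕ.+ b ℕ.* suc c′ →
              frac a b c ℚ.< frac a′ b′ c′
frac-mono-< a b c a′ b′ c′ h = ℚₚ.toℚᵘ-cancel-< (begin-strict
  ℚ.toℚᵘ (frac a b c)     ≃⟨ toℚᵘ-frac a b c ⟩
  fracᵘ a b c             <⟨ ℚᵘ.*<* (subst₂ ℤ._<_ (sym (⊖-*-pos a b (suc c′))) (sym (⊖-*-pos a′ b′ (suc c)))
                               (⊖-mono-< (a ℕ.* suc c′) (b ℕ.* suc c′) (a′ ℕ.* suc c) (b′ ℕ.* suc c) h)) ⟩
  fracᵘ a′ b′ c′          ≃⟨ toℚᵘ-frac a′ b′ c′ ⟨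
  ℚ.toℚᵘ (frac a′ b′ c′)  ∎)
  where open ℚᵘₚ.≤-Reasoning

frac-cancel-< : ∀ a b c a′ b′ c′ → frac a b c ℚ.< frac a′ b′ c′ →
                a ℕ.* suc c′ ℕ.+ b′ ℕ.* suc c ℕ.< a′ ℕ.* suc c ℕ.+ b ℕ.* suc c′
frac-cancel-< a b c a′ b′ c′ h = ⊖-cancel-< (a ℕ.* suc c′) (b ℕ.* suc c′) (a′ ℕ.* suc c) (b′ ℕ.* suc c)
  (subst₂ ℤ._<_ (⊖-*-pos a b (suc c′)) (⊖-*-pos a′ b′ (suc c)) (ℚᵘₚ.drop-*<* (begin-strict
    fracᵘ a b c             ≃⟨ toℚᵘ-frac a b c ⟨
    ℚ.toℚᵘ (frac a b c)     <⟨ ℚₚ.toℚᵘ-mono-< h ⟩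
    ℚ.toℚᵘ (frac a′ b′ c′)  ≃⟨ toℚᵘ-frac a′ b′ c′ ⟩
    fracᵘ a′ b′ c′          ∎)))
  where open ℚᵘₚ.≤-Reasoning

frac-mono-≤ : ∀ a b c a′ b′ c′ → a ℕ.* suc c′ ℕ.+ b′ ℕ.* suc c ℕ.≤ a′ ℕ.* suc c ℕ.+ b ℕ.* suc c′ →
              frac a b c ℚ.≤ frac a′ b′ c′
frac-mono-≤ a b c a′ b′ c′ h = ℚₚ.≮⇒≥ λ lt → ℕₚ.<⇒≱ (frac-cancel-< a′ b′ c′ a b c lt) h

frac-≡ : ∀ a b c a′ b′ c′ → a ℕ.* suc c′ ℕ.+ b′ ℕ.* suc c ≡ a′ ℕ.* suc c ℕ.+ b ℕ.* suc c′ →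
         frac a b c ≡ frac a′ b′ c′
frac-≡ a b c a′ b′ c′ e = ℚₚ.≤-antisym (frac-mono-≤ a b c a′ b′ c′ (ℕₚ.≤-reflexive e))
                                        (frac-mono-≤ a′ b′ c′ a b c (ℕₚ.≤-reflexive (sym e)))

frac-+ : ∀ a b c a′ b′ c′ → frac a b c ℚ.+ frac a′ b′ c′ ≡
         frac (a ℕ.* suc c′ ℕ.+ a′ ℕ.* suc c) (b ℕ.* suc c′ ℕ.+ b′ ℕ.* suc c) (c′ ℕ.+ c ℕ.* suc c′)
frac-+ a b c a′ b′ c′ = ℚₚ.toℚᵘ-injective (begin-equality
  ℚ.toℚᵘ (frac a b c ℚ.+ frac a′ b′ c′)                ≃⟨ ℚₚ.toℚᵘ-homo-+ (frac a b c) (frac a′ b′ c′) ⟩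
  ℚ.toℚᵘ (frac a b c) ℚᵘ.+ ℚ.toℚᵘ (frac a′ b′ c′)      ≃⟨ ℚᵘₚ.+-cong (toℚᵘ-frac a b c) (toℚᵘ-frac a′ b′ c′) ⟩
  fracᵘ a b c ℚᵘ.+ fracᵘ a′ b′ c′                      ≡⟨ cong (λ z → mkℚᵘ z (c′ ℕ.+ c ℕ.* suc c′))
                                                            (trans (cong₂ ℤ._+_ (⊖-*-pos a b (suc c′)) (⊖-*-pos a′ b′ (suc c)))
                                                                   (⊖-+-⊖ (a ℕ.* suc c′) (b ℕ.* suc c′) (a′ ℕ.* suc c) (b′ ℕ.* suc c))) ⟩
  fracᵘ A B C                                          ≃⟨ toℚᵘ-frac A B C ⟨
  ℚ.toℚᵘ (frac A B C)                                  ∎)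
  where
  open ℚᵘₚ.≤-Reasoning
  A = a ℕ.* suc c′ ℕ.+ a′ ℕ.* suc c
  B = b ℕ.* suc c′ ℕ.+ b′ ℕ.* suc c
  C = c′ ℕ.+ c ℕ.* suc c′

νℚ-pair : ∀ a b c → νℚ (pair (pair a b) c) ≡ frac a b c
νℚ-pair a b c = trans (cong (λ (s , c) → frac (fst s) (snd s) c) (unpair-pair (pair a b) c))
                      (cong (λ (a , b) → frac a b c) (unpair-pair a b))

lessℚ-sound : ∀ k l → lessℚ k l ≡ 0 → νℚ k ℚ.< νℚ l
lessℚ-sound k l h = frac-mono-< (num⁺ k) (num⁻ k) (snd k) (num⁺ l) (num⁻ l) (snd l) (ℕₚ.m∸n≡0⇒m≤n h)

lessℚ-complete : ∀ k l → νℚ k ℚ.< νℚ l → lessℚ k l ≡ 0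
lessℚ-complete k l h = ℕₚ.m≤n⇒m∸n≡0 (frac-cancel-< (num⁺ k) (num⁻ k) (snd k) (num⁺ l) (num⁻ l) (snd l) h)

νℚ-addℚ : ∀ k l → νℚ (addℚ k l) ≡ νℚ k ℚ.+ νℚ l
νℚ-addℚ k l = trans
  (νℚ-pair (num⁺ k ℕ.* den l ℕ.+ num⁺ l ℕ.* den k) (num⁻ k ℕ.* den l ℕ.+ num⁻ l ℕ.* den k) (snd l ℕ.+ snd k ℕ.* den l))
  (sym (frac-+ (num⁺ k) (num⁻ k) (snd k) (num⁺ l) (num⁻ l) (snd l)))

νℚ-clampℚ : ∀ k → νℚ (clampℚ k) ≡ clamp (νℚ k)
νℚ-clampℚ k = trans (νℚ-pair (x ℕ.∸ (x ℕ.∸ suc c)) 0 c) (eq (ℕₚ.≤-total a b))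
  where
  a = num⁺ k
  b = num⁻ k
  c = snd k
  x = a ℕ.∸ b
  frac-0 : frac 0 0 c ≡ 0ℚ
  frac-0 = frac-≡ 0 0 c 0 0 0 refl
  1-frac : frac (suc c) 0 c ≡ 1ℚ
  1-frac = frac-≡ (suc c) 0 c 1 0 0 (cong (ℕ._+ 0) (trans (ℕₚ.*-identityʳ (suc c)) (sym (ℕₚ.*-identityˡ (suc c)))))
  eq : a ℕ.≤ b ⊎ b ℕ.≤ a → frac (x ℕ.∸ (x ℕ.∸ suc c)) 0 c ≡ clamp (νℚ k)
  eq (inj₁ a≤b) rewrite ℕₚ.m≤n⇒m∸n≡0 a≤b = trans frac-0 (sym (trans
      (cong (0ℚ ℚ.⊔_) (ℚₚ.p≥q⇒p⊓q≡q (ℚₚ.≤-trans ≤0 (ℚₚ.<⇒≤ (ℚₚ.positive⁻¹ 1ℚ)))))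
      (ℚₚ.p≥q⇒p⊔q≡p ≤0)))
    where
    ≤0 : frac a b c ℚ.≤ 0ℚ
    ≤0 = frac-mono-≤ a b c 0 0 0 (ℕₚ.≤-trans (ℕₚ.≤-reflexive (ℕₚ.+-identityʳ (a ℕ.* 1))) (ℕₚ.*-monoˡ-≤ 1 a≤b))
  eq (inj₂ b≤a) = trans (eq′ (ℕₚ.≤-total x (suc c))) (cong clamp (sym x≡))
    where
    x≡ : frac a b c ≡ frac x 0 c
    x≡ = frac-≡ a b c x 0 c (trans (ℕₚ.+-identityʳ (a ℕ.* suc c))
      (trans (cong (ℕ._* suc c) (sym (ℕₚ.m∸n+n≡m b≤a))) (ℕₚ.*-distribʳ-+ (suc c) x b)))
    0≤ : 0ℚ ℚ.≤ frac x 0 c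
    0≤ = frac-mono-≤ 0 0 0 x 0 c ℕ.z≤n
    eq′ : x ℕ.≤ suc c ⊎ suc c ℕ.≤ x → frac (x ℕ.∸ (x ℕ.∸ suc c)) 0 c ≡ clamp (frac x 0 c)
    eq′ (inj₁ x≤c) = trans (cong (λ y → frac (x ℕ.∸ y) 0 c) (ℕₚ.m≤n⇒m∸n≡0 x≤c)) (sym (trans
      (cong (0ℚ ℚ.⊔_) (ℚₚ.p≥q⇒p⊓q≡q (subst (frac x 0 c ℚ.≤_) 1-frac
        (frac-mono-≤ x 0 c (suc c) 0 c (ℕₚ.+-monoˡ-≤ 0 (ℕₚ.*-monoˡ-≤ (suc c) x≤c))))))
      (ℚₚ.p≤q⇒p⊔q≡q 0≤)))
    eq′ (inj₂ c≤x) = trans (cong (λ y → frac y 0 c) (ℕₚ.m∸[m∸n]≡n c≤x)) (trans 1-frac (sym (trans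
      (cong (0ℚ ℚ.⊔_) (ℚₚ.p≤q⇒p⊓q≡p (subst (ℚ._≤ frac x 0 c) 1-frac
        (frac-mono-≤ (suc c) 0 c x 0 c (ℕₚ.+-monoˡ-≤ 0 (ℕₚ.*-monoˡ-≤ (suc c) c≤x))))))
      (ℚₚ.p≤q⇒p⊔q≡q (ℚₚ.<⇒≤ (ℚₚ.positive⁻¹ 1ℚ))))))

+≡⇒∣-∣≡ : ∀ p q r → p ℚ.+ r ≡ q → 0ℚ ℚ.≤ r → ℚ.∣ q ℚ.- p ∣ ≡ r
+≡⇒∣-∣≡ p q r refl 0≤r = trans (cong ℚ.∣_∣ (solve 2 (λ p r → (p :+ r) :- p := r) refl p r)) (ℚₚ.0≤p⇒∣p∣≡p 0≤r)
  where
  open Data.Rational.Solver.+-*-Solver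

-- Adding the smaller fraction back avoids negative numerators. The denominator is a variable so
-- that either order of the two fractions can yield the same code.
frac-∣-∣ : ∀ x c y d → y ℕ.* suc c ℕ.≤ x ℕ.* suc d → ∀ e → suc e ≡ suc c ℕ.* suc d →
           ℚ.∣ frac x 0 c ℚ.- frac y 0 d ∣ ≡ frac (x ℕ.* suc d ℕ.∸ y ℕ.* suc c) 0 e
frac-∣-∣ x c y d le e e≡ = +≡⇒∣-∣≡ (frac y 0 d) (frac x 0 c) (frac z 0 e)
  (trans (frac-+ y 0 d z 0 e) (frac-≡ (y ℕ.* suc e ℕ.+ z ℕ.* suc d) 0 _ x 0 c (cong (ℕ._+ 0) eq)))
  (frac-mono-≤ 0 0 0 z 0 e ℕ.z≤n)
  where
  z = x ℕ.* suc d ℕ.∸ y ℕ.* suc c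
  open Data.Nat.Solver.+-*-Solver
  eq : (y ℕ.* suc e ℕ.+ z ℕ.* suc d) ℕ.* suc c ≡ x ℕ.* (suc e ℕ.+ d ℕ.* suc e)
  eq = trans (cong (λ e → (y ℕ.* e ℕ.+ z ℕ.* suc d) ℕ.* suc c) e≡)
    (trans (solve 4 (λ y z c d → (y :* (c :* d) :+ z :* d) :* c := (y :* c :+ z) :* (d :* c)) refl y z (suc c) (suc d))
    (trans (cong (ℕ._* (suc d ℕ.* suc c)) (ℕₚ.m+[n∸m]≡n le))
    (trans (solve 3 (λ x c d → (x :* d) :* (d :* c) := x :* (d :* (c :* d))) refl x (suc c) (suc d))
           (cong (λ e → x ℕ.* (suc d ℕ.* e)) (sym e≡)))))

νℚ-gapℚ : ∀ k l → num⁻ k ≡ 0 → num⁻ l ≡ 0 → νℚ (gapℚ k l) ≡ ℚ.∣ νℚ k ℚ.- νℚ l ∣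
νℚ-gapℚ k l k⁻≡0 l⁻≡0 = trans (νℚ-pair ((X ℕ.∸ Y) ℕ.+ (Y ℕ.∸ X)) 0 e) (trans (eq (ℕₚ.≤-total Y X))
  (cong₂ (λ b b′ → ℚ.∣ frac x b c ℚ.- frac y b′ d ∣) (sym k⁻≡0) (sym l⁻≡0)))
  where
  x = num⁺ k
  c = snd k
  y = num⁺ l
  d = snd l
  X = x ℕ.* suc d
  Y = y ℕ.* suc c
  e = d ℕ.+ c ℕ.* suc d
  eq : Y ℕ.≤ X ⊎ X ℕ.≤ Y → frac ((X ℕ.∸ Y) ℕ.+ (Y ℕ.∸ X)) 0 e ≡ ℚ.∣ frac x 0 c ℚ.- frac y 0 d ∣
  eq (inj₁ Y≤X) = trans (cong (λ z → frac z 0 e) (trans (cong ((X ℕ.∸ Y) ℕ.+_) (ℕₚ.m≤n⇒m∸n≡0 Y≤X)) (ℕₚ.+-identityʳ (X ℕ.∸ Y))))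
    (sym (frac-∣-∣ x c y d Y≤X e refl))
  eq (inj₂ X≤Y) = trans (cong (λ z → frac (z ℕ.+ (Y ℕ.∸ X)) 0 e) (ℕₚ.m≤n⇒m∸n≡0 X≤Y))
    (trans (sym (frac-∣-∣ y d x c X≤Y e (ℕₚ.*-comm (suc c) (suc d)))) (∣p-q∣≡∣q-p∣ (frac y 0 d) (frac x 0 c)))

num⁻-clampℚ : ∀ k → num⁻ (clampℚ k) ≡ 0
num⁻-clampℚ k = trans (cong snd (fst-pair (pair x 0) (snd k))) (snd-pair x 0)
  where x = num⁺ k ℕ.∸ num⁻ k ℕ.∸ (num⁺ k ℕ.∸ num⁻ k ℕ.∸ den k)

distanceI : ℕ → ℕ → ℕ
distanceI k l = gapℚ (clampℚ k) (clampℚ l)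

νℚ-distanceI : ∀ k l → νℚ (distanceI k l) ≡ ℚ.∣ clamp (νℚ k) ℚ.- clamp (νℚ l) ∣
νℚ-distanceI k l = trans (νℚ-gapℚ (clampℚ k) (clampℚ l) (num⁻-clampℚ k) (num⁻-clampℚ l))
  (cong₂ (λ p q → ℚ.∣ p ℚ.- q ∣) (νℚ-clampℚ k) (νℚ-clampℚ l))

-- Dyadic numbers

infix 8 _/2^_

-- Abstract, so that quotients are compared by their arguments rather than by
-- their normal forms.
abstract

  _/2^_ : ℕ → ℕ → ℚ
  h /2^ m = frac h 0 (pred (2 ℕ.^ m))

  νℚ-dyadic : ∀ h m → νℚ (dyadic h m) ≡ h /2^ m
  νℚ-dyadic h m = νℚ-pair h 0 (pred (2 ℕ.^ m))

  suc-pred-2^ : ∀ m → suc (pred (2 ℕ.^ m)) ≡ 2 ℕ.^ m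
  suc-pred-2^ m = ℕₚ.suc-pred (2 ℕ.^ m) {{ℕₚ.m^n≢0 2 m}}

  /2^-mono-≤ : ∀ {h h′} m → h ℕ.≤ h′ → h /2^ m ℚ.≤ h′ /2^ m
  /2^-mono-≤ {h} {h′} m h≤h′ = frac-mono-≤ h 0 e h′ 0 e (ℕₚ.+-monoˡ-≤ 0 (ℕₚ.*-monoˡ-≤ (suc e) h≤h′))
    where
    e : ℕ
    e = pred (2 ℕ.^ m)

  /2^-mono-< : ∀ {h h′} m → h ℕ.< h′ → h /2^ m ℚ.< h′ /2^ m
  /2^-mono-< {h} {h′} m h<h′ = frac-mono-< h 0 e h′ 0 e (ℕₚ.+-monoˡ-< 0 (ℕₚ.*-monoˡ-< (suc e) h<h′))
    where
    e : ℕ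
    e = pred (2 ℕ.^ m)

  /2^-+ : ∀ h h′ m → h /2^ m ℚ.+ h′ /2^ m ≡ (h ℕ.+ h′) /2^ m
  /2^-+ h h′ m = trans (frac-+ h 0 e h′ 0 e)
    (frac-≡ (h ℕ.* suc e ℕ.+ h′ ℕ.* suc e) 0 _ (h ℕ.+ h′) 0 e (cong (ℕ._+ 0)
      (solve 3 (λ h h′ e → (h :* e :+ h′ :* e) :* e := (h :+ h′) :* (e :* e)) refl h h′ (suc e))))
    where
    open Data.Nat.Solver.+-*-Solver
    e : ℕ
    e = pred (2 ℕ.^ m)

  /2^-suc : ∀ h m → (2 ℕ.* h) /2^ suc m ≡ h /2^ m
  /2^-suc h m = frac-≡ (2 ℕ.* h) 0 _ h 0 _ (cong (ℕ._+ 0)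
    (trans (cong (2 ℕ.* h ℕ.*_) (suc-pred-2^ m))
    (trans (solve 2 (λ h e → con 2 :* h :* e := h :* (con 2 :* e)) refl h (2 ℕ.^ m))
           (cong (h ℕ.*_) (sym (suc-pred-2^ (suc m)))))))
    where open Data.Nat.Solver.+-*-Solver

  0/2^ : ∀ m → 0 /2^ m ≡ 0ℚ
  0/2^ m = frac-≡ 0 0 (pred (2 ℕ.^ m)) 0 0 0 refl

  2^/2^ : ∀ m → (2 ℕ.^ m) /2^ m ≡ 1ℚ
  2^/2^ m = frac-≡ (2 ℕ.^ m) 0 (pred (2 ℕ.^ m)) 1 0 0 (cong (ℕ._+ 0)
    (trans (ℕₚ.*-identityʳ (2 ℕ.^ m)) (trans (sym (suc-pred-2^ m)) (sym (ℕₚ.*-identityˡ (suc (pred (2 ℕ.^ m))))))))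

1/2^ : ∀ m → 1 /2^ m ≡ ½^ m
1/2^ zero    = 2^/2^ 0
1/2^ (suc m) = trans (sym (half+half x)) (trans (sym (ℚₚ.*-distribˡ-+ ½ x x))
  (cong (ℚ._*_ ½) (trans (/2^-+ 1 1 (suc m)) (trans (/2^-suc 1 m) (1/2^ m)))))
  where
  x = 1 /2^ suc m

-- Comparison of real and rational numbers

real-cancel-≤ : ∀ {p q} → real p ≤ᴿ real q → p ℚ.≤ q
real-cancel-≤ h = ℚₚ.≮⇒≥ λ q<p → <ᴿ-irrefl (≤-<ᴿ-trans h (real-mono-< q<p))

≤-real-+ : ∀ {x y p q} → x ≤ᴿ real p → y ≤ᴿ real q → x +ᴿ y ≤ᴿ real (p ℚ.+ q)
≤-real-+ {p = p} {q} h k = ≤ᴿ-trans (+ᴿ-mono-≤ h k) (real-+-≤ p q)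

≤-real-closed : ∀ {x p} → (∀ ε → 0ℚ ℚ.< ε → x ≤ᴿ real (p ℚ.+ ε)) → x ≤ᴿ real p
≤-real-closed {x} {p} h = mk≤ λ ε 0<ε → ev-map
  (λ n → subst (seq x n ℚ.≤_) (+½+½ p ε)) (eventually-≤ (h (½ ℚ.* ε) (½-pos 0<ε)) (½ ℚ.* ε) (½-pos 0<ε))

≮-real⇒≥ : ∀ {x p} → ¬ (real p <ᴿ x) → x ≤ᴿ real p
≮-real⇒≥ {x} {p} ≮ = mk≤ λ ε 0<ε →
  let η     = ½ ℚ.* ε
      0<η   = ½-pos 0<ε
      N , h = cauchy x η 0<η
      xN≤ : seq x N ℚ.≤ p ℚ.+ η
      xN≤ = ℚₚ.≮⇒≥ λ lt → let δ = seq x N ℚ.- (p ℚ.+ η) in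
        ≮ (mk< δ (subst (ℚ._< δ) (ℚₚ.+-inverseʳ (p ℚ.+ η)) (ℚₚ.+-monoˡ-< (ℚ.- (p ℚ.+ η)) lt))
          (N , λ n N≤n → subst₂ ℚ._≤_
            (solve 3 (λ p η s → s :- η := p :+ (s :- (p :+ η))) refl p η (seq x N))
            (solve 2 (λ s η → (s :+ η) :- η := s) refl (seq x n) η)
            (ℚₚ.+-monoˡ-≤ (ℚ.- η) (∣-∣≤⇒≤+ (seq x N) (seq x n) (h N n ℕₚ.≤-refl N≤n)))))
  in N , λ n N≤n → subst (seq x n ℚ.≤_) (+½+½ p ε)
       (ℚₚ.≤-trans (∣-∣≤⇒≤+′ (seq x N) (seq x n) (h N n ℕₚ.≤-refl N≤n)) (ℚₚ.+-monoˡ-≤ η xN≤))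
  where open Data.Rational.Solver.+-*-Solver

approx-upper : ∀ {x q ε} → ∣ x - real q ∣ᴿ ≤ᴿ real ε → x ≤ᴿ real (q ℚ.+ ε)
approx-upper {x} {q} {ε} (mk≤ h) = mk≤ λ η 0<η → ev-map
  (λ n a → subst (seq x n ℚ.≤_) (sym (ℚₚ.+-assoc q ε η)) (∣-∣≤⇒≤+ (seq x n) q a)) (h η 0<η)

approx-lower : ∀ {x q ε c} → ∣ x - real q ∣ᴿ ≤ᴿ real ε → x ≤ᴿ real c → q ℚ.≤ c ℚ.+ ε
approx-lower {x} {q} {ε} {c} (mk≤ h) (mk≤ k) = real-cancel-≤ (mk≤ λ η 0<η → ev-map₂
  (λ n a b → ℚₚ.≤-trans (∣-∣≤⇒≤+′ (seq x n) q a)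
    (ℚₚ.≤-trans (ℚₚ.+-monoˡ-≤ (ε ℚ.+ ½ ℚ.* η) b) (ℚₚ.≤-reflexive (trans
      (solve 3 (λ c ε η → (c :+ η) :+ (ε :+ η) := (c :+ ε) :+ (η :+ η)) refl c ε (½ ℚ.* η))
      (cong ((c ℚ.+ ε) ℚ.+_) (half+half η))))))
  (h (½ ℚ.* η) (½-pos 0<η)) (k (½ ℚ.* η) (½-pos 0<η)))
  where open Data.Rational.Solver.+-*-Solver

-- Eight is a power of two above all sums of errors, in units of 2^-n, that occur below; the largest
-- is the 5 of `inside-complete`.
8/2^≤ : ∀ {δ} → 0ℚ ℚ.< δ → Eventually λ n → 8 /2^ n ℚ.≤ δ
8/2^≤ {δ} 0<δ = let m , ½^m≤δ = archimedean 0<δ in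
  3 ℕ.+ m , λ n 3+m≤n → subst (λ n → 8 /2^ n ℚ.≤ δ) (ℕₚ.m+[n∸m]≡n (ℕₚ.≤-trans (ℕₚ.m≤m+n 3 m) 3+m≤n))
    (ℚₚ.≤-trans (ℚₚ.≤-reflexive (8/2^3+ (n ℕ.∸ 3)))
      (ℚₚ.≤-trans (½^-anti (subst (ℕ._≤ n ℕ.∸ 3) (ℕₚ.m+n∸m≡n 3 m) (ℕₚ.∸-monoˡ-≤ 3 3+m≤n))) ½^m≤δ))
  where
  8/2^3+ : ∀ n → 8 /2^ (3 ℕ.+ n) ≡ ½^ n
  8/2^3+ n = trans (/2^-suc 4 (2 ℕ.+ n)) (trans (/2^-suc 2 (1 ℕ.+ n)) (trans (/2^-suc 1 n) (1/2^ n)))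

room-below : ∀ {x q} → x <ᴿ real q → ∃[ c ] x ≤ᴿ real c × Eventually λ n → c ℚ.+ 8 /2^ n ℚ.≤ q
room-below {x} {q} (mk< δ 0<δ h) = q ℚ.- δ ,
  mk≤ (λ ε 0<ε → ev-map (λ n a → ℚₚ.≤-trans (subst (ℚ._≤ q ℚ.- δ)
      (solve 2 (λ s δ → (s :+ δ) :- δ := s) refl (seq x n) δ) (ℚₚ.+-monoˡ-≤ (ℚ.- δ) a)) (q≤q+ε (q ℚ.- δ) 0<ε)) h) ,
  ev-map (λ n a → subst (q ℚ.- δ ℚ.+ 8 /2^ n ℚ.≤_) (solve 2 (λ q δ → (q :- δ) :+ δ := q) refl q δ)
      (ℚₚ.+-monoʳ-≤ (q ℚ.- δ) a)) (8/2^≤ 0<δ)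
  where open Data.Rational.Solver.+-*-Solver

room-above : ∀ {x q} → real q <ᴿ x → ∃[ c ] real c ≤ᴿ x × Eventually λ n → q ℚ.+ 8 /2^ n ℚ.≤ c
room-above {x} {q} (mk< δ 0<δ h) = q ℚ.+ δ ,
  mk≤ (λ ε 0<ε → ev-map (λ n a → ℚₚ.≤-trans a (q≤q+ε (seq x n) 0<ε)) h) ,
  ev-map (λ n a → ℚₚ.+-monoʳ-≤ q a) (8/2^≤ 0<δ)

-- Formal inclusion and disjointness of rational balls

module _ (Z : SeparableMetricSpace) where
  open SeparableMetricSpace Z

  ball-pair : ∀ i k z → (z ∈ Ball (pair i k)) ≡ (d (α i) z <ᴿ real (νℚ k))
  ball-pair i k z = cong (λ (i , k) → d (α i) z <ᴿ real (νℚ k)) (unpair-pair i k)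

  ball-intro : ∀ {i k z q} → νℚ k ≡ q → d (α i) z <ᴿ real q → z ∈ Ball (pair i k)
  ball-intro {i} {k} {z} refl h = subst (λ P → P) (sym (ball-pair i k z)) h

  ball-elim : ∀ {i k z q} → νℚ k ≡ q → z ∈ Ball (pair i k) → d (α i) z <ᴿ real q
  ball-elim {i} {k} {z} refl h = subst (λ P → P) (ball-pair i k z) h

  ball-0-empty : ∀ z → ¬ (z ∈ Ball 0)
  ball-0-empty z h = <ᴿ-irrefl (≤-<ᴿ-trans nonNegative h)

  ball-open : ∀ n → Open (Ball n)
  ball-open n x h =
    let c , ≤c , N , room = room-below h
        0<ε = subst (0ℚ ℚ.<_) (sym (1/2^ N)) (½^-pos N)
    in 1 /2^ N , 0<ε , λ y xy →
       ≤-<ᴿ-trans (≤ᴿ-trans (triangle (α (fst n)) x y) (≤-real-+ ≤c (<ᴿ⇒≤ᴿ xy)))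
         (real-mono-< (ℚₚ.<-≤-trans (ℚₚ.+-monoʳ-< c (/2^-mono-< N (ℕ.s≤s (ℕ.s≤s ℕ.z≤n)))) (room N ℕₚ.≤-refl)))

  ball-resp : ∀ n {x y} → x ≈ y → x ∈ Ball n → y ∈ Ball n
  ball-resp n x≈y h = ≤-<ᴿ-trans (proj₂ (d-cong (IsEquivalence.refl isEquivalence) x≈y)) h

  name-dist : ∀ {q z} → CauchyName Z q z → ∀ n → d (α (q n)) z ≤ᴿ real (½^ n)
  name-dist {q} {z} c n = ≤-real-closed λ ε 0<ε →
    let N , h = CauchyName.converges c ε 0<ε
        m = suc n ℕ.⊔ N
    in ≤ᴿ-trans (triangle (α (q n)) (α (q m)) z)
         (≤-real-+ (<ᴿ⇒≤ᴿ (CauchyName.rapid c n m (ℕₚ.m≤m⊔n (suc n) N))) (h m (ℕₚ.m≤n⊔m (suc n) N)))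

  d-flip : ∀ x y → d x y ≤ᴿ d y x
  d-flip x y = proj₁ (d-sym x y)

abstract

  around : ℕ → ℕ → ℕ
  around i n = pair i (dyadic 2 n)

  aroundᵖ : Computes₂ (λ _ → around)
  aroundᵖ = fn₂ (ap₂ pairᵖ (var 0F) (ap₂ dyadicᵖ (lit 2) (var 1F)))

  around≡ : ∀ i n → around i n ≡ pair i (dyadic 2 n)
  around≡ i n = refl

-- `name-dist` bounds the distance to the named point by 2^-n only non-strictly; the radius 2 · 2^-n
-- puts the point into the open ball.
nameBall : 𝔹 → ℕ → ℕ
nameBall q n = around (q n) n

name∈nameBall : ∀ Z {q z} → CauchyName Z q z → ∀ n → z ∈ SeparableMetricSpace.Ball Z (nameBall q n)
name∈nameBall Z {q} {z} c n = subst (λ β → z ∈ SeparableMetricSpace.Ball Z β) (sym (around≡ (q n) n)) (ball-intro Z (νℚ-dyadic 2 n)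
  (≤-<ᴿ-trans (name-dist Z c n) (real-mono-< (subst (ℚ._< 2 /2^ n) (1/2^ n) (/2^-mono-< n (ℕ.s≤s (ℕ.s≤s ℕ.z≤n)))))))

module FormalBalls (Z : ComputableMetricSpace) where
  open ComputableMetricSpace Z hiding (space)

  dist : ℕ → ℕ → ℕ → ℕ
  dist i j n = proj₁ (proj₂ computable i j n)

  dist-approx : ∀ i j n → ∣ d (α i) (α j) - real (νℚ (dist i j n)) ∣ᴿ ≤ᴿ real (½^ n)
  dist-approx i j n = proj₂ (proj₂ (proj₂ computable i j n))

  distᵖ : Computes₃ (λ _ → dist)
  distᵖ = record
    { code    = oracleFree (proj₁ computable)
    ; correct = λ _ i j n → oracleFree⇓ (proj₁ (proj₂ (proj₂ computable i j n)))
    }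

  abstract

    -- `dist` at precision `r` errs by at most 2^-r; the surplus of the same size makes the test
    -- `inside` sound for every `r`.
    reach : ℕ → ℕ → ℕ → ℕ
    reach r β γ = addℚ (addℚ (dist (fst β) (fst γ) r) (dyadic 1 r)) (snd β)

    inside : ℕ → ℕ → ℕ → ℕ
    inside r β γ = lessℚ (reach r β γ) (snd γ)

    radii : ℕ → ℕ → ℕ → ℕ
    radii r β γ = addℚ (addℚ (snd β) (snd γ)) (dyadic 1 r)

    apart : ℕ → ℕ → ℕ → ℕ
    apart r β γ = lessℚ (radii r β γ) (dist (fst β) (fst γ) r)

    insideᵖ : Computes₃ (λ _ → inside)
    insideᵖ = fn₃ (ap₂ lessℚᵖ
      (ap₂ addℚᵖ (ap₂ addℚᵖ (ap₃ distᵖ (ap₁ fstᵖ (var 1F)) (ap₁ fstᵖ (var 2F)) (var 0F)) (ap₂ dyadicᵖ (lit 1) (var 0F)))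
                 (ap₁ sndᵖ (var 1F)))
      (ap₁ sndᵖ (var 2F)))

    apartᵖ : Computes₃ (λ _ → apart)
    apartᵖ = fn₃ (ap₂ lessℚᵖ
      (ap₂ addℚᵖ (ap₂ addℚᵖ (ap₁ sndᵖ (var 1F)) (ap₁ sndᵖ (var 2F))) (ap₂ dyadicᵖ (lit 1) (var 0F)))
      (ap₃ distᵖ (ap₁ fstᵖ (var 1F)) (ap₁ fstᵖ (var 2F)) (var 0F)))

    private
      νℚ-+-dyadic : ∀ k r → νℚ (addℚ k (dyadic 1 r)) ≡ νℚ k ℚ.+ ½^ r
      νℚ-+-dyadic k r = trans (νℚ-addℚ k (dyadic 1 r)) (cong (νℚ k ℚ.+_) (trans (νℚ-dyadic 1 r) (1/2^ r)))

      νℚ-reach : ∀ r β γ → νℚ (reach r β γ) ≡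
                      (νℚ (dist (fst β) (fst γ) r) ℚ.+ ½^ r) ℚ.+ νℚ (snd β)
      νℚ-reach r β γ = trans (νℚ-addℚ (addℚ (dist (fst β) (fst γ) r) (dyadic 1 r)) (snd β))
        (cong (ℚ._+ νℚ (snd β)) (νℚ-+-dyadic (dist (fst β) (fst γ) r) r))

      νℚ-radii : ∀ r β γ → νℚ (radii r β γ) ≡ (νℚ (snd β) ℚ.+ νℚ (snd γ)) ℚ.+ ½^ r
      νℚ-radii r β γ = trans (νℚ-+-dyadic (addℚ (snd β) (snd γ)) r) (cong (ℚ._+ ½^ r) (νℚ-addℚ (snd β) (snd γ)))

    inside-sound : ∀ {r β γ} z → inside r β γ ≡ 0 → z ∈ Ball β → z ∈ Ball γ
    inside-sound {r} {β} {γ} z h z∈β = ≤-<ᴿ-trans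
      (≤ᴿ-trans (triangle (α (fst γ)) (α (fst β)) z)
        (≤-real-+ (≤ᴿ-trans (d-flip (space Z) (α (fst γ)) (α (fst β))) (approx-upper (dist-approx (fst β) (fst γ) r))) (<ᴿ⇒≤ᴿ z∈β)))
      (real-mono-< (subst (ℚ._< νℚ (snd γ)) (νℚ-reach r β γ) (lessℚ-sound (reach r β γ) (snd γ) h)))

    -- Five errors of size 2^-n add up: one from the name, one from `dist`, one from the surplus in
    -- `reach` and two from the radius. Success at all large `n` lets finitely many tests share one
    -- `n`.
    inside-complete : ∀ {q z γ} → CauchyName (space Z) q z → z ∈ Ball γ → Eventually λ n → inside n (nameBall q n) γ ≡ 0
    inside-complete {q} {z} {γ} c z∈γ =
      let e , ≤e , room = room-below z∈γ
      in ev-map (λ n e+8≤ → lessℚ-complete (reach n (nameBall q n) γ) (snd γ) (subst (ℚ._< νℚ (snd γ)) (sym (radius n))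
           (ℚₚ.≤-<-trans (ℚₚ.+-monoˡ-≤ (2 /2^ n) (ℚₚ.+-monoˡ-≤ (½^ n) (D≤ n ≤e)))
             (ℚₚ.<-≤-trans (subst (ℚ._< e ℚ.+ 8 /2^ n) (sum n e) (ℚₚ.+-monoʳ-< e (/2^-mono-< n (ℕₚ.m≤m+n 6 2)))) e+8≤)))) room
      where
      D : ℕ → ℕ
      D n = dist (q n) (fst γ) n
      D≤ : ∀ n {e} → d (α (fst γ)) z ≤ᴿ real e → νℚ (D n) ℚ.≤ (½^ n ℚ.+ e) ℚ.+ ½^ n
      D≤ n ≤e = approx-lower (dist-approx (q n) (fst γ) n)
        (≤ᴿ-trans (triangle (α (q n)) z (α (fst γ)))
          (≤-real-+ (name-dist (space Z) c n) (≤ᴿ-trans (d-flip (space Z) z (α (fst γ))) ≤e)))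
      radius : ∀ n → νℚ (reach n (nameBall q n) γ) ≡
                     (νℚ (D n) ℚ.+ ½^ n) ℚ.+ 2 /2^ n
      radius n = trans (νℚ-reach n (nameBall q n) γ) (cong₂ (λ i ρ → (νℚ (dist i (fst γ) n) ℚ.+ ½^ n) ℚ.+ ρ)
        (trans (cong fst (around≡ (q n) n)) (fst-pair (q n) (dyadic 2 n)))
        (trans (cong (λ β → νℚ (snd β)) (around≡ (q n) n)) (trans (cong νℚ (snd-pair (q n) (dyadic 2 n))) (νℚ-dyadic 2 n))))
      sum : ∀ n e → e ℚ.+ 5 /2^ n ≡ (((½^ n ℚ.+ e) ℚ.+ ½^ n) ℚ.+ ½^ n) ℚ.+ 2 /2^ n
      sum n e = trans (cong (e ℚ.+_) (trans (sym (/2^-+ 3 2 n)) (cong (ℚ._+ 2 /2^ n)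
          (trans (sym (/2^-+ 2 1 n)) (cong₂ ℚ._+_ (trans (sym (/2^-+ 1 1 n)) (cong₂ ℚ._+_ (1/2^ n) (1/2^ n))) (1/2^ n))))))
        (solve 3 (λ e t u → e :+ (((t :+ t) :+ t) :+ u) := (((t :+ e) :+ t) :+ t) :+ u) refl e (½^ n) (2 /2^ n))
        where open Data.Rational.Solver.+-*-Solver

    -- A possible bit 1 gives only the closed ball, hence `≤` for `β`. The strictness behind the
    -- contradiction comes from the test.
    apart-sound : ∀ {r β γ} z → apart r β γ ≡ 0 → d (α (fst β)) z ≤ᴿ real (νℚ (snd β)) → ¬ (z ∈ Ball γ)
    apart-sound {r} {β} {γ} z h z≤β z∈γ = ℚₚ.<-irrefl refl
      (ℚₚ.<-≤-trans (subst (ℚ._< νℚ (dist (fst β) (fst γ) r)) (νℚ-radii r β γ) (lessℚ-sound (radii r β γ) (dist (fst β) (fst γ) r) h))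
        (approx-lower (dist-approx (fst β) (fst γ) r)
          (≤ᴿ-trans (triangle (α (fst β)) z (α (fst γ)))
            (≤-real-+ z≤β (≤ᴿ-trans (d-flip (space Z) z (α (fst γ))) (<ᴿ⇒≤ᴿ z∈γ))))))

    apart-complete : ∀ {β} z → real (νℚ (snd β)) <ᴿ d (α (fst β)) z → ∃[ γ ] ∃[ r ] apart r β γ ≡ 0 × z ∈ Ball γ
    apart-complete {β} z h =
      let e , e≤ , n , room = room-above h
          i , near = α-dense z (½^ n) (½^-pos n)
          γ = pair i (dyadic 1 n)
          D = dist (fst β) i n
          e≤D : e ℚ.≤ (νℚ D ℚ.+ ½^ n) ℚ.+ ½^ n
          e≤D = real-cancel-≤ (≤ᴿ-trans e≤ (≤ᴿ-trans (triangle (α (fst β)) (α i) z)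
                  (≤-real-+ (approx-upper (dist-approx (fst β) i n)) (<ᴿ⇒≤ᴿ near))))
          -- Passing from `e` to `D` costs two terms 2^-n, the radius of `γ` and the surplus in
          -- `radii` two more: four of the eight at hand.
          less : (νℚ (snd β) ℚ.+ ½^ n) ℚ.+ ½^ n ℚ.< νℚ D
          less = subst₂ ℚ._<_ (shift (νℚ (snd β)) (½^ n)) (cancel (νℚ D) (½^ n))
            (ℚₚ.+-monoˡ-< (ℚ.- (½^ n ℚ.+ ½^ n)) (ℚₚ.<-≤-trans
              (subst (ℚ._< νℚ (snd β) ℚ.+ 8 /2^ n) (sum n (νℚ (snd β))) (ℚₚ.+-monoʳ-< (νℚ (snd β)) (/2^-mono-< n (ℕₚ.m≤m+n 5 3))))
              (ℚₚ.≤-trans (room n ℕₚ.≤-refl) e≤D)))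
      in γ , n ,
         lessℚ-complete (radii n β γ) (dist (fst β) (fst γ) n) (subst₂ ℚ._<_ (sym (trans (νℚ-radii n β γ) (cong (λ ρ → (νℚ (snd β) ℚ.+ ρ) ℚ.+ ½^ n)
                                             (trans (cong νℚ (snd-pair i (dyadic 1 n))) (trans (νℚ-dyadic 1 n) (1/2^ n))))))
                                      (cong (λ i → νℚ (dist (fst β) i n)) (sym (fst-pair i (dyadic 1 n)))) less) ,
         ball-intro (space Z) (trans (νℚ-dyadic 1 n) (1/2^ n)) near
      where
      open Data.Rational.Solver.+-*-Solver
      shift : ∀ p t → (p ℚ.+ ((t ℚ.+ t) ℚ.+ (t ℚ.+ t))) ℚ.- (t ℚ.+ t) ≡ (p ℚ.+ t) ℚ.+ t
      shift = solve 2 (λ p t → (p :+ ((t :+ t) :+ (t :+ t))) :- (t :+ t) := (p :+ t) :+ t) refl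
      cancel : ∀ p t → ((p ℚ.+ t) ℚ.+ t) ℚ.- (t ℚ.+ t) ≡ p
      cancel = solve 2 (λ p t → ((p :+ t) :+ t) :- (t :+ t) := p) refl
      sum : ∀ n p → p ℚ.+ 4 /2^ n ≡ p ℚ.+ ((½^ n ℚ.+ ½^ n) ℚ.+ (½^ n ℚ.+ ½^ n))
      sum n p = cong (p ℚ.+_) (trans (sym (/2^-+ 2 2 n)) (cong₂ ℚ._+_ 2/ 2/))
        where
        2/ : 2 /2^ n ≡ ½^ n ℚ.+ ½^ n
        2/ = trans (sym (/2^-+ 1 1 n)) (cong₂ ℚ._+_ (1/2^ n) (1/2^ n))

-- The unit interval

module 𝕀 = SeparableMetricSpace unitInterval

distanceIᵖ : Computes₃ (λ _ k l _ → distanceI k l)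
distanceIᵖ = fn₃ (ap₂ gapℚᵖ (ap₁ clampℚᵖ (var 0F)) (ap₁ clampℚᵖ (var 1F)))

computable-unitInterval : ComputableMetricSpace
computable-unitInterval = record
  { space      = unitInterval
  ; computable = code , λ k l n → distanceI k l , correct (λ _ → 0) k l n ,
      pointwise-≤ λ _ → subst (λ q → ℚ.∣ ℚ.∣ clamp (νℚ k) ℚ.- clamp (νℚ l) ∣ ℚ.- q ∣ ℚ.≤ ½^ n) (sym (νℚ-distanceI k l))
        (∣q-q∣≤ ℚ.∣ clamp (νℚ k) ℚ.- clamp (νℚ l) ∣ n)
  }
  where
  open Computes₃ distanceIᵖ
  ∣q-q∣≤ : ∀ q n → ℚ.∣ q ℚ.- q ∣ ℚ.≤ ½^ n
  ∣q-q∣≤ q n = ≤+⇒∣-∣≤ q q (q≤q+ε q (½^-pos n)) (q≤q+ε q (½^-pos n))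

clamp-fixed : ∀ {q} → 0ℚ ℚ.≤ q → q ℚ.≤ 1ℚ → clamp q ≡ q
clamp-fixed 0≤q q≤1 = trans (cong (0ℚ ℚ.⊔_) (ℚₚ.p≥q⇒p⊓q≡q q≤1)) (ℚₚ.p≤q⇒p⊔q≡q 0≤q)

clamp-≤ : ∀ {q} → 0ℚ ℚ.≤ q → clamp q ℚ.≤ q
clamp-≤ {q} 0≤q = ℚₚ.⊔-lub 0≤q (ℚₚ.p⊓q≤q 1ℚ q)

≤-clamp : ∀ {p q} → p ℚ.≤ 1ℚ → p ℚ.≤ q → p ℚ.≤ clamp q
≤-clamp {p} {q} p≤1 p≤q = ℚₚ.≤-trans (ℚₚ.⊓-glb p≤1 p≤q) (ℚₚ.p≤q⊔p 0ℚ (1ℚ ℚ.⊓ q))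

0≤/2^ : ∀ h m → 0ℚ ℚ.≤ h /2^ m
0≤/2^ h m = subst (ℚ._≤ h /2^ m) (0/2^ m) (/2^-mono-≤ m ℕ.z≤n)

/2^≤1 : ∀ {h} m → h ℕ.≤ 2 ℕ.^ m → h /2^ m ℚ.≤ 1ℚ
/2^≤1 {h} m h≤ = subst (h /2^ m ℚ.≤_) (2^/2^ m) (/2^-mono-≤ m h≤)

/2^-+3 : ∀ h m → (8 ℕ.* h) /2^ (3 ℕ.+ m) ≡ h /2^ m
/2^-+3 h m = trans (cong (_/2^ (3 ℕ.+ m)) (solve 1 (λ h → con 8 :* h := con 2 :* (con 2 :* (con 2 :* h))) refl h))
  (trans (/2^-suc (2 ℕ.* (2 ℕ.* h)) (2 ℕ.+ m)) (trans (/2^-suc (2 ℕ.* h) (1 ℕ.+ m)) (/2^-suc h m)))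
  where open Data.Nat.Solver.+-*-Solver

2^-+3 : ∀ m → 2 ℕ.^ (3 ℕ.+ m) ≡ 8 ℕ.* 2 ℕ.^ m
2^-+3 m = solve 1 (λ e → con 2 :* (con 2 :* (con 2 :* e)) := con 8 :* e) refl (2 ℕ.^ m)
  where open Data.Nat.Solver.+-*-Solver

-- Bisection, by comparisons of rationals. The upper bound is non-strict so that q = 1 falls into
-- the last interval.
dyadic-floor : ∀ m {q} → 0ℚ ℚ.≤ q → q ℚ.≤ 1ℚ → ∃[ h ] h /2^ m ℚ.≤ q × q ℚ.≤ suc h /2^ m × suc h ℕ.≤ 2 ℕ.^ m
dyadic-floor zero {q} 0≤q q≤1 = 0 , subst (ℚ._≤ q) (sym (0/2^ 0)) 0≤q , subst (q ℚ.≤_) (sym (2^/2^ 0)) q≤1 , ℕₚ.≤-refl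
dyadic-floor (suc m) {q} 0≤q q≤1 =
  let h , lower , upper , h<2^m = dyadic-floor m 0≤q q≤1
  in refine h lower upper h<2^m (ℚₚ.≤-total q ((1 ℕ.+ 2 ℕ.* h) /2^ suc m))
  where
  refine : ∀ h → h /2^ m ℚ.≤ q → q ℚ.≤ suc h /2^ m → suc h ℕ.≤ 2 ℕ.^ m →
           q ℚ.≤ (1 ℕ.+ 2 ℕ.* h) /2^ suc m ⊎ (1 ℕ.+ 2 ℕ.* h) /2^ suc m ℚ.≤ q →
           ∃[ h ] h /2^ suc m ℚ.≤ q × q ℚ.≤ suc h /2^ suc m × suc h ℕ.≤ 2 ℕ.^ suc m
  refine h lower upper h<2^m (inj₁ q≤) = 2 ℕ.* h , subst (ℚ._≤ q) (sym (/2^-suc h m)) lower , q≤ ,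
    ℕₚ.≤-trans (ℕₚ.m≤n+m (1 ℕ.+ 2 ℕ.* h) 1)
      (subst (ℕ._≤ 2 ℕ.* 2 ℕ.^ m) (ℕₚ.*-distribˡ-+ 2 1 h) (ℕₚ.*-monoʳ-≤ 2 h<2^m))
  refine h lower upper h<2^m (inj₂ ≤q) = 1 ℕ.+ 2 ℕ.* h , ≤q ,
    subst (q ℚ.≤_) (trans (sym (/2^-suc (suc h) m)) (cong (_/2^ suc m) (ℕₚ.*-distribˡ-+ 2 1 h))) upper ,
    subst (ℕ._≤ 2 ℕ.* 2 ℕ.^ m) (ℕₚ.*-distribˡ-+ 2 1 h) (ℕₚ.*-monoʳ-≤ 2 h<2^m)

-- Reading bits off a point of the unit interval

-- In units of 8^-(j+1), this is the ball of radius 3 around 4h. For fixed j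
-- these balls cover [0,1], and t may have j-th bit b if it lies in one of
-- them with h of parity b, so that every t has at least one j-th bit.
abstract

  bitBall : ℕ → ℕ → ℕ
  bitBall j h = pair (dyadic (4 ℕ.* h) (suc j ℕ.* 3)) (dyadic 3 (suc j ℕ.* 3))

  bitBallᵖ : Computes₂ (λ _ → bitBall)
  bitBallᵖ = fn₂ (ap₂ pairᵖ (ap₂ dyadicᵖ (lit 4 ⊗ᵗ var 1F) (ap₁ sucᵖ (var 0F) ⊗ᵗ lit 3))
                            (ap₂ dyadicᵖ (lit 3) (ap₁ sucᵖ (var 0F) ⊗ᵗ lit 3)))

  bitBall≡ : ∀ j h → bitBall j h ≡ pair (dyadic (4 ℕ.* h) (suc j ℕ.* 3)) (dyadic 3 (suc j ℕ.* 3))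
  bitBall≡ j h = refl

HasBit : ℕ → ℕ → 𝕀.Carrier → Set
HasBit b j t = ∃[ h ] parity h ≡ b × t ∈ 𝕀.Ball (bitBall j h)

bitBalls-cover : ∀ j t → ∃[ h ] t ∈ 𝕀.Ball (bitBall j h)
bitBalls-cover j t = finish (𝕀.α-dense t (1 /2^ suc M) (subst (0ℚ ℚ.<_) (sym (1/2^ (suc M))) (½^-pos (suc M))))
  where
  M = suc j ℕ.* 3
  quarter : ∀ h → (4 ℕ.* h) /2^ M ≡ h /2^ suc (j ℕ.* 3)
  quarter h = trans (cong (_/2^ M) (ℕₚ.*-assoc 2 2 h)) (trans (/2^-suc (2 ℕ.* h) (2 ℕ.+ j ℕ.* 3)) (/2^-suc h (1 ℕ.+ j ℕ.* 3)))
  -- Rounding to a multiple of 4 units costs at most 2 units, and replacing t by a point of the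
  -- dense sequence half a unit.
  small : 2 /2^ M ℚ.+ 1 /2^ suc M ℚ.< 3 /2^ M
  small = subst (2 /2^ M ℚ.+ 1 /2^ suc M ℚ.<_) (trans (cong (2 /2^ M ℚ.+_) (/2^-suc 1 M)) (/2^-+ 2 1 M))
    (ℚₚ.+-monoʳ-< (2 /2^ M) (/2^-mono-< (suc M) (ℕ.s≤s (ℕ.s≤s ℕ.z≤n))))
  4+ : ∀ h → 4 ℕ.* suc h ≡ 2 ℕ.+ 4 ℕ.* h ℕ.+ 2
  4+ = solve 1 (λ h → con 4 :* (con 1 :+ h) := con 2 :+ con 4 :* h :+ con 2) refl
    where open Data.Nat.Solver.+-*-Solver
  close-to : ∀ {q} a b → a /2^ M ℚ.≤ q → q ℚ.≤ b /2^ M → ∀ c → c ℕ.≤ a ℕ.+ 2 → b ℕ.≤ c ℕ.+ 2 → ℚ.∣ c /2^ M ℚ.- q ∣ ℚ.≤ 2 /2^ M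
  close-to {q} a b a≤q q≤b c c≤ b≤ = ≤+⇒∣-∣≤ (c /2^ M) q
    (ℚₚ.≤-trans (/2^-mono-≤ M c≤) (subst (ℚ._≤ q ℚ.+ 2 /2^ M) (/2^-+ a 2 M) (ℚₚ.+-monoˡ-≤ (2 /2^ M) a≤q)))
    (ℚₚ.≤-trans q≤b (subst (b /2^ M ℚ.≤_) (sym (/2^-+ c 2 M)) (/2^-mono-≤ M b≤)))
  ≤1 : ∀ {h} → h ℕ.≤ 2 ℕ.^ suc (j ℕ.* 3) → (4 ℕ.* h) /2^ M ℚ.≤ 1ℚ
  ≤1 {h} h≤ = subst (ℚ._≤ 1ℚ) (sym (quarter h)) (/2^≤1 (suc (j ℕ.* 3)) h≤)
  Centre : ℚ → Set
  Centre q = ∃[ h ] (4 ℕ.* h) /2^ M ℚ.≤ 1ℚ × ℚ.∣ (4 ℕ.* h) /2^ M ℚ.- q ∣ ℚ.≤ 2 /2^ M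
  round : ∀ {q} h → h /2^ suc (j ℕ.* 3) ℚ.≤ q → q ℚ.≤ suc h /2^ suc (j ℕ.* 3) → suc h ℕ.≤ 2 ℕ.^ suc (j ℕ.* 3) →
          q ℚ.≤ (2 ℕ.+ 4 ℕ.* h) /2^ M ⊎ (2 ℕ.+ 4 ℕ.* h) /2^ M ℚ.≤ q → Centre q
  round {q} h lower upper h<2^m (inj₁ q≤) = h , ≤1 (ℕₚ.<⇒≤ h<2^m) ,
    close-to (4 ℕ.* h) (2 ℕ.+ 4 ℕ.* h) (subst (ℚ._≤ q) (sym (quarter h)) lower) q≤
      (4 ℕ.* h) (ℕₚ.m≤m+n (4 ℕ.* h) 2) (ℕₚ.≤-reflexive (ℕₚ.+-comm 2 (4 ℕ.* h)))
  round {q} h lower upper h<2^m (inj₂ ≤q) = suc h , ≤1 h<2^m ,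
    close-to (2 ℕ.+ 4 ℕ.* h) (4 ℕ.* suc h) ≤q (subst (q ℚ.≤_) (sym (quarter (suc h))) upper)
      (4 ℕ.* suc h) (ℕₚ.≤-reflexive (4+ h)) (ℕₚ.m≤m+n (4 ℕ.* suc h) 2)
  centre : ∀ {q} → 0ℚ ℚ.≤ q → q ℚ.≤ 1ℚ → Centre q
  centre {q} 0≤q q≤1 =
    let h , lower , upper , h<2^m = dyadic-floor (suc (j ℕ.* 3)) 0≤q q≤1
    in round h lower upper h<2^m (ℚₚ.≤-total q ((2 ℕ.+ 4 ℕ.* h) /2^ M))
  inBall : ∀ k → 𝕀.d (𝕀.α k) t <ᴿ real (1 /2^ suc M) → Centre (clamp (νℚ k)) → ∃[ h ] t ∈ 𝕀.Ball (bitBall j h)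
  inBall k near (h , centre≤1 , close) = h , subst (λ β → t ∈ 𝕀.Ball β) (sym (bitBall≡ j h)) (ball-intro unitInterval {dyadic (4 ℕ.* h) M} {dyadic 3 M} {t} (νℚ-dyadic 3 M)
    (≤-<ᴿ-trans (𝕀.triangle (𝕀.α (dyadic (4 ℕ.* h) M)) (𝕀.α k) t)
    (≤-<ᴿ-trans (≤-real-+ (pointwise-≤ λ _ → subst (λ c → ℚ.∣ c ℚ.- clamp (νℚ k) ∣ ℚ.≤ 2 /2^ M) (sym ν≡) close) (<ᴿ⇒≤ᴿ near))
                (real-mono-< small))))
    where
    ν≡ : clamp (νℚ (dyadic (4 ℕ.* h) M)) ≡ (4 ℕ.* h) /2^ M
    ν≡ = trans (cong clamp (νℚ-dyadic (4 ℕ.* h) M)) (clamp-fixed (0≤/2^ (4 ℕ.* h) M) centre≤1)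
  finish : ∃[ k ] 𝕀.d (𝕀.α k) t <ᴿ real (1 /2^ suc M) → ∃[ h ] t ∈ 𝕀.Ball (bitBall j h)
  finish (k , near) = inBall k near (centre (0≤clamp (νℚ k)) (clamp≤1 (νℚ k)))

parity≤1 : ∀ n → parity n ℕ.≤ 1
parity≤1 zero    = ℕ.z≤n
parity≤1 (suc n) = ℕₚ.m∸n≤m 1 (parity n)

parity-2*+ : ∀ k n → parity (2 ℕ.* k ℕ.+ n) ≡ parity n
parity-2*+ zero    n = refl
parity-2*+ (suc k) n = trans (cong (λ m → parity (m ℕ.+ n)) (ℕₚ.*-distribˡ-+ 2 1 k))
  (trans (ℕₚ.m∸[m∸n]≡n (parity≤1 (2 ℕ.* k ℕ.+ n))) (parity-2*+ k n))

parity-bit : ∀ {b} → b ℕ.≤ 1 → parity b ≡ b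
parity-bit ℕ.z≤n         = refl
parity-bit (ℕ.s≤s ℕ.z≤n) = refl

-- The point Σ b(j) / (2 · 8^j) has the j-th bit b(j) only.
module BitPoint (b : ℕ → ℕ) (b≤1 : ∀ j → b j ℕ.≤ 1) where

  prefix : ℕ → ℕ
  prefix zero    = 0
  prefix (suc n) = 8 ℕ.* prefix n ℕ.+ b n

  -- The partial sum of the first n digits, and a bound for the whole sum: the tail is at most 4/7
  -- of 8^-n.
  lower upper : ℕ → ℚ
  lower n = (4 ℕ.* prefix n) /2^ (n ℕ.* 3)
  upper n = (1 ℕ.+ 4 ℕ.* prefix n) /2^ (n ℕ.* 3)

  parity-prefix : ∀ j → parity (prefix (suc j)) ≡ b j
  parity-prefix j = trans (cong (λ m → parity (m ℕ.+ b j)) (ℕₚ.*-assoc 2 4 (prefix j)))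
    (trans (parity-2*+ (4 ℕ.* prefix j) (b j)) (parity-bit (b≤1 j)))

  private
    4*suc-prefix : ∀ n → 4 ℕ.* prefix (suc n) ≡ 8 ℕ.* (4 ℕ.* prefix n) ℕ.+ 4 ℕ.* b n
    4*suc-prefix n = solve 2 (λ g b → con 4 :* (con 8 :* g :+ b) := con 8 :* (con 4 :* g) :+ con 4 :* b) refl (prefix n) (b n)
      where open Data.Nat.Solver.+-*-Solver

  lower-suc : ∀ n → lower n ℚ.≤ lower (suc n)
  lower-suc n = subst (ℚ._≤ lower (suc n)) (/2^-+3 (4 ℕ.* prefix n) (n ℕ.* 3)) (/2^-mono-≤ (suc n ℕ.* 3)
    (subst (8 ℕ.* (4 ℕ.* prefix n) ℕ.≤_) (sym (4*suc-prefix n)) (ℕₚ.m≤m+n _ (4 ℕ.* b n))))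

  upper-suc : ∀ n → upper (suc n) ℚ.≤ upper n
  upper-suc n = subst (upper (suc n) ℚ.≤_) (/2^-+3 (1 ℕ.+ 4 ℕ.* prefix n) (n ℕ.* 3)) (/2^-mono-≤ (suc n ℕ.* 3)
    (subst₂ ℕ._≤_ (cong suc (sym (4*suc-prefix n))) (sym (ℕₚ.*-distribˡ-+ 8 1 (4 ℕ.* prefix n)))
      (ℕₚ.≤-trans (ℕₚ.≤-reflexive (cong suc (ℕₚ.+-comm (8 ℕ.* (4 ℕ.* prefix n)) (4 ℕ.* b n))))
        -- The next digit contributes at most 4, so 1 + 4 = 5 fits into the 8 finer units that make
        -- up one unit.
        (ℕₚ.+-monoˡ-≤ (8 ℕ.* (4 ℕ.* prefix n)) (ℕₚ.≤-trans (ℕ.s≤s (ℕₚ.*-monoʳ-≤ 4 (b≤1 n))) (ℕₚ.m≤m+n 5 3))))))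

  lower≤upper : ∀ n → lower n ℚ.≤ upper n
  lower≤upper n = /2^-mono-≤ (n ℕ.* 3) (ℕₚ.n≤1+n (4 ℕ.* prefix n))

  lower-mono : ∀ {m n} → m ℕ.≤ n → lower m ℚ.≤ lower n
  lower-mono {m} {n} m≤n = subst (λ n → lower m ℚ.≤ lower n) (ℕₚ.m∸n+n≡m m≤n) (go (n ℕ.∸ m))
    where
    go : ∀ k → lower m ℚ.≤ lower (k ℕ.+ m)
    go zero    = ℚₚ.≤-refl
    go (suc k) = ℚₚ.≤-trans (go k) (lower-suc (k ℕ.+ m))

  upper-anti : ∀ {m n} → m ℕ.≤ n → upper n ℚ.≤ upper m
  upper-anti {m} {n} m≤n = subst (λ n → upper n ℚ.≤ upper m) (ℕₚ.m∸n+n≡m m≤n) (go (n ℕ.∸ m))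
    where
    go : ∀ k → upper (k ℕ.+ m) ℚ.≤ upper m
    go zero    = ℚₚ.≤-refl
    go (suc k) = ℚₚ.≤-trans (upper-suc (k ℕ.+ m)) (go k)

  lower≤upper′ : ∀ {m n} → m ℕ.≤ n → lower n ℚ.≤ upper m
  lower≤upper′ {m} {n} m≤n = ℚₚ.≤-trans (lower≤upper n) (upper-anti m≤n)

  pointᴿ : ℝ
  pointᴿ .seq = lower
  pointᴿ .cauchy ε 0<ε =
    let N , ½^N≤ε = archimedean 0<ε
        within : ∀ m n → N ℕ.≤ m → N ℕ.≤ n → lower m ℚ.≤ lower n ℚ.+ ε
        within m n N≤m N≤n = begin
          lower m                            ≤⟨ lower≤upper′ N≤m ⟩
          upper N                            ≡⟨ /2^-+ 1 (4 ℕ.* prefix N) (N ℕ.* 3) ⟨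
          1 /2^ (N ℕ.* 3) ℚ.+ lower N        ≡⟨ cong (ℚ._+ lower N) (1/2^ (N ℕ.* 3)) ⟩
          ½^ (N ℕ.* 3) ℚ.+ lower N           ≤⟨ ℚₚ.+-mono-≤ (ℚₚ.≤-trans (½^-anti (ℕₚ.m≤m*n N 3)) ½^N≤ε) (lower-mono N≤n) ⟩
          ε ℚ.+ lower n                      ≡⟨ ℚₚ.+-comm ε (lower n) ⟩
          lower n ℚ.+ ε                      ∎
    in N , λ m n N≤m N≤n → ≤+⇒∣-∣≤ (lower m) (lower n) (within m n N≤m N≤n) (within n m N≤n N≤m)
    where open ℚₚ.≤-Reasoning

  point : 𝕀.Carrier
  point = pointᴿ , pointwise-≤ (λ n → 0≤/2^ (4 ℕ.* prefix n) (n ℕ.* 3)) ,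
    pointwise-≤ (λ n → subst (lower n ℚ.≤_) (2^/2^ 0) (lower≤upper′ {0} {n} ℕ.z≤n))

  -- Centres beyond 1 are truncated to 1. This keeps even the truncated ones at least 4 units above
  -- `lower (suc j)`.
  4+4*prefix≤ : ∀ j → 4 ℕ.+ 4 ℕ.* prefix (suc j) ℕ.≤ 2 ℕ.^ (suc j ℕ.* 3)
  4+4*prefix≤ zero    = ℕₚ.+-monoʳ-≤ 4 (ℕₚ.*-monoʳ-≤ 4 (b≤1 0))
  4+4*prefix≤ (suc j) = subst₂ ℕ._≤_ (cong (4 ℕ.+_) (sym (4*suc-prefix (suc j)))) (sym (2^-+3 (suc j ℕ.* 3)))
    (ℕₚ.≤-trans
      (ℕₚ.≤-trans (ℕₚ.+-monoʳ-≤ 4 (ℕₚ.+-monoʳ-≤ (8 ℕ.* (4 ℕ.* g)) (ℕₚ.*-monoʳ-≤ 4 (b≤1 (suc j)))))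
        (ℕₚ.≤-trans (ℕₚ.m≤m+n (4 ℕ.+ (8 ℕ.* (4 ℕ.* g) ℕ.+ 4)) 24) (ℕₚ.≤-reflexive
          (solve 1 (λ g → con 4 :+ (con 8 :* (con 4 :* g) :+ con 4) :+ con 24 := con 8 :* (con 4 :+ con 4 :* g)) refl g))))
      (ℕₚ.*-monoʳ-≤ 8 (4+4*prefix≤ j)))
    where
    open Data.Nat.Solver.+-*-Solver
    g = prefix (suc j)

  -- In units of 8^-(j+1) the point lies in [4g, 4g+1]. Balls with h < g end at 4h+3 < 4g, and those
  -- with h > g begin at 4h-3 ≥ 4g+1, so h = g remains, whose last digit is the bit.
  point∈bitBall : ∀ j h → point ∈ 𝕀.Ball (bitBall j h) → parity h ≡ b j
  point∈bitBall j h t∈ = trans (cong parity (h≡ (ℕₚ.<-cmp h g))) (parity-prefix j)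
    where
    M = suc j ℕ.* 3
    g = prefix (suc j)
    c = (4 ℕ.* h) /2^ M
    Near : Set
    Near = ∃[ n ] suc j ℕ.≤ n × ℚ.∣ clamp c ℚ.- lower n ∣ ℚ.< 3 /2^ M
    near : 𝕀.d (𝕀.α (dyadic (4 ℕ.* h) M)) point <ᴿ real (3 /2^ M) → Near
    near (mk< δ 0<δ (N , close)) = n , ℕₚ.m≤m⊔n (suc j) N ,
      subst (λ c → ℚ.∣ clamp c ℚ.- lower n ∣ ℚ.< 3 /2^ M) (νℚ-dyadic (4 ℕ.* h) M)
        (ℚₚ.<-≤-trans (subst (ℚ._< x ℚ.+ δ) (ℚₚ.+-identityʳ x) (ℚₚ.+-monoʳ-< x 0<δ)) (close n (ℕₚ.m≤n⊔m (suc j) N)))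
      where
      n = suc j ℕ.⊔ N
      x = ℚ.∣ clamp (νℚ (dyadic (4 ℕ.* h) M)) ℚ.- lower n ∣
    too-small : h ℕ.< g → ¬ Near
    too-small h<g (n , 1+j≤n , close) = ℚₚ.<-irrefl refl (begin-strict
      lower n               ≤⟨ ∣-∣≤⇒≤+′ (clamp c) (lower n) (ℚₚ.<⇒≤ close) ⟩
      clamp c ℚ.+ 3 /2^ M   ≤⟨ ℚₚ.+-monoˡ-≤ (3 /2^ M) (clamp-≤ (0≤/2^ (4 ℕ.* h) M)) ⟩
      c ℚ.+ 3 /2^ M         ≡⟨ /2^-+ (4 ℕ.* h) 3 M ⟩
      (4 ℕ.* h ℕ.+ 3) /2^ M <⟨ /2^-mono-< M (ℕₚ.≤-trans
                                 (ℕₚ.≤-reflexive (sym (trans (ℕₚ.*-distribˡ-+ 4 1 h) (cong suc (ℕₚ.+-comm 3 (4 ℕ.* h))))))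
                                 (ℕₚ.*-monoʳ-≤ 4 h<g)) ⟩
      (4 ℕ.* g) /2^ M       ≤⟨ lower-mono 1+j≤n ⟩
      lower n               ∎)
      where open ℚₚ.≤-Reasoning
    too-large : g ℕ.< h → ¬ Near
    too-large g<h (n , 1+j≤n , close) = ℚₚ.<-irrefl refl (begin-strict
      (4 ℕ.+ 4 ℕ.* g) /2^ M             ≤⟨ ≤-clamp (/2^≤1 M (4+4*prefix≤ j)) (/2^-mono-≤ M
                                             (subst (ℕ._≤ 4 ℕ.* h) (ℕₚ.*-distribˡ-+ 4 1 g) (ℕₚ.*-monoʳ-≤ 4 g<h))) ⟩
      clamp c                           ≡⟨ solve 2 (λ c l → c := (c :- l) :+ l) refl (clamp c) (lower n) ⟩
      (clamp c ℚ.- lower n) ℚ.+ lower n <⟨ ℚₚ.+-monoˡ-< (lower n) (ℚₚ.≤-<-trans (p≤∣p∣ (clamp c ℚ.- lower n)) close) ⟩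
      3 /2^ M ℚ.+ lower n               ≤⟨ ℚₚ.+-monoʳ-≤ (3 /2^ M) (lower≤upper′ 1+j≤n) ⟩
      3 /2^ M ℚ.+ upper (suc j)         ≡⟨ /2^-+ 3 (1 ℕ.+ 4 ℕ.* g) M ⟩
      (4 ℕ.+ 4 ℕ.* g) /2^ M             ∎)
      where
      open ℚₚ.≤-Reasoning
      open Data.Rational.Solver.+-*-Solver
    is-near : Near
    is-near = near (ball-elim unitInterval {dyadic (4 ℕ.* h) M} {dyadic 3 M} {point} (νℚ-dyadic 3 M)
      (subst (λ β → point ∈ 𝕀.Ball β) (bitBall≡ j h) t∈))
    h≡ : Tri (h ℕ.< g) (h ≡ g) (g ℕ.< h) → h ≡ g
    h≡ (tri< h<g _ _) = ⊥-elim (too-small h<g is-near)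
    h≡ (tri≈ _ h≡g _) = h≡g
    h≡ (tri> _ _ g<h) = ⊥-elim (too-large g<h is-near)

-- The programs of the reduction

dropᵖ : Computes₂ (λ _ → drop)
dropᵖ = fn₂ (rec (var 0F) (ap₁ sndᵖ (ap₁ predᵖ (var 1F))) (var 1F))

differ : ℕ → ℕ → ℕ
differ m n = (m ℕ.∸ n) ℕ.+ (n ℕ.∸ m)

differᵖ : Computes₂ (λ _ → differ)
differᵖ = fn₂ ((var 0F ⊖ var 1F) ⊕ (var 1F ⊖ var 0F))

differ-sound : ∀ m n → differ m n ≡ 0 → m ≡ n
differ-sound m n h = ℕₚ.≤-antisym (ℕₚ.m∸n≡0⇒m≤n (ℕₚ.m+n≡0⇒m≡0 (m ℕ.∸ n) h)) (ℕₚ.m∸n≡0⇒m≤n (ℕₚ.m+n≡0⇒n≡0 (m ℕ.∸ n) h))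

differ-refl : ∀ n → differ n n ≡ 0
differ-refl n = cong₂ ℕ._+_ (ℕₚ.n∸n≡0 n) (ℕₚ.n∸n≡0 n)

module FI = FormalBalls computable-unitInterval

module Reduction
  (X Y : ComputableMetricSpace)
  {cov : 𝔹} (covᵖ : Computes₁ (λ _ → cov))
  {a : 𝔹} (aᵖ : Computes₁ (λ _ → a))
  where

  module FX = FormalBalls X
  module FY = FormalBalls Y

  -- Each of the following three tests witnesses that a point of the ball l of Y
  -- is not related to the points of the ball β of the unit interval: points of
  -- β may have l-th bit 0; they may have j-th bit 1, where the balls j and l
  -- are formally disjoint; {x} × l is contained in the complement of A.

  bitZero : ℕ → ℕ → ℕ → ℕ
  bitZero β l w = parity (fst w) ℕ.+ FI.inside (snd w) β (bitBall l (fst w))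

  bitOneApart : ℕ → ℕ → ℕ → ℕ
  bitOneApart β l w =
    let h = fst (fst w) ; j = snd (fst w) ; r = fst (snd w) ; s = snd (snd w)
    in (1 ℕ.∸ parity h) ℕ.+ (FI.inside r β (bitBall j h) ℕ.+ FY.apart s j l)

  outside : 𝔹 → ℕ → ℕ → ℕ
  outside p l w =
    let n = a (fst w) ; u = fst (fst n) ; v = snd (fst n) ; k = snd n ; r = snd w
    in differ l (pair v k) ℕ.+ FX.inside r (nameBall p r) (pair u k)

  -- One number `w` is decoded in three ways, so that a single search bound serves the whole
  -- disjunction.
  unrelated : 𝔹 → ℕ → ℕ → ℕ → ℕ
  unrelated p β l w = bitZero β l w ℕ.* (bitOneApart β l w ℕ.* outside p l w)

  allUnrelated : 𝔹 → ℕ → ℕ → ℕ → ℕ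
  allUnrelated p β s = allItems (λ l → anyBelow (unrelated p β l) s)

  -- The inner `natrec` is a conditional: `β` if the test passes, otherwise 0, the index of an empty
  -- ball. The outer one skips the value 0 of `cov`, which lists no cover.
  emit : 𝔹 → ℕ → ℕ → ℕ → ℕ
  emit p β s = natrec 0 (λ e _ → natrec β (λ _ _ → 0) (allUnrelated p β s e))

  -- Dovetailing over a candidate ball, the position of a finite cover, and a bound for the
  -- witnesses.
  removedBall : 𝔹 → 𝔹
  removedBall p n = emit p (fst n) (snd (snd n)) (cov (fst (snd n)))

  bitZeroᵖ : Computes₃ (λ _ → bitZero)
  bitZeroᵖ = fn₃ (ap₁ parityᵖ h ⊕ ap₃ FI.insideᵖ (ap₁ sndᵖ (var 2F)) (var 0F) (ap₂ bitBallᵖ (var 1F) h))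
    where
    h : Computes {3} _
    h = ap₁ fstᵖ (var 2F)

  bitOneApartᵖ : Computes₃ (λ _ → bitOneApart)
  bitOneApartᵖ = fn₃ ((lit 1 ⊖ ap₁ parityᵖ h) ⊕
    (ap₃ FI.insideᵖ (ap₁ fstᵖ (ap₁ sndᵖ (var 2F))) (var 0F) (ap₂ bitBallᵖ j h) ⊕
     ap₃ FY.apartᵖ (ap₁ sndᵖ (ap₁ sndᵖ (var 2F))) j (var 1F)))
    where
    h j : Computes {3} _
    h = ap₁ fstᵖ (ap₁ fstᵖ (var 2F))
    j = ap₁ sndᵖ (ap₁ fstᵖ (var 2F))

  outsideᵖ : Computes₂ outside
  outsideᵖ = fn₂ (ap₂ differᵖ (var 0F) (ap₂ pairᵖ (ap₁ sndᵖ (ap₁ fstᵖ n)) (ap₁ sndᵖ n)) ⊕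
    ap₃ FX.insideᵖ r (ap₂ aroundᵖ (ap₁ oracleᵖ r) r) (ap₂ pairᵖ (ap₁ fstᵖ (ap₁ fstᵖ n)) (ap₁ sndᵖ n)))
    where
    n r : Computes {2} _
    n = ap₁ aᵖ (ap₁ fstᵖ (var 1F))
    r = ap₁ sndᵖ (var 1F)

  unrelatedᵖ : Computes₃ unrelated
  unrelatedᵖ = fn₃ (ap₃ bitZeroᵖ (var 0F) (var 1F) (var 2F) ⊗ᵗ
    (ap₃ bitOneApartᵖ (var 0F) (var 1F) (var 2F) ⊗ᵗ ap₂ outsideᵖ (var 1F) (var 2F)))

  anyUnrelatedᵖ : Computes₃ (λ p β l → anyBelow (unrelated p β l))
  anyUnrelatedᵖ = fn₃ (rec (lit 1) (ap₃ unrelatedᵖ (var 2F) (var 3F) (var 0F) ⊗ᵗ var 1F) (var 2F))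

  allUnrelatedᵖ : Computes₃ allUnrelated
  allUnrelatedᵖ = fn₃ (rec zeroᵗ
    ((lit 1 ⊖ (lit 1 ⊖ rest)) ⊗ᵗ ap₃ anyUnrelatedᵖ (var 2F) (ap₁ fstᵖ (ap₁ predᵖ rest)) (var 3F) ⊕ var 1F) (var 2F))
    where
    rest : Computes {5} _
    rest = ap₂ dropᵖ (var 4F) (var 0F)

  removedBallᵖ : Computes₁ removedBall
  removedBallᵖ = fn₁ (rec zeroᵗ
    (rec (ap₁ fstᵖ (var 2F)) zeroᵗ
      (ap₃ allUnrelatedᵖ (ap₁ fstᵖ (var 2F)) (ap₁ sndᵖ (ap₁ sndᵖ (var 2F))) (var 0F)))
    (ap₁ covᵖ (ap₁ fstᵖ (ap₁ sndᵖ (var 0F)))))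

  -- w codes a ball j of Y of radius less than 2^-(n+1) together with evidence
  -- that the point with name q may have j-th bit 1.
  locates : 𝔹 → ℕ → ℕ → ℕ
  locates q w n =
    let j = fst w ; h = fst (snd w) ; r = snd (snd w)
    in (1 ℕ.∸ parity h) ℕ.+ (FI.inside r (nameBall q r) (bitBall j h) ℕ.+ lessℚ (snd j) (dyadic 1 (suc n)))

  right : 𝔹 → 𝔹
  right p r = p (suc (r ℕ.* 2))

  locatesᵖ : Computes {2} (λ p xs → locates (right p) (lookup xs 0F) (lookup xs 1F))
  locatesᵖ = (lit 1 ⊖ ap₁ parityᵖ h) ⊕
    (ap₃ FI.insideᵖ r (ap₂ aroundᵖ (ap₁ oracleᵖ (ap₁ sucᵖ (r ⊗ᵗ lit 2))) r) (ap₂ bitBallᵖ j h) ⊕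
     ap₂ lessℚᵖ (ap₁ sndᵖ j) (ap₂ dyadicᵖ (lit 1) (ap₁ sucᵖ (var 1F))))
    where
    h j r : Computes {2} _
    h = ap₁ fstᵖ (ap₁ sndᵖ (var 0F))
    j = ap₁ fstᵖ (var 0F)
    r = ap₁ sndᵖ (ap₁ sndᵖ (var 0F))

  centreᵖ : Computes₁ (λ _ w → fst (fst w))
  centreᵖ = fn₁ (ap₁ fstᵖ (ap₁ fstᵖ (var 0F)))

  encode : 𝔹-setoid ⇀ 𝔹-setoid
  encode = functional (Computes₁.code removedBallᵖ)

  decode : 𝔹-setoid ⇀ 𝔹-setoid
  decode = functional (compᶜ (Computes₁.code centreᵖ) (minᶜ (Computes.code locatesᵖ) ∷ []))

  -- Correctness of the reduction

  module Correct
    (em : ExcludedMiddle 0ℓ)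
    (compact : Compact (space Y))
    (cov-covers : ∀ L → Covers (space Y) L ⇔ (∃[ n ] cov n ≡ suc (encodeList L)))
    (A : ClosedSubset (space X ⊗ space Y))
    (a-name : ClosedName (space X ⊗ space Y) a A)
    where

    private
      module X = ComputableMetricSpace X
      module Y = ComputableMetricSpace Y

    Admits : 𝕀.Carrier → Y.Carrier → ℕ → Set
    Admits t y j = (HasBit 1 j t → Y.d (Y.α (fst j)) y ≤ᴿ real (νℚ (snd j))) × (HasBit 0 j t → ¬ (y ∈ Y.Ball j))

    Codes : X.Carrier → 𝕀.Carrier → Y.Carrier → Set
    Codes x t y = (x , y) ∈ member A × (∀ j → Admits t y j)

    Survives : 𝔹 → 𝕀.Carrier → Set
    Survives p t = ¬ (∃[ n ] t ∈ 𝕀.Ball (removedBall p n))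

    ∸-parity : ∀ h → 1 ℕ.∸ parity h ≡ 0 → parity h ≡ 1
    ∸-parity h e = ℕₚ.≤-antisym (parity≤1 h) (ℕₚ.m∸n≡0⇒m≤n e)

    -- For the maximum metric, a ball of the product is a product of balls of equal radius.
    ball-⊗ : ∀ n {x y} → (x , y) ∈ SeparableMetricSpace.Ball (space X ⊗ space Y) n ⇔
             (x ∈ X.Ball (pair (fst (fst n)) (snd n)) × y ∈ Y.Ball (pair (snd (fst n)) (snd n)))
    ball-⊗ n = mk⇔
      (λ h → ball-intro (space X) refl (≤-<ᴿ-trans (x≤x⊔ᴿy _ _) h) ,
             ball-intro (space Y) refl (≤-<ᴿ-trans (y≤x⊔ᴿy _ _) h))
      (λ (h , k) → ⊔ᴿ-lub-< (ball-elim (space X) refl h) (ball-elim (space Y) refl k))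

    emit-elim : ∀ p t β s c → t ∈ 𝕀.Ball (emit p β s c) →
                ∃[ e ] c ≡ suc e × allUnrelated p β s e ≡ 0 × t ∈ 𝕀.Ball β
    emit-elim p t β s zero    t∈ = ⊥-elim (ball-0-empty unitInterval t t∈)
    emit-elim p t β s (suc e) t∈ = let v≡0 , t∈β = choose (allUnrelated p β s e) t∈ in e , refl , v≡0 , t∈β
      where
      choose : ∀ v → t ∈ 𝕀.Ball (natrec β (λ _ _ → 0) v) → v ≡ 0 × t ∈ 𝕀.Ball β
      choose zero    t∈ = refl , t∈
      choose (suc v) t∈ = ⊥-elim (ball-0-empty unitInterval t t∈)

    unrelated-sound : ∀ {p x t y} → CauchyName (space X) p x → Codes x t y →
                      ∀ {β l} w → t ∈ 𝕀.Ball β → y ∈ Y.Ball l → unrelated p β l w ≢ 0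
    unrelated-sound {p} {x} {t} {y} p-name (xy∈A , admits) {β} {l} w t∈β y∈l w≡0 =
      cases (ℕₚ.m*n≡0⇒m≡0∨n≡0 (bitZero β l w) w≡0)
      where
      zeroCase : bitZero β l w ≡ 0 → ⊥
      zeroCase h = proj₂ (admits l)
        (fst w , ℕₚ.m+n≡0⇒m≡0 (parity (fst w)) h , FI.inside-sound t (ℕₚ.m+n≡0⇒n≡0 (parity (fst w)) h) t∈β) y∈l
      oneCase : bitOneApart β l w ≡ 0 → ⊥
      oneCase e = FY.apart-sound y (ℕₚ.m+n≡0⇒n≡0 (FI.inside r β (bitBall j h)) e₂)
        (proj₁ (admits j) (h , ∸-parity h (ℕₚ.m+n≡0⇒m≡0 (1 ℕ.∸ parity h) e) , FI.inside-sound t (ℕₚ.m+n≡0⇒m≡0 _ e₂) t∈β)) y∈l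
        where
        j = snd (fst w)
        h = fst (fst w)
        r = fst (snd w)
        e₂ = ℕₚ.m+n≡0⇒n≡0 (1 ℕ.∸ parity h) e
      outsideCase : outside p l w ≡ 0 → ⊥
      outsideCase e = Equivalence.from (a-name (x , y)) (fst w , Equivalence.from (ball-⊗ n)
        ( FX.inside-sound x (ℕₚ.m+n≡0⇒n≡0 (differ l vk) e) (name∈nameBall (space X) p-name (snd w))
        , subst (λ l → y ∈ Y.Ball l) (differ-sound l vk (ℕₚ.m+n≡0⇒m≡0 (differ l vk) e)) y∈l)) xy∈A
        where
        n = a (fst w)
        vk = pair (snd (fst n)) (snd n)
      cases₂ : bitOneApart β l w ≡ 0 ⊎ outside p l w ≡ 0 → ⊥
      cases₂ (inj₁ h) = oneCase h
      cases₂ (inj₂ h) = outsideCase h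
      cases : bitZero β l w ≡ 0 ⊎ bitOneApart β l w ℕ.* outside p l w ≡ 0 → ⊥
      cases (inj₁ h) = zeroCase h
      cases (inj₂ h) = cases₂ (ℕₚ.m*n≡0⇒m≡0∨n≡0 (bitOneApart β l w) h)

    -- A removed ball comes with a finite cover of `Y`. Some member contains `y`, but each member
    -- has a witness against this if t lies in the removed ball.
    codes⇒survives : ∀ {p x t y} → CauchyName (space X) p x → Codes x t y → Survives p t
    codes⇒survives {p} {x} {t} {y} p-name codes (n , t∈) =
      let e , cov≡ , all≡0 , t∈β = emit-elim p t β s (cov N) t∈
          L , L≡ = encodeList-surjective e
      in refute L (Equivalence.from (cov-covers L) (N , trans cov≡ (cong suc (sym L≡))) y)
           (allItems-elim (λ l → anyBelow (unrelated p β l) s) {L} (trans (cong (allUnrelated p β s) L≡) all≡0)) t∈β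
      where
      β = fst n
      N = fst (snd n)
      s = snd (snd n)
      refute : ∀ L → Any (λ l → y ∈ Y.Ball l) L → All (λ l → anyBelow (unrelated p β l) s ≡ 0) L → ¬ (t ∈ 𝕀.Ball β)
      refute (l ∷ L) (Any.here y∈l) (h ∷ _) t∈β =
        let w , w≡0 = anyBelow-elim (unrelated p β l) s h
        in unrelated-sound {t = t} {y} p-name codes w t∈β y∈l w≡0
      refute (l ∷ L) (Any.there y∈L) (_ ∷ h) t∈β = refute L y∈L h t∈β

    -- Membership in the l-th ball is the l-th bit of a code.
    code-exists : ∀ x y → (x , y) ∈ member A → ∃[ t ] Codes x t y
    code-exists x y xy∈A = point , xy∈A , λ j →
      (λ (h , odd , t∈) → <ᴿ⇒≤ᴿ (bit-1 j em (trans (sym (point∈bitBall j h t∈)) odd))) ,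
      (λ (h , even , t∈) → bit-0 j em (trans (sym (point∈bitBall j h t∈)) even))
      where
      bit : ∀ {P : Set} → Dec P → ℕ
      bit (yes _) = 1
      bit (no _)  = 0
      bit≤1 : ∀ {P : Set} (P? : Dec P) → bit P? ℕ.≤ 1
      bit≤1 (yes _) = ℕ.s≤s ℕ.z≤n
      bit≤1 (no _)  = ℕ.z≤n
      bit-1 : ∀ j (y∈j? : Dec (y ∈ Y.Ball j)) → bit y∈j? ≡ 1 → y ∈ Y.Ball j
      bit-1 j (yes y∈j) _ = y∈j
      bit-0 : ∀ j (y∈j? : Dec (y ∈ Y.Ball j)) → bit y∈j? ≡ 0 → ¬ (y ∈ Y.Ball j)
      bit-0 j (no y∉j) _ = y∉j
      open BitPoint (λ j → bit (em {y ∈ Y.Ball j})) (λ j → bit≤1 (em {y ∈ Y.Ball j}))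

    module _ {p q x t} (p-name : CauchyName (space X) p x) (q-name : CauchyName unitInterval q t) where

      Unrelated : ℕ → ℕ → Set
      Unrelated l n = ∃[ w ] unrelated p (nameBall q n) l w ≡ 0

      private
        *-introʳ : ∀ m {n} → n ≡ 0 → m ℕ.* n ≡ 0
        *-introʳ m refl = ℕₚ.*-zeroʳ m

        *-introˡ : ∀ {m} n → m ≡ 0 → m ℕ.* n ≡ 0
        *-introˡ n refl = refl

      bitZero-intro : ∀ {l} → HasBit 0 l t → Eventually (Unrelated l)
      bitZero-intro {l} (h , even , t∈) = ev-map
        (λ n e → pair h n , *-introˡ _ (subst₂ (λ h r → parity h ℕ.+ FI.inside r (nameBall q n) (bitBall l h) ≡ 0)
           (sym (fst-pair h n)) (sym (snd-pair h n)) (cong₂ ℕ._+_ even e)))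
        (FI.inside-complete q-name t∈)

      bitOneApart-intro : ∀ {l j s} → HasBit 1 j t → FY.apart s j l ≡ 0 → Eventually (Unrelated l)
      bitOneApart-intro {l} {j} {s} (h , odd , t∈) apart = ev-map
        (λ n e → let w = pair (pair h j) (pair n s) in w ,
           *-introʳ (bitZero (nameBall q n) l w) (*-introˡ _ (holds n w
             (trans (cong fst (fst-pair (pair h j) (pair n s))) (fst-pair h j))
             (trans (cong snd (fst-pair (pair h j) (pair n s))) (snd-pair h j))
             (trans (cong fst (snd-pair (pair h j) (pair n s))) (fst-pair n s))
             (trans (cong snd (snd-pair (pair h j) (pair n s))) (snd-pair n s)) e)))
        (FI.inside-complete q-name t∈)
        where
        holds : ∀ n w → fst (fst w) ≡ h → snd (fst w) ≡ j → fst (snd w) ≡ n → snd (snd w) ≡ s →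
                FI.inside n (nameBall q n) (bitBall j h) ≡ 0 → bitOneApart (nameBall q n) l w ≡ 0
        holds n w h≡ j≡ n≡ s≡ e = cong₂ ℕ._+_ (cong (1 ℕ.∸_) (trans (cong parity h≡) odd))
          (cong₂ ℕ._+_
            (trans (cong₂ (λ r b → FI.inside r (nameBall q n) b) n≡ (cong₂ bitBall j≡ h≡)) e)
            (trans (cong₂ (λ s j → FY.apart s j l) s≡ j≡) apart))

      -- This test does not look at the ball around t, so one witness serves every stage.
      outside-intro : ∀ {y} n → (x , y) ∈ SeparableMetricSpace.Ball (space X ⊗ space Y) (a n) →
                      ∃[ l ] Eventually (Unrelated l) × y ∈ Y.Ball l
      outside-intro n xy∈ =
        let x∈ , y∈ = Equivalence.to (ball-⊗ (a n)) xy∈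
            r , e   = ev-witness (FX.inside-complete p-name x∈)
            vk      = pair (snd (fst (a n))) (snd (a n))
            uk      = pair (fst (fst (a n))) (snd (a n))
            w       = pair n r
            holds : outside p vk w ≡ 0
            holds = cong₂ ℕ._+_
              (trans (cong (λ n → differ vk (pair (snd (fst (a n))) (snd (a n)))) (fst-pair n r)) (differ-refl vk))
              (trans (cong₂ (λ n r → FX.inside r (nameBall p r) (pair (fst (fst (a n))) (snd (a n)))) (fst-pair n r) (snd-pair n r)) e)
        in vk , always (λ m → w , *-introʳ (bitZero (nameBall q m) vk w) (*-introʳ (bitOneApart (nameBall q m) vk w) holds)) , y∈

      unrelated-complete : ∀ y → ¬ Codes x t y → ∃[ l ] Eventually (Unrelated l) × y ∈ Y.Ball l
      unrelated-complete y ¬codes = cases em em em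
        where
        cases : Dec ((x , y) ∈ member A) →
                Dec (∃[ j ] HasBit 1 j t × real (νℚ (snd j)) <ᴿ Y.d (Y.α (fst j)) y) →
                Dec (∃[ j ] HasBit 0 j t × y ∈ Y.Ball j) → ∃[ l ] Eventually (Unrelated l) × y ∈ Y.Ball l
        cases (no xy∉A) _ _ = let n , xy∈ = Equivalence.to (a-name (x , y)) xy∉A in outside-intro n xy∈
        cases (yes _) (yes (j , bit , far)) _ =
          let l , s , apart , y∈l = FY.apart-complete y far in l , bitOneApart-intro bit apart , y∈l
        cases (yes _) (no _) (yes (l , bit , y∈l)) = l , bitZero-intro bit , y∈l
        -- A point not strictly outside a ball lies in the closed ball, which is all that bit 1
        -- demands.
        cases (yes xy∈A) (no ¬1) (no ¬0) = ⊥-elim (¬codes (xy∈A , λ j →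
          (λ bit → ≮-real⇒≥ λ far → ¬1 (j , bit , far)) , (λ bit y∈j → ¬0 (j , bit , y∈j))))

      bound : ∀ {n} L → All (λ l → Unrelated l n) L →
              ∃[ s ] All (λ l → anyBelow (unrelated p (nameBall q n) l) s ≡ 0) L
      bound L h = let s , h′ = go h in s , All.map (λ (w , w<s , w≡0) → anyBelow-intro _ w<s w≡0) h′
        where
        go : ∀ {n L} → All (λ l → Unrelated l n) L →
             ∃[ s ] All (λ l → ∃[ w ] w ℕ.< s × unrelated p (nameBall q n) l w ≡ 0) L
        go []              = 0 , []
        go ((w , w≡0) ∷ h) = let s , h′ = go h in suc w ℕ.⊔ s ,
          (w , ℕₚ.m≤m⊔n (suc w) s , w≡0) ∷
          All.map (λ (v , v<s , v≡0) → v , ℕₚ.≤-trans v<s (ℕₚ.m≤n⊔m (suc w) s) , v≡0) h′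

      -- If no `y` were coded, every `y` would lie in a ball that is unrelated from some stage on.
      -- Compactness leaves finitely many of them, so a common stage and a common witness bound
      -- exist, and the ball around t of that stage would be removed.
      survives⇒codes : Survives p t → ∃[ y ] Codes x t y
      survives⇒codes survives = decidable-stable em λ ¬∃ →
        -- The index carries the stage, so the finite subcover keeps this information.
        let Index = Σ[ l ∈ ℕ ] Eventually (Unrelated l)
            I , covers = compact {Index} (λ (l , _) → Y.Ball l) (λ (l , _) → ball-open (space Y) l)
              (λ y → let l , un , y∈l = unrelated-complete y (λ codes → ¬∃ (y , codes)) in (l , un) , y∈l)
            L = map proj₁ I
            N , cov≡ = Equivalence.to (cov-covers L) (λ y → Anyₚ.map⁺ (covers y))
            n , un = ev-witness (eventually-all I)
            s , un≡0 = bound L un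
        in removed N n s L cov≡ un≡0
        where
        eventually-all : (I : List (Σ[ l ∈ ℕ ] Eventually (Unrelated l))) →
                         Eventually λ n → All (λ l → Unrelated l n) (map proj₁ I)
        eventually-all []             = always λ _ → []
        eventually-all ((_ , un) ∷ I) = ev-map₂ (λ _ → _∷_) un (eventually-all I)
        removed : ∀ N n s L → cov N ≡ suc (encodeList L) →
                  All (λ l → anyBelow (unrelated p (nameBall q n) l) s ≡ 0) L → ⊥
        removed N n s L cov≡ un≡0 = survives (pair β (pair N s) , subst (λ k → t ∈ 𝕀.Ball k) (sym ball≡) (name∈nameBall unitInterval q-name n))
          where
          β = nameBall q n
          emit≡ : ∀ c → c ≡ suc (encodeList L) → emit p β s c ≡ β
          emit≡ _ refl = cong (natrec β (λ _ _ → 0)) (allItems-intro _ un≡0)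
          ball≡ : removedBall p (pair β (pair N s)) ≡ β
          ball≡ = trans (cong₂ (λ β m → emit p β (snd m) (cov (fst m))) (fst-pair β (pair N s)) (snd-pair β (pair N s)))
            (trans (cong₂ (λ N s → emit p β s (cov N)) (fst-pair N s) (snd-pair N s)) (emit≡ (cov N) cov≡))

      locates-sound : ∀ {y} w n → Codes x t y → locates q w n ≡ 0 → Y.d (Y.α (fst (fst w))) y <ᴿ real (½^ suc n)
      locates-sound {y} w n (_ , admits) e = ≤-<ᴿ-trans
        (proj₁ (admits j) (h , ∸-parity h (ℕₚ.m+n≡0⇒m≡0 (1 ℕ.∸ parity h) e) ,
          FI.inside-sound t (ℕₚ.m+n≡0⇒m≡0 inside e₂) (name∈nameBall unitInterval q-name r)))
        (real-mono-< (subst (νℚ (snd j) ℚ.<_) (trans (νℚ-dyadic 1 (suc n)) (1/2^ (suc n)))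
          (lessℚ-sound (snd j) (dyadic 1 (suc n)) (ℕₚ.m+n≡0⇒n≡0 inside e₂))))
        where
        j = fst w
        h = fst (snd w)
        r = snd (snd w)
        inside = FI.inside r (nameBall q r) (bitBall j h)
        e₂ = ℕₚ.m+n≡0⇒n≡0 (1 ℕ.∸ parity h) e

      -- Take a small ball containing `y`. Some bit ball contains t; an even one would forbid `y`
      -- from lying in that small ball, so its index is odd.
      locates-complete : ∀ {y} → Codes x t y → ∀ n → ∃[ w ] locates q w n ≡ 0
      locates-complete {y} (_ , admits) n =
        let i , near = Y.α-dense y (½^ suc (suc n)) (½^-pos (suc (suc n)))
            j        = pair i (dyadic 1 (suc (suc n)))
            h , t∈   = bitBalls-cover j t
            odd      = one-bit j h t∈ (ball-intro (space Y) (trans (νℚ-dyadic 1 (suc (suc n))) (1/2^ (suc (suc n)))) near)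
            r , e    = ev-witness (FI.inside-complete q-name t∈)
            w        = pair j (pair h r)
        in w , holds i h r w (fst-pair j (pair h r))
                 (trans (cong fst (snd-pair j (pair h r))) (fst-pair h r))
                 (trans (cong snd (snd-pair j (pair h r))) (snd-pair h r)) odd e
        where
        one-bit : ∀ j h → t ∈ 𝕀.Ball (bitBall j h) → y ∈ Y.Ball j → parity h ≡ 1
        one-bit j h t∈ y∈j = go (ℕₚ.n≤1⇒n≡0∨n≡1 (parity≤1 h))
          where
          go : parity h ≡ 0 ⊎ parity h ≡ 1 → parity h ≡ 1
          go (inj₁ even) = ⊥-elim (proj₂ (admits j) (h , even , t∈) y∈j)
          go (inj₂ odd)  = odd
        holds : ∀ i h r w → fst w ≡ pair i (dyadic 1 (suc (suc n))) → fst (snd w) ≡ h → snd (snd w) ≡ r → parity h ≡ 1 →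
                FI.inside r (nameBall q r) (bitBall (pair i (dyadic 1 (suc (suc n)))) h) ≡ 0 → locates q w n ≡ 0
        holds i h r w j≡ h≡ r≡ odd e = cong₂ ℕ._+_ (cong (1 ℕ.∸_) (trans (cong parity h≡) odd)) (cong₂ ℕ._+_
          (trans (cong₂ (λ r b → FI.inside r (nameBall q r) b) r≡ (cong₂ bitBall j≡ h≡)) e)
          (lessℚ-complete (snd (fst w)) (dyadic 1 (suc n)) (subst₂ ℚ._<_
            (sym (trans (cong (λ j → νℚ (snd j)) j≡) (trans (cong νℚ (snd-pair i (dyadic 1 (suc (suc n))))) (νℚ-dyadic 1 (suc (suc n))))))
            (trans (/2^-suc 1 (suc n)) (sym (νℚ-dyadic 1 (suc n))))
            (/2^-mono-< (suc (suc n)) (ℕ.s≤s (ℕ.s≤s ℕ.z≤n))))))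

    encode-graph : ∀ p → graph encode p (removedBall p)
    encode-graph p n = Computes₁.correct removedBallᵖ p n

    survivors : 𝔹 → ClosedSubset unitInterval
    survivors p = record
      { member = Survives p
      ; resp   = λ {s} {t} s≈t ¬∃ (n , t∈) → ¬∃ (n , ball-resp unitInterval (removedBall p n) {t} {s} (𝕀-sym {s} {t} s≈t) t∈)
      ; closed = λ t ¬¬∃ →
          let n , t∈ = decidable-stable em ¬¬∃
              ε , 0<ε , ball⊆ = ball-open unitInterval (removedBall p n) t t∈
          in ε , 0<ε , λ s ts<ε ¬∃ → ¬∃ (n , ball⊆ s ts<ε)
      }
      where
      𝕀-sym : ∀ {s t} → s 𝕀.≈ t → t 𝕀.≈ s
      𝕀-sym {s} {t} = IsEquivalence.sym 𝕀.isEquivalence {s} {t}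

    survivors-name : ∀ p → ClosedName unitInterval (removedBall p) (survivors p)
    survivors-name p t = mk⇔ (decidable-stable em) (λ ∃t ¬∃t → ¬∃t ∃t)

    module _ {p q x y t} (p-name : CauchyName (space X) p x) (q-name : CauchyName unitInterval q t)
             (codes : Codes x t y) where

      private
        right-⟨,⟩ : ∀ (p q : 𝔹) r → right ⟨ p , q ⟩ r ≡ q r
        right-⟨,⟩ p q zero    = refl
        right-⟨,⟩ p q (suc r) = right-⟨,⟩ (λ i → p (suc i)) (λ i → q (suc i)) r

        right-name : CauchyName unitInterval (right ⟨ p , q ⟩) t
        right-name = Cauchy unitInterval .RepresentedSpace.δ .resp {q} {right ⟨ p , q ⟩} {t} {t}
          (λ r → sym (right-⟨,⟩ p q r)) (IsEquivalence.refl 𝕀.isEquivalence {t}) q-name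

        -- Completeness only makes the search halt; it may stop at another `w`, to which
        -- `locates-sound` applies as well.
        found : ∀ n → ∃[ w ] locates (right ⟨ p , q ⟩) w n ≡ 0 × ⟨ p , q ⟩ ⊢ minᶜ (Computes.code locatesᵖ) · n ∷ [] ⇓ w
        found n = let w , e = locates-complete p-name right-name codes n in search locatesᵖ ⟨ p , q ⟩ (n ∷ []) w e

      decoded : 𝔹
      decoded n = fst (fst (proj₁ (found n)))

      decode-graph : graph decode ⟨ p , q ⟩ decoded
      decode-graph n = comp⇓ (proj₂ (proj₂ (found n)) ∷ []) (Computes₁.correct centreᵖ ⟨ p , q ⟩ (proj₁ (found n)))

      decoded-near : ∀ n → Y.d (Y.α (decoded n)) y <ᴿ real (½^ suc n)
      decoded-near n = locates-sound p-name right-name (proj₁ (found n)) n codes (proj₁ (proj₂ (found n)))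

    -- Errors 2^-(i+1) and 2^-(j+1) with i < j add up to less than 2^-i, hence the exponent `suc n`
    -- in `locates`.
    near⇒name : ∀ {s y} → (∀ n → Y.d (Y.α (s n)) y <ᴿ real (½^ suc n)) → CauchyName (space Y) s y
    near⇒name {s} {y} near = record
      { rapid     = λ i j i<j → Y.triangle-< (Y.α (s i)) y (Y.α (s j)) (near i)
          (≤-<ᴿ-trans (d-flip (space Y) y (Y.α (s j)))
            (<-≤ᴿ-trans (near j) (real-mono-≤ (½^-anti {suc i} {suc j} (ℕ.s≤s (ℕₚ.<⇒≤ i<j))))))
      ; converges = λ ε 0<ε → let N , h = archimedean 0<ε in N , λ n N≤n →
          ≤ᴿ-trans (<ᴿ⇒≤ᴿ (near n)) (real-mono-≤ (ℚₚ.≤-trans (½^-anti {N} {suc n} (ℕₚ.m≤n⇒m≤1+n N≤n)) h))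
      }

    section-≤W-C-K : (∀ x → ∃[ y ] (x , y) ∈ member A) → section (space X) (space Y) A ≤W C-K em
    section-≤W-C-K total = decode , encode , functional-computable _ , functional-computable _ ,
      λ G realizes p x p-name (y , xy∈A) →
        -- This t only shows that the set of survivors is non-empty; the realizer returns a point
        -- `t′` of its own, which may code another solution `y′`.
        let t , codes = code-exists x y xy∈A
            q , Gq , t′ , q-name , t′∈ = realizes (removedBall p) (survivors p) (survivors-name p)
                                           (t , codes⇒survives {t = t} {y} p-name codes)
            y′ , codes′ = survives⇒codes p-name q-name t′∈
        in decoded p-name q-name codes′ ,
           (removedBall p , q , encode-graph p , Gq , decode-graph p-name q-name codes′) ,
           y′ , near⇒name (decoded-near p-name q-name codes′) , proj₁ codes′

theorem8p5 : (em : ExcludedMiddle 0ℓ)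
    (X Y : ComputableMetricSpace) →
    CoCeCompact (space Y) →
    (A : ClosedSubset (space X ⊗ space Y)) →
    CoCeClosed (space X ⊗ space Y) A →
    (∀ x → ∃[ y ] (x , y) ∈ member A) →
    section (space X) (space Y) A ≤W C-K em
theorem8p5 em X Y (compact , cov , cov-computable , cov-covers) A (a , a-computable , a-name) =
  Correct.section-≤W-C-K em compact cov-covers A a-name
  where open Reduction X Y (computableSeq cov-computable) (computableSeq a-computable)
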